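{- Let $n \geq 9$ and let $k \in \{1, 2, \dotsc, \lfloor n/2 \rfloor\}$. Then there exists a constant $a_k = \frac{n}{k} + \alpha_k$ with $|\alpha_k| \leq \frac{10}{n}$ such that \[ Q - \mathbbm{1} \;\subset\; P_k - \mathbbm{1} \;\subset\; a_k\,(Q - \mathbbm{1}). \]
   Context: Let $N = n(n-1)/2$ and index the coordinates of $\mathbb{R}^N$ by unordered pairs $\{i,j\}$ of distinct elements of $\{1,\dotsc,n\}$ (write $x_{ij}=x_{ji}$ for the $\{i,j\}$ coordinate). Let $X \subset \mathbb{R}^N$ be the set of incidence vectors of Hamiltonian cycles of the complete graph $K_n$: $x_{ij}=1$ if the cycle contains edge $\{i,j\}$ and $0$ otherwise ($|X| = (n-1)!/2$). Define $Q = \{ f: X \to \mathbb{R} : f \text{ is the restriction to } X \text{ of a linear function on } \mathbb{R}^N,\ f(x)\ge 0 \ \forall x\in X,\ \frac{1}{|X|}\sum_{x\in X} f(x) = 1\}$. For a function $f:X\to\mathbb{R}$, let $q_f$ be the quadratic form on the space $\mathcal{P}_k(\mathbb{R}^N)$ of real polynomials of degree at most $k$ on $\mathbb{R}^N$ given by $q_f(h) = \frac{1}{|X|}\sum_{x\in X} f(x) h(x)^2$. Define $P_k$ as the set of all $f:X\to\mathbb{R}$ that are restrictions to $X$ of linear functions on $\mathbb{R}^N$, have average value $1$ on $X$, and for which $q_f$ is positive semidefinite on $\mathcal{P}_k(\mathbb{R}^N)$. Let $\mathbbm{1}$ denote the constant function $1$ on $X$ (it is the restriction of the linear function $x \mapsto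 \frac1n\sum_{i<j} x_{ij}$). Sets of functions are translated and scaled pointwise: $S - \mathbbm{1} = \{f - \mathbbm{1}: f\in S\}$, $aS = \{af : f \in S\}$. -}

module Defs where

open import Algebra.Bundles using (RawMonoid)
import Algebra.Definitions.RawMonoid as Sums
open import Data.Bool.Base using (if_then_else_)
import Data.Bool.Properties as Bool
open import Data.Fin.Base as Fin using (Fin; toℕ)
import Data.Fin.Properties as Fin
open import Data.Fin.Subset using (Subset)
open import Data.Integer.Base using (+_)
open import Data.List.Base as List
  using (List; []; _∷_; length; filter; allFin; cartesianProduct; cartesianProductWith; deduplicate)
open import Data.List.Membership.Propositional using (_∈_)
open import Data.List.Membership.Propositional.Properties
  using (∈-map⁺; ∈-filter⁺; ∈-deduplicate⁺; ∈-allFin; ∈-cartesianProductWith⁺)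
open import Data.List.Relation.Unary.Any using (here)
open import Data.Nat.Base as ℕ using (ℕ; zero; suc; NonZero)
open import Data.Nat.DivMod using (_mod_)
import Data.Nat.Properties as ℕ
open import Data.Product.Base using (_×_; _,_; ∃; uncurry)
import Data.Product.Properties as Product
open import Data.Rational.Base as ℚ
  using (ℚ; 0ℚ; 1ℚ; ½; Positive; positive; 1/_; _/_)
import Data.Rational.Properties as ℚ
open import Data.Rational.Solver using (module +-*-Solver)
open import Data.Vec.Base as Vec using (Vec; []; _∷_)
open import Data.Vec.Bounded.Base as Vec≤ using (Vec≤)
open import Data.Vec.Functional using (Vector)
import Data.Vec.Properties as Vec
import Data.Vec.Relation.Unary.AllPairs as AllPairs
open import Data.Vec.Relation.Unary.Unique.Propositional using (Unique)
import Data.Vec.Relation.Unary.Unique.Propositional.Properties as Unique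
open import Data.Sum.Base using (_⊎_; inj₁; inj₂)
open import Function.Base using (id; _∘_)
open import Level using (0ℓ)
open import Relation.Binary.PropositionalEquality
  using (_≡_; refl; sym; trans; cong; cong₂; subst)
open import Relation.Nullary.Decidable using (Dec; does; ¬?; _⊎-dec_)
open import Relation.Unary using (Pred) renaming (_∈_ to _∈ˢ_)

-- A real number is a Cauchy sequence of rationals; equality of reals is
-- the setoid equality _≈_ below.

Eventually : (ℕ → Set) → Set
Eventually P = ∃ λ N → ∀ m → N ℕ.≤ m → P m

IsCauchy : (ℕ → ℚ) → Set
IsCauchy x = ∀ ε → 0ℚ ℚ.< ε →
  ∃ λ N → ∀ m n → N ℕ.≤ m → N ℕ.≤ n → ℚ.∣ x m ℚ.- x n ∣ ℚ.< ε

record ℝ : Set where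
  constructor mkℝ
  field
    seq    : ℕ → ℚ
    cauchy : IsCauchy seq
open ℝ public

infix 4 _≈_ _≤_

_≈_ : ℝ → ℝ → Set
x ≈ y = ∀ ε → 0ℚ ℚ.< ε → Eventually λ m → ℚ.∣ seq x m ℚ.- seq y m ∣ ℚ.< ε

-- The ε matters: x ≤ y must not depend on the representing sequences.
_≤_ : ℝ → ℝ → Set
x ≤ y = ∀ ε → 0ℚ ℚ.< ε → Eventually λ m → seq x m ℚ.< seq y m ℚ.+ ε

private
  0<½ε : ∀ {ε} → 0ℚ ℚ.< ε → 0ℚ ℚ.< ½ ℚ.* ε
  0<½ε {ε} 0<ε = ℚ.positive⁻¹ _ {{ℚ.pos*pos⇒pos ½ ε {{positive 0<ε}}}}

  ½+½ : ∀ ε → ½ ℚ.* ε ℚ.+ ½ ℚ.* ε ≡ ε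
  ½+½ ε = trans (sym (ℚ.*-distribʳ-+ ε ½ ½)) (ℚ.*-identityˡ ε)

  ∣∣≤-resp : ∀ {p q r} → p ≡ q → ℚ.∣ p ∣ ℚ.≤ r → ℚ.∣ q ∣ ℚ.≤ r
  ∣∣≤-resp refl p≤r = p≤r

  ≤-+⇒-≤ : ∀ {p r} q → p ℚ.≤ q ℚ.+ r → p ℚ.- r ℚ.≤ q
  ≤-+⇒-≤ {p} {r} q h = ℚ.≤-trans (ℚ.+-monoˡ-≤ (ℚ.- r) h)
    (ℚ.≤-reflexive (solve 2 (λ q r → (q :+ r) :- r := q) refl q r))
    where open +-*-Solver

  ∣∣-diff-+ : ∀ a b c d →
    ℚ.∣ (a ℚ.+ b) ℚ.- (c ℚ.+ d) ∣ ℚ.≤ ℚ.∣ a ℚ.- c ∣ ℚ.+ ℚ.∣ b ℚ.- d ∣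
  ∣∣-diff-+ a b c d = ∣∣≤-resp
    (solve 4 (λ a b c d → (a :- c) :+ (b :- d) := (a :+ b) :- (c :+ d)) refl a b c d)
    (ℚ.∣p+q∣≤∣p∣+∣q∣ (a ℚ.- c) (b ℚ.- d))
    where open +-*-Solver

  ∣∣-diff-* : ∀ a b c d →
    ℚ.∣ a ℚ.* b ℚ.- c ℚ.* d ∣ ℚ.≤ ℚ.∣ a ∣ ℚ.* ℚ.∣ b ℚ.- d ∣ ℚ.+ ℚ.∣ d ∣ ℚ.* ℚ.∣ a ℚ.- c ∣
  ∣∣-diff-* a b c d = ℚ.≤-trans
    (∣∣≤-resp
      (solve 4 (λ a b c d → a :* (b :- d) :+ d :* (a :- c) := a :* b :- c :* d) refl a b c d)
      (ℚ.∣p+q∣≤∣p∣+∣q∣ (a ℚ.* (b ℚ.- d)) (d ℚ.* (a ℚ.- c))))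
    (ℚ.≤-reflexive (cong₂ ℚ._+_ (ℚ.∣p*q∣≡∣p∣*∣q∣ a (b ℚ.- d)) (ℚ.∣p*q∣≡∣p∣*∣q∣ d (a ℚ.- c))))
    where open +-*-Solver

  ∣∣-split : ∀ a b → ℚ.∣ a ∣ ℚ.≤ ℚ.∣ a ℚ.- b ∣ ℚ.+ ℚ.∣ b ∣
  ∣∣-split a b = ∣∣≤-resp
    (solve 2 (λ a b → (a :- b) :+ b := a) refl a b)
    (ℚ.∣p+q∣≤∣p∣+∣q∣ (a ℚ.- b) b)
    where open +-*-Solver

  ∣∣-swap : ∀ a b → ℚ.∣ a ℚ.- b ∣ ≡ ℚ.∣ b ℚ.- a ∣
  ∣∣-swap a b = trans (sym (ℚ.∣-p∣≡∣p∣ (a ℚ.- b)))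
    (cong ℚ.∣_∣ (solve 2 (λ a b → :- (a :- b) := b :- a) refl a b))
    where open +-*-Solver

  ∣∣-diff-∣∣ : ∀ a b → ℚ.∣ ℚ.∣ a ∣ ℚ.- ℚ.∣ b ∣ ∣ ℚ.≤ ℚ.∣ a ℚ.- b ∣
  ∣∣-diff-∣∣ a b with ℚ.∣p∣≡p∨∣p∣≡-p (ℚ.∣ a ∣ ℚ.- ℚ.∣ b ∣)
  ... | inj₁ eq = ℚ.≤-trans (ℚ.≤-reflexive eq) (≤-+⇒-≤ _ (∣∣-split a b))
  ... | inj₂ eq = ℚ.≤-trans
    (ℚ.≤-reflexive (trans eq
      (solve 2 (λ p r → :- (p :- r) := r :- p) refl ℚ.∣ a ∣ ℚ.∣ b ∣)))
    (≤-+⇒-≤ _ (ℚ.≤-trans (∣∣-split b a)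
      (ℚ.≤-reflexive (cong (ℚ._+ ℚ.∣ a ∣) (∣∣-swap b a)))))
    where open +-*-Solver

  eventually-bounded : ∀ x → IsCauchy x →
    ∃ λ B → Positive B × Eventually λ m → ℚ.∣ x m ∣ ℚ.≤ B
  eventually-bounded x cx with N , h ← cx 1ℚ (ℚ.positive⁻¹ 1ℚ) =
    1ℚ ℚ.+ ℚ.∣ x N ∣
    , positive (ℚ.+-mono-<-≤ (ℚ.positive⁻¹ 1ℚ) (ℚ.0≤∣p∣ (x N)))
    , N
    , λ m N≤m → ℚ.≤-trans (∣∣-split (x m) (x N))
        (ℚ.+-monoˡ-≤ ℚ.∣ x N ∣ (ℚ.<⇒≤ (h m N N≤m ℕ.≤-refl)))

  scale : ∀ B ε → .{{_ : Positive B}} → 0ℚ ℚ.< ε →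
    ∃ λ δ → 0ℚ ℚ.< δ × B ℚ.* δ ≡ ε
  scale B ε 0<ε =
    1/B ℚ.* ε
    , ℚ.positive⁻¹ _ {{ℚ.pos*pos⇒pos 1/B {{ℚ.1/pos⇒pos B}} ε {{positive 0<ε}}}}
    , trans (sym (ℚ.*-assoc B 1/B ε))
        (trans (cong (ℚ._* ε) (ℚ.*-inverseʳ B {{ℚ.pos⇒nonZero B}})) (ℚ.*-identityˡ ε))
    where
    1/B : ℚ
    1/B = (1/ B) {{ℚ.pos⇒nonZero B}}

  *-bound : ∀ {p q B δ} → 0ℚ ℚ.≤ q → Positive B → p ℚ.≤ B → q ℚ.< δ → p ℚ.* q ℚ.< B ℚ.* δ
  *-bound {p} {q} {B} 0≤q B>0 p≤B q<δ = ℚ.≤-<-trans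
    (ℚ.*-monoʳ-≤-nonNeg q {{ℚ.nonNegative 0≤q}} p≤B)
    (ℚ.*-monoʳ-<-pos B {{B>0}} q<δ)

  *-close : ∀ {A B δ η} ε → Positive A → Positive B →
    A ℚ.* δ ≡ ½ ℚ.* ε → B ℚ.* η ≡ ½ ℚ.* ε →
    ∀ a b c d → ℚ.∣ a ∣ ℚ.≤ A → ℚ.∣ d ∣ ℚ.≤ B →
    ℚ.∣ b ℚ.- d ∣ ℚ.< δ → ℚ.∣ a ℚ.- c ∣ ℚ.< η →
    ℚ.∣ a ℚ.* b ℚ.- c ℚ.* d ∣ ℚ.< ε
  *-close {A} {B} {δ} {η} ε A>0 B>0 Aδ Bη a b c d a≤A d≤B bd<δ ac<η = begin-strict
    ℚ.∣ a ℚ.* b ℚ.- c ℚ.* d ∣                                    ≤⟨ ∣∣-diff-* a b c d ⟩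
    ℚ.∣ a ∣ ℚ.* ℚ.∣ b ℚ.- d ∣ ℚ.+ ℚ.∣ d ∣ ℚ.* ℚ.∣ a ℚ.- c ∣     <⟨ ℚ.+-mono-<
      (*-bound (ℚ.0≤∣p∣ (b ℚ.- d)) A>0 a≤A bd<δ)
      (*-bound (ℚ.0≤∣p∣ (a ℚ.- c)) B>0 d≤B ac<η) ⟩
    A ℚ.* δ ℚ.+ B ℚ.* η                                          ≡⟨ cong₂ ℚ._+_ Aδ Bη ⟩
    ½ ℚ.* ε ℚ.+ ½ ℚ.* ε                                          ≡⟨ ½+½ ε ⟩
    ε                                                            ∎
    where open ℚ.≤-Reasoning

  *-cauchy : ∀ x y → IsCauchy x → IsCauchy y → IsCauchy (λ m → x m ℚ.* y m)
  *-cauchy x y cx cy ε 0<ε =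
    choose-bounds (eventually-bounded x cx) (eventually-bounded y cy)
    where
    -- Matching on function arguments rather than by with, which would
    -- normalise the rational arithmetic.
    Bounded : (ℕ → ℚ) → Set
    Bounded z = ∃ λ B → Positive B × Eventually λ m → ℚ.∣ z m ∣ ℚ.≤ B

    Goal : Set
    Goal = ∃ λ K → ∀ m n → K ℕ.≤ m → K ℕ.≤ n → ℚ.∣ x m ℚ.* y m ℚ.- x n ℚ.* y n ∣ ℚ.< ε

    Close : (ℕ → ℚ) → ℚ → Set
    Close z δ = ∃ λ K → ∀ m n → K ℕ.≤ m → K ℕ.≤ n → ℚ.∣ z m ℚ.- z n ∣ ℚ.< δ

    combine : ∀ {A B δ η} → Positive A → Positive B →
      Eventually (λ m → ℚ.∣ x m ∣ ℚ.≤ A) → Eventually (λ m → ℚ.∣ y m ∣ ℚ.≤ B) →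
      A ℚ.* δ ≡ ½ ℚ.* ε → B ℚ.* η ≡ ½ ℚ.* ε → Close y δ → Close x η → Goal
    combine A>0 B>0 (L , x≤A) (M , y≤B) Aδ Bη (N , g) (O , h) =
      (L ℕ.⊔ M) ℕ.⊔ (N ℕ.⊔ O) , λ m n ≤m ≤n →
        *-close ε A>0 B>0 Aδ Bη (x m) (y m) (x n) (y n)
          (x≤A m (ℕ.m⊔n≤o⇒m≤o L M (ℕ.m⊔n≤o⇒m≤o (L ℕ.⊔ M) (N ℕ.⊔ O) ≤m)))
          (y≤B n (ℕ.m⊔n≤o⇒n≤o L M (ℕ.m⊔n≤o⇒m≤o (L ℕ.⊔ M) (N ℕ.⊔ O) ≤n)))
          (g m n (ℕ.m⊔n≤o⇒m≤o N O (ℕ.m⊔n≤o⇒n≤o (L ℕ.⊔ M) (N ℕ.⊔ O) ≤m))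
                 (ℕ.m⊔n≤o⇒m≤o N O (ℕ.m⊔n≤o⇒n≤o (L ℕ.⊔ M) (N ℕ.⊔ O) ≤n)))
          (h m n (ℕ.m⊔n≤o⇒n≤o N O (ℕ.m⊔n≤o⇒n≤o (L ℕ.⊔ M) (N ℕ.⊔ O) ≤m))
                 (ℕ.m⊔n≤o⇒n≤o N O (ℕ.m⊔n≤o⇒n≤o (L ℕ.⊔ M) (N ℕ.⊔ O) ≤n)))

    choose-δ : ∀ {A B} → Positive A → Positive B →
      Eventually (λ m → ℚ.∣ x m ∣ ℚ.≤ A) → Eventually (λ m → ℚ.∣ y m ∣ ℚ.≤ B) →
      (∃ λ δ → 0ℚ ℚ.< δ × A ℚ.* δ ≡ ½ ℚ.* ε) →
      (∃ λ η → 0ℚ ℚ.< η × B ℚ.* η ≡ ½ ℚ.* ε) → Goal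
    choose-δ A>0 B>0 ex ey (δ , 0<δ , Aδ) (η , 0<η , Bη) =
      combine A>0 B>0 ex ey Aδ Bη (cy δ 0<δ) (cx η 0<η)

    choose-bounds : Bounded x → Bounded y → Goal
    choose-bounds (A , A>0 , ex) (B , B>0 , ey) =
      choose-δ A>0 B>0 ex ey
        (scale A (½ ℚ.* ε) {{A>0}} (0<½ε 0<ε)) (scale B (½ ℚ.* ε) {{B>0}} (0<½ε 0<ε))

fromℚ : ℚ → ℝ
fromℚ q = mkℝ (λ _ → q) λ ε 0<ε →
  0 , λ _ _ _ _ → subst (ℚ._< ε) (cong ℚ.∣_∣ (sym (ℚ.+-inverseʳ q))) 0<ε

0ℝ 1ℝ : ℝ
0ℝ = fromℚ 0ℚ
1ℝ = fromℚ 1ℚ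

infixl 7 _*_
infixl 6 _+_ _-_
infix  8 -_

_+_ : ℝ → ℝ → ℝ
mkℝ x cx + mkℝ y cy = mkℝ (λ m → x m ℚ.+ y m) c
  where
  c : IsCauchy (λ m → x m ℚ.+ y m)
  c ε 0<ε with N , h ← cx (½ ℚ.* ε) (0<½ε 0<ε) | M , g ← cy (½ ℚ.* ε) (0<½ε 0<ε) =
    N ℕ.⊔ M , λ m n ≤m ≤n → ℚ.<-respʳ-≡ (½+½ ε)
      (ℚ.≤-<-trans (∣∣-diff-+ (x m) (y m) (x n) (y n))
        (ℚ.+-mono-< (h m n (ℕ.m⊔n≤o⇒m≤o N M ≤m) (ℕ.m⊔n≤o⇒m≤o N M ≤n))
                    (g m n (ℕ.m⊔n≤o⇒n≤o N M ≤m) (ℕ.m⊔n≤o⇒n≤o N M ≤n))))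

-_ : ℝ → ℝ
- mkℝ x cx = mkℝ (λ m → ℚ.- x m) c
  where
  eq : ∀ a b → ℚ.∣ b ℚ.- a ∣ ≡ ℚ.∣ ℚ.- a ℚ.- ℚ.- b ∣
  eq a b = cong ℚ.∣_∣ (solve 2 (λ a b → b :- a := :- a :- :- b) refl a b)
    where open +-*-Solver

  c : IsCauchy (λ m → ℚ.- x m)
  c ε 0<ε with N , h ← cx ε 0<ε =
    N , λ m n ≤m ≤n → subst (ℚ._< ε) (eq (x m) (x n)) (h n m ≤n ≤m)

_-_ : ℝ → ℝ → ℝ
x - y = x + (- y)

_*_ : ℝ → ℝ → ℝ
mkℝ x cx * mkℝ y cy = mkℝ (λ m → x m ℚ.* y m) (*-cauchy x y cx cy)

∣_∣ : ℝ → ℝ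
∣ mkℝ x cx ∣ = mkℝ (λ m → ℚ.∣ x m ∣) c
  where
  c : IsCauchy (λ m → ℚ.∣ x m ∣)
  c ε 0<ε with N , h ← cx ε 0<ε =
    N , λ m n ≤m ≤n → ℚ.≤-<-trans (∣∣-diff-∣∣ (x m) (x n)) (h m n ≤m ≤n)

+-rawMonoid : RawMonoid 0ℓ 0ℓ
+-rawMonoid = record { Carrier = ℝ ; _≈_ = _≈_ ; _∙_ = _+_ ; ε = 0ℝ }

∑ : ∀ {n} → Vector ℝ n → ℝ
∑ = Sums.sum +-rawMonoid

-- The edge {i , j} of the complete graph is represented by (i , j), i < j.
edges : ∀ n → List (Fin n × Fin n)
edges n = filter (uncurry Fin._<?_) (cartesianProduct (allFin n) (allFin n))

N : ℕ → ℕ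
N n = length (edges n)

edge : ∀ n → Fin (N n) → Fin n × Fin n
edge n = List.lookup (edges n)

_Joins_,_ : ∀ {n} → Fin n × Fin n → Fin n → Fin n → Set
e Joins i , j = e ≡ (i , j) ⊎ e ≡ (j , i)

joins? : ∀ {n} (e : Fin n × Fin n) i j → Dec (e Joins i , j)
joins? e i j = (e ≟ (i , j)) ⊎-dec (e ≟ (j , i))
  where _≟_ = Product.≡-dec Fin._≟_ Fin._≟_

words : ∀ {A : Set} → List A → ∀ m → List (Vec A m)
words as zero    = [] ∷ []
words as (suc m) = cartesianProductWith _∷_ as (words as m)

unique? : ∀ {n m} (t : Vec (Fin n) m) → Dec (Unique t)
unique? = AllPairs.allPairs? (λ i j → ¬? (i Fin.≟ j))

-- The injective words of length n, i.e. the orderings of all n vertices.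
tours : ∀ n → List (Vec (Fin n) n)
tours n = filter unique? (words (allFin n) n)

next : ∀ {n} → Fin n → Fin n
next {suc n} i = suc (toℕ i) mod suc n

-- Edge set of the closed walk t₀ t₁ … tₙ₋₁ t₀.
incidence : ∀ {n} → Vec (Fin n) n → Subset (N n)
incidence {n} t = Vec.tabulate λ e →
  does (Fin.any? λ i → joins? (edge n e) (Vec.lookup t i) (Vec.lookup t (next i)))

-- A cycle arises from several orderings, hence the deduplication.
X : ∀ n → List (Subset (N n))
X n = deduplicate (Vec.≡-dec Bool._≟_) (List.map incidence (tours n))

∣X∣ : ℕ → ℕ
∣X∣ n = length (X n)

∣X∣-nonZero : ∀ n → NonZero (∣X∣ n)
∣X∣-nonZero n = ∈⇒nonZero
  (∈-deduplicate⁺ (Vec.≡-dec Bool._≟_)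
    (∈-map⁺ incidence
      (∈-filter⁺ unique? (∈-words id) (Unique.tabulate⁺ id))))
  where
  ∈⇒nonZero : ∀ {A : Set} {a : A} {as} → a ∈ as → NonZero (length as)
  ∈⇒nonZero {as = _ ∷ _} _ = _

  ∈-words : ∀ {m} (f : Fin m → Fin n) → Vec.tabulate f ∈ words (allFin n) m
  ∈-words {zero}  f = here refl
  ∈-words {suc m} f =
    ∈-cartesianProductWith⁺ _∷_ (∈-allFin (f Fin.zero)) (∈-words (f ∘ Fin.suc))

-- The points of X are listed without repetition, so a
-- function X → ℝ is a function of the position in that list.
FunX : ℕ → Set
FunX n = Vector ℝ (∣X∣ n)

point : ∀ n → Fin (∣X∣ n) → Vector ℝ (N n)
point n x e = if Vec.lookup (List.lookup (X n) x) e then 1ℝ else 0ℝ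

average : ∀ n → FunX n → ℝ
average n f = fromℚ ((+ 1 / ∣X∣ n) {{∣X∣-nonZero n}}) * ∑ f

IsLinear : ∀ n → FunX n → Set
IsLinear n f = ∃ λ (c : Vector ℝ (N n)) → ∀ x → f x ≈ ∑ (λ e → c e * point n x e)

-- Polynomials of degree at most k in d variables: sums of terms
-- (coefficient , monomial), a monomial being a product of at most k variables.
Poly : ℕ → ℕ → Set
Poly d k = List (ℝ × Vec≤ (Fin d) k)

eval : ∀ {d k} → Poly d k → Vector ℝ d → ℝ
eval h v = List.foldr (λ (c , m) s → c * monomial m + s) 0ℝ h
  where
  monomial : ∀ {k} → Vec≤ (Fin _) k → ℝ
  monomial m = List.foldr (λ i p → v i * p) 1ℝ (Vec≤.toList m)

q : ∀ n {k} → FunX n → Poly (N n) k → ℝ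
q n f h = average n λ x → f x * (eval h (point n x) * eval h (point n x))

Q : ∀ n → Pred (FunX n) 0ℓ
Q n f = IsLinear n f × (∀ x → 0ℝ ≤ f x) × average n f ≈ 1ℝ

P : ∀ n → ℕ → Pred (FunX n) 0ℓ
P n k f = IsLinear n f × average n f ≈ 1ℝ × (∀ (h : Poly (N n) k) → 0ℝ ≤ q n f h)

infixl 6 _-𝟙
infixr 7 _·_

_-𝟙 : ∀ {m} → Pred (Vector ℝ m) 0ℓ → Pred (Vector ℝ m) 0ℓ
(S -𝟙) g = ∃ λ f → f ∈ˢ S × (∀ x → g x ≈ f x - 1ℝ)

_·_ : ∀ {m} → ℝ → Pred (Vector ℝ m) 0ℓ → Pred (Vector ℝ m) 0ℓ
(a · S) g = ∃ λ f → f ∈ˢ S × (∀ x → g x ≈ a * f x)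

{-# OPTIONS --safe #-}

-- The inclusion Q ⊆ P_k holds because squares are nonnegative. For the other one take α = 10/n;
-- it is to be shown that f ∈ P_k satisfies f(x₀) ≥ 1 − a at every cycle x₀. Choose a matching of
-- ⌊n/2⌋ edges of x₀ and let w(x) = C(j, k), where j is the number of matching edges on the cycle x.
-- Since w is the sum of the squares of the monomials x_S over the k-subsets S of the matching,
-- Σ w f ≥ 0. By invariance under the permutations that preserve the matching, the moment Σ w(x) x_e
-- is g₀ on the matching, g₂ at the vertex missed by the matching (if n is odd), and g₁ elsewhere.
-- Adding up the n rotations of the matching along x₀ gives a weight whose moments take one value on
-- the edges of x₀ and another one off them, so linearity of f yields n W + G (f(x₀) − 1) ≥ 0 with
-- W = Σ w and G = ⌊n/2⌋ (g₀ − g₁). The degree equations express g₁ through W and J = ⌊n/2⌋ g₀ = Σ w j.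
-- Here J ≥ k W, and J is larger by the chance that a further matching edge lies on a cycle x ⊇ S,
-- which is estimated by permuting the r = n − 2k vertices outside S: at least r − k edges of x join
-- two of them. It remains to check that n W / G ≤ n/k + 10/n, a polynomial inequality.

module Submission where

-- The degree equations make G close to J - W. Hence J ≥ k W alone gives only a constant near n/(k -
-- 1), which is no bound at all for k = 1. The chance of a further matching edge adds about (r -
-- k)/r, nearly 1 when n is large compared with k, and so restores n/k. To leading order the excess
-- over n/k is then at most 2/r for k < r and (n - k)/k² for r ≤ k, hence at most 6/n in both
-- ranges; the constant 10 leaves room for the lower-order terms when n is small. One matching
-- covers only about half of the edges of x₀, whereas f(x₀) depends on all of them alike. A weighted
-- sum of f gives information on f(x₀) and the average alone only if the moments of the weight are
-- determined by the coordinates of x₀, which is what the rotations achieve. The bound f ≥ 1 - a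
-- yields the inclusion because 1 + (f - 1)/a is again linear with average 1. The counting takes
-- place in natural numbers, with differences such as g₀ - g₁ spread over the two sides of an
-- equation; the real numbers enter only when f is paired with the moments.

module Combinatorics where

  import Defs
  open Defs using (next; edges; edge; N; joins?; _Joins_,_; words; tours; unique?; incidence; X; ∣X∣)
  import Algebra.Properties.Semiring.Sum as SemiringSum
  open import Data.Bool.Base using (Bool; true; false; not; if_then_else_)
  import Data.Bool.Properties as Bool
  open import Data.Fin.Base as Fin using (Fin; zero; suc; toℕ)
  open import Data.Fin.Permutation as Perm using (Permutation′; _⟨$⟩ʳ_; _⟨$⟩ˡ_; _∘ₚ_)
  import Data.Fin.Properties as Fin
  open import Data.Fin.Subset using (Subset) renaming (∣_∣ to size)
  open import Data.List.Base as List using (List; []; _∷_; _++_; allFin; cartesianProduct; filter)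
  open import Data.List.Membership.Propositional using (_∈_)
  open import Data.List.Membership.Propositional.Properties
    using (∈-allFin; ∈-cartesianProduct⁺; ∈-cartesianProductWith⁺; ∈-deduplicate⁺; ∈-deduplicate⁻;
           ∈-filter⁺; ∈-filter⁻; ∈-lookup; ∈-map⁺; ∈-map⁻)
  open import Data.List.Relation.Unary.All as All using ()
  open import Data.List.Relation.Unary.AllPairs using (_∷_)
  open import Data.List.Relation.Unary.Any as Any using (here)
  import Data.List.Relation.Unary.Any.Properties as Any
  import Data.List.Relation.Unary.Unique.DecPropositional.Properties as UniqueList
  open import Data.List.Relation.Unary.Unique.Propositional renaming (Unique to UniqueL)
  open import Data.Nat.Base
  open import Data.Nat.Combinatorics renaming (_C_ to choose) using (nCk+nC[k+1]≡[n+1]C[k+1])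
  open import Data.Nat.DivMod using (m<n⇒m%n≡m; n%n≡0; m%n<n)
  open import Data.Nat.GeneralisedArithmetic using (fold; fold-+)
  open import Data.Nat.Properties
  open import Algebra.Properties.CommutativeSemigroup +-commutativeSemigroup
    using () renaming (interchange to +-interchange)
  open import Data.Nat.Solver using (module +-*-Solver)
  open import Data.Product.Base using (∃; _×_; _,_; proj₁; proj₂; uncurry)
  open import Data.Product.Properties using (,-injectiveˡ; ,-injectiveʳ)
  open import Data.Sum.Base using (_⊎_; inj₁; inj₂)
  open import Data.Vec.Base as Vec using (Vec; []; _∷_; lookup)
  import Data.Vec.Properties as Vec
  open import Data.Vec.Relation.Unary.Unique.Propositional using (Unique)
  import Data.Vec.Relation.Unary.Unique.Propositional.Properties as UniqueVec
  open import Function.Base using (_∘_; id)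
  open import Function.Definitions using (Injective)
  open import Relation.Binary.Definitions using (tri<; tri≈; tri>)
  open import Relation.Binary.PropositionalEquality hiding (J)
  open import Relation.Nullary.Decidable using (Dec; yes; no; does; dec-true; dec-false)
  open import Relation.Nullary.Negation using (¬_; contradiction)

  -- Finite sums of natural numbers.

  module Σ = SemiringSum +-*-semiring

  opaque

    -- Opaque, so that the summand can be inferred from the sum.
    sum : ∀ {n} → (Fin n → ℕ) → ℕ
    sum = Σ.sum

    sum-zero : (f : Fin 0 → ℕ) → sum f ≡ 0
    sum-zero f = refl

    sum-suc : ∀ {n} (f : Fin (suc n) → ℕ) → sum f ≡ f zero + sum (λ i → f (suc i))
    sum-suc f = refl

    sum-cong : ∀ {n} {f g : Fin n → ℕ} → (∀ i → f i ≡ g i) → sum f ≡ sum g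
    sum-cong = Σ.sum-cong-≗

    sum-+ : ∀ {n} (f g : Fin n → ℕ) → sum (λ i → f i + g i) ≡ sum f + sum g
    sum-+ = Σ.∑-distrib-+

    sum-swap : ∀ {m n} (f : Fin m → Fin n → ℕ) →
      sum (λ i → sum (f i)) ≡ sum (λ j → sum λ i → f i j)
    sum-swap = Σ.∑-comm

    sum-*ˡ : ∀ {n} c (f : Fin n → ℕ) → sum (λ i → c * f i) ≡ c * sum f
    sum-*ˡ c f = sym (Σ.*-distribˡ-sum c f)

    sum-*ʳ : ∀ {n} c (f : Fin n → ℕ) → sum (λ i → f i * c) ≡ sum f * c
    sum-*ʳ c f = sym (Σ.*-distribʳ-sum c f)

    sum-permute : ∀ {n} (f : Fin n → ℕ) (π : Permutation′ n) →
      sum f ≡ sum (λ i → f (π ⟨$⟩ʳ i))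
    sum-permute = Σ.sum-permute

    sum-mono : ∀ {n} {f g : Fin n → ℕ} → (∀ i → f i ≤ g i) → sum f ≤ sum g
    sum-mono {zero}  h = z≤n
    sum-mono {suc n} h = +-mono-≤ (h zero) (sum-mono (h ∘ suc))

    sum-const : ∀ n c → sum {n} (λ _ → c) ≡ n * c
    sum-const zero    c = refl
    sum-const (suc n) c = cong (c +_) (sum-const n c)

    term≤sum : ∀ {n} (f : Fin n → ℕ) i → f i ≤ sum f
    term≤sum f zero    = m≤m+n _ _
    term≤sum f (suc i) = ≤-trans (term≤sum (f ∘ suc) i) (m≤n+m _ _)

  suc² : ∀ {n} → Fin n → Fin (2 + n)
  suc² i = suc (suc i)

  ⟦_⟧ : Bool → ℕ
  ⟦ b ⟧ = if b then 1 else 0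

  δ : ∀ {n} → Fin n → Fin n → ℕ
  δ u v = ⟦ does (u Fin.≟ v) ⟧

  δ-refl : ∀ {n} (u : Fin n) → δ u u ≡ 1
  δ-refl u rewrite dec-true (u Fin.≟ u) refl = refl

  δ-≢ : ∀ {n} {u v : Fin n} → u ≢ v → δ u v ≡ 0
  δ-≢ {u = u} {v} u≢v rewrite dec-false (u Fin.≟ v) u≢v = refl

  opaque
    unfolding sum

    sum-δ : ∀ {n} (u : Fin n) (f : Fin n → ℕ) → sum (λ v → δ u v * f v) ≡ f u
    sum-δ {suc n} zero f = trans (cong (f zero + 0 +_) (trans (sum-const n 0) (*-zeroʳ n)))
      (trans (+-identityʳ _) (+-identityʳ _))
    sum-δ (suc u) f = sum-δ u (f ∘ suc)

  transpose-fst : ∀ {n} (i j : Fin n) → Perm.transpose i j ⟨$⟩ʳ i ≡ j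
  transpose-fst i j rewrite dec-true (i Fin.≟ i) refl = refl

  transpose-snd : ∀ {n} (i j : Fin n) → Perm.transpose i j ⟨$⟩ʳ j ≡ i
  transpose-snd i j with j Fin.≟ i
  ... | yes j≡i = j≡i
  ... | no  _   rewrite dec-true (j Fin.≟ j) refl = refl

  transpose-other : ∀ {n} (i j : Fin n) {k} → k ≢ i → k ≢ j → Perm.transpose i j ⟨$⟩ʳ k ≡ k
  transpose-other i j {k} k≢i k≢j
    rewrite dec-false (k Fin.≟ i) k≢i | dec-false (k Fin.≟ j) k≢j = refl

  -- A fixed matching of the vertices.

  -- The matched pairs are {2i, 2i+1}; for odd n the last vertex is its own mate.

  left right : ∀ {n} → Fin ⌊ n /2⌋ → Fin n
  left  {suc (suc n)} zero    = zero
  left  {suc (suc n)} (suc i) = suc (suc (left i))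
  right {suc (suc n)} zero    = suc zero
  right {suc (suc n)} (suc i) = suc (suc (right i))

  mate : ∀ {n} → Fin n → Fin n
  mate {suc zero}    zero          = zero
  mate {suc (suc n)} zero          = suc zero
  mate {suc (suc n)} (suc zero)    = zero
  mate {suc (suc n)} (suc (suc v)) = suc (suc (mate v))

  mate-involutive : ∀ {n} (v : Fin n) → mate (mate v) ≡ v
  mate-involutive {suc zero}    zero          = refl
  mate-involutive {suc (suc n)} zero          = refl
  mate-involutive {suc (suc n)} (suc zero)    = refl
  mate-involutive {suc (suc n)} (suc (suc v)) = cong suc² (mate-involutive v)

  mate-injective : ∀ {n} {u v : Fin n} → mate u ≡ mate v → u ≡ v
  mate-injective {u = u} {v} e =
    trans (sym (mate-involutive u)) (trans (cong mate e) (mate-involutive v))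

  mate-left : ∀ {n} (i : Fin ⌊ n /2⌋) → mate (left i) ≡ right i
  mate-left {suc (suc n)} zero    = refl
  mate-left {suc (suc n)} (suc i) = cong suc² (mate-left i)

  mate-right : ∀ {n} (i : Fin ⌊ n /2⌋) → mate (right i) ≡ left i
  mate-right {suc (suc n)} zero    = refl
  mate-right {suc (suc n)} (suc i) = cong suc² (mate-right i)

  left≢right : ∀ {n} (i : Fin ⌊ n /2⌋) → left {n} i ≢ right i
  left≢right {suc (suc n)} (suc i) e = left≢right i (Fin.suc-injective (Fin.suc-injective e))

  toℕ-right : ∀ {n} (i : Fin ⌊ n /2⌋) → toℕ (right {n} i) ≡ suc (toℕ (left {n} i))
  toℕ-right {suc (suc n)} zero    = refl
  toℕ-right {suc (suc n)} (suc i) = cong (2 +_) (toℕ-right i)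

  odd : ℕ → ℕ
  odd zero          = 0
  odd (suc zero)    = 1
  odd (suc (suc n)) = odd n

  halves : ∀ n → n ≡ ⌊ n /2⌋ + ⌊ n /2⌋ + odd n
  halves zero          = refl
  halves (suc zero)    = refl
  halves (suc (suc n)) = cong suc (trans (cong suc (halves n))
    (cong (_+ odd n) (sym (+-suc ⌊ n /2⌋ ⌊ n /2⌋))))

  -- The indicator of the vertex missed by the matching, identically 0 for even n.
  single : ∀ {n} → Fin n → ℕ
  single v = δ (mate v) v

  opaque
    unfolding sum

    sum-pairs : ∀ {n} (f : Fin n → ℕ) →
      sum f ≡ sum (λ i → f (left i) + f (right i)) + sum (λ v → single v * f v)
    sum-pairs {zero} f = refl
    sum-pairs {suc zero} f = sym (cong (_+ 0) (+-identityʳ (f zero)))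
    sum-pairs {suc (suc n)} f = trans
      (cong (λ s → f zero + (f (suc zero) + s)) (sum-pairs (f ∘ suc²)))
      (solve 4 (λ a b c d → a :+ (b :+ (c :+ d)) := ((a :+ b) :+ c) :+ d) refl
        (f zero) (f (suc zero)) _ _)
      where open +-*-Solver

  opaque
    unfolding sum

    sum-single : ∀ {n} → sum (single {n}) ≡ odd n
    sum-single {zero} = refl
    sum-single {suc zero} = refl
    sum-single {suc (suc n)} = sum-single {n}

  single-unique : ∀ {n} {u v : Fin n} → mate u ≡ u → mate v ≡ v → u ≡ v
  single-unique {suc zero} {zero} {zero} _ _ = refl
  single-unique {suc (suc n)} {suc (suc u)} {suc (suc v)} e e′ = cong suc²
    (single-unique (Fin.suc-injective (Fin.suc-injective e)) (Fin.suc-injective (Fin.suc-injective e′)))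

  -- The vertex missed by the matching counts as uncovered, so that it may be exchanged with the
  -- other vertices outside `s`.
  covers : ∀ {n} → Subset ⌊ n /2⌋ → Fin n → Bool
  covers {suc zero}    s       zero          = false
  covers {suc (suc n)} (b ∷ s) zero          = b
  covers {suc (suc n)} (b ∷ s) (suc zero)    = b
  covers {suc (suc n)} (b ∷ s) (suc (suc v)) = covers s v

  covers-left : ∀ {n} (s : Subset ⌊ n /2⌋) i → covers s (left {n} i) ≡ lookup s i
  covers-left {suc (suc n)} (b ∷ s) zero    = refl
  covers-left {suc (suc n)} (b ∷ s) (suc i) = covers-left s i

  covers-right : ∀ {n} (s : Subset ⌊ n /2⌋) i → covers s (right {n} i) ≡ lookup s i
  covers-right {suc (suc n)} (b ∷ s) zero    = refl
  covers-right {suc (suc n)} (b ∷ s) (suc i) = covers-right s i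

  pair-of : ∀ {n} (s : Subset ⌊ n /2⌋) v → covers s v ≡ true →
    ∃ λ i → lookup s i ≡ true × (v ≡ left i ⊎ v ≡ right i)
  pair-of {suc (suc n)} (b ∷ s) zero          e = zero , e , inj₁ refl
  pair-of {suc (suc n)} (b ∷ s) (suc zero)    e = zero , e , inj₂ refl
  pair-of {suc (suc n)} (b ∷ s) (suc (suc v)) e with pair-of s v e
  ... | i , sᵢ , inj₁ refl = suc i , sᵢ , inj₁ refl
  ... | i , sᵢ , inj₂ refl = suc i , sᵢ , inj₂ refl

  opaque
    unfolding sum

    sum-size : ∀ {m} (s : Subset m) → sum (λ i → ⟦ lookup s i ⟧) ≡ size s
    sum-size []          = refl
    sum-size (true  ∷ s) = cong suc (sum-size s)
    sum-size (false ∷ s) = sum-size s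

  opaque
    unfolding sum

    sum-covers : ∀ {n} (s : Subset ⌊ n /2⌋) → sum (λ v → ⟦ covers {n} s v ⟧) ≡ size s + size s
    sum-covers {zero}        []          = refl
    sum-covers {suc zero}    []          = refl
    sum-covers {suc (suc n)} (true  ∷ s) = cong suc (trans (cong suc (sum-covers s)) (sym (+-suc _ _)))
    sum-covers {suc (suc n)} (false ∷ s) = sum-covers s

  -- Monomials and sums over the k-subsets of the matching.

  prod : ∀ {m} → Subset m → (Fin m → ℕ) → ℕ
  prod []          f = 1
  prod (true  ∷ s) f = f zero * prod s (f ∘ suc)
  prod (false ∷ s) f = prod s (f ∘ suc)

  prod-cong : ∀ {m} (s : Subset m) {f g} → (∀ i → lookup s i ≡ true → f i ≡ g i) →
    prod s f ≡ prod s g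
  prod-cong []          h = refl
  prod-cong (true  ∷ s) h = cong₂ _*_ (h zero refl) (prod-cong s (h ∘ suc))
  prod-cong (false ∷ s) h = prod-cong s (h ∘ suc)

  Boolean : ℕ → Set
  Boolean a = a ≡ 0 ⊎ a ≡ 1

  prod-boolean : ∀ {m} (s : Subset m) {f} → (∀ i → Boolean (f i)) → Boolean (prod s f)
  prod-boolean []          h = inj₂ refl
  prod-boolean (false ∷ s) h = prod-boolean s (h ∘ suc)
  prod-boolean (true  ∷ s) {f} h with h zero
  ... | inj₁ e rewrite e = inj₁ refl
  ... | inj₂ e rewrite e | +-identityʳ (prod s (f ∘ suc)) = prod-boolean s (h ∘ suc)

  prod≡1 : ∀ {m} (s : Subset m) {f} → prod s f ≡ 1 → ∀ i → lookup s i ≡ true → f i ≡ 1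
  prod≡1 (true  ∷ s) {f} e zero    sᵢ = m*n≡1⇒m≡1 _ _ e
  prod≡1 (true  ∷ s) {f} e (suc i) sᵢ = prod≡1 s (m*n≡1⇒n≡1 (f zero) _ e) i sᵢ
  prod≡1 (false ∷ s) e (suc i) sᵢ = prod≡1 s e i sᵢ

  -- The sum over the subsets of size `k`, by the recursion of Pascal's rule, so that `sumSub-prod`
  -- becomes an induction.
  sumSub : (m k : ℕ) → (Subset m → ℕ) → ℕ
  sumSub zero    zero    F = F []
  sumSub zero    (suc k) F = 0
  sumSub (suc m) zero    F = sumSub m zero (F ∘ (false ∷_))
  sumSub (suc m) (suc k) F = sumSub m k (F ∘ (true ∷_)) + sumSub m (suc k) (F ∘ (false ∷_))

  -- `K g` will say that the sum of g f over X is nonnegative. Leaving `K` arbitrary carries this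
  -- property from monomials to the weight without mentioning real numbers here.
  sumSub-closed : ∀ {A : Set} (K : (A → ℕ) → Set) →
    K (λ _ → 0) → (∀ {f g} → K f → K g → K (λ x → f x + g x)) →
    ∀ (m k : ℕ) (F : Subset m → A → ℕ) → (∀ s → size s ≡ k → K (F s)) →
    K (λ x → sumSub m k (λ s → F s x))
  sumSub-closed K K0 K+ zero    zero    F h = h [] refl
  sumSub-closed K K0 K+ zero    (suc k) F h = K0
  sumSub-closed K K0 K+ (suc m) zero    F h =
    sumSub-closed K K0 K+ m zero (F ∘ (false ∷_)) (λ s → h (false ∷ s))
  sumSub-closed K K0 K+ (suc m) (suc k) F h = K+
    (sumSub-closed K K0 K+ m k (F ∘ (true ∷_)) (λ s e → h (true ∷ s) (cong suc e)))
    (sumSub-closed K K0 K+ m (suc k) (F ∘ (false ∷_)) (λ s → h (false ∷ s)))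

  sumSub-rel : (_~_ : ℕ → ℕ → Set) → 0 ~ 0 → (∀ {a b c d} → a ~ b → c ~ d → (a + c) ~ (b + d)) →
    ∀ (m k : ℕ) {F G : Subset m → ℕ} → (∀ s → size s ≡ k → F s ~ G s) → sumSub m k F ~ sumSub m k G
  sumSub-rel _~_ 0~ +~ zero    zero    h = h [] refl
  sumSub-rel _~_ 0~ +~ zero    (suc k) h = 0~
  sumSub-rel _~_ 0~ +~ (suc m) zero    h = sumSub-rel _~_ 0~ +~ m zero (λ s → h (false ∷ s))
  sumSub-rel _~_ 0~ +~ (suc m) (suc k) h = +~
    (sumSub-rel _~_ 0~ +~ m k (λ s e → h (true ∷ s) (cong suc e)))
    (sumSub-rel _~_ 0~ +~ m (suc k) (λ s → h (false ∷ s)))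

  sumSub-cong : ∀ (m k : ℕ) {F G : Subset m → ℕ} → (∀ s → size s ≡ k → F s ≡ G s) →
    sumSub m k F ≡ sumSub m k G
  sumSub-cong = sumSub-rel _≡_ refl (cong₂ _+_)

  sumSub-mono : ∀ (m k : ℕ) {F G : Subset m → ℕ} → (∀ s → size s ≡ k → F s ≤ G s) →
    sumSub m k F ≤ sumSub m k G
  sumSub-mono = sumSub-rel _≤_ z≤n +-mono-≤

  sumSub-+ : ∀ (m k : ℕ) (F G : Subset m → ℕ) →
    sumSub m k (λ s → F s + G s) ≡ sumSub m k F + sumSub m k G
  sumSub-+ zero    zero    F G = refl
  sumSub-+ zero    (suc k) F G = refl
  sumSub-+ (suc m) zero    F G = sumSub-+ m zero (F ∘ (false ∷_)) (G ∘ (false ∷_))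
  sumSub-+ (suc m) (suc k) F G = trans
    (cong₂ _+_ (sumSub-+ m k (F ∘ (true ∷_)) (G ∘ (true ∷_)))
               (sumSub-+ m (suc k) (F ∘ (false ∷_)) (G ∘ (false ∷_))))
    (+-interchange (sumSub m k (F ∘ (true ∷_))) _ _ _)

  sumSub-* : ∀ (m k : ℕ) c (F : Subset m → ℕ) → sumSub m k (λ s → c * F s) ≡ c * sumSub m k F
  sumSub-* zero    zero    c F = refl
  sumSub-* zero    (suc k) c F = sym (*-zeroʳ c)
  sumSub-* (suc m) zero    c F = sumSub-* m zero c (F ∘ (false ∷_))
  sumSub-* (suc m) (suc k) c F = trans
    (cong₂ _+_ (sumSub-* m k c (F ∘ (true ∷_))) (sumSub-* m (suc k) c (F ∘ (false ∷_))))
    (sym (*-distribˡ-+ c _ _))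

  sumSub-sum : ∀ (m k : ℕ) {n} (F : Subset m → Fin n → ℕ) →
    sum (λ x → sumSub m k (λ s → F s x)) ≡ sumSub m k (λ s → sum (F s))
  sumSub-sum zero    zero    F = refl
  sumSub-sum zero    (suc k) {n} F = trans (sum-const n 0) (*-zeroʳ n)
  sumSub-sum (suc m) zero    F = sumSub-sum m zero (F ∘ (false ∷_))
  sumSub-sum (suc m) (suc k) F = trans (sum-+ _ _)
    (cong₂ _+_ (sumSub-sum m k (F ∘ (true ∷_))) (sumSub-sum m (suc k) (F ∘ (false ∷_))))

  opaque
    unfolding sum

    -- At a 0/1 vector the elementary symmetric polynomial of degree `k` counts the k-subsets of the
    -- support.
    sumSub-prod : ∀ (m k : ℕ) {f : Fin m → ℕ} → (∀ i → Boolean (f i)) →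
      sumSub m k (λ s → prod s f) ≡ choose (sum f) k
    sumSub-prod zero zero    h = refl
    sumSub-prod zero (suc k) h = refl
    sumSub-prod (suc m) zero h = sumSub-prod m zero (h ∘ suc)
    sumSub-prod (suc m) (suc k) {f} h with h zero
    ... | inj₁ e rewrite e = trans
      (cong₂ _+_ (sumSub-* m k 0 (λ s → prod s (f ∘ suc))) (sumSub-prod m (suc k) (h ∘ suc))) refl
    ... | inj₂ e rewrite e = trans
      (cong₂ _+_ (trans (sumSub-* m k 1 (λ s → prod s (f ∘ suc)))
                    (trans (*-identityˡ _) (sumSub-prod m k (h ∘ suc))))
                 (sumSub-prod m (suc k) (h ∘ suc)))
      (nCk+nC[k+1]≡[n+1]C[k+1] (sum (f ∘ suc)) k)

  sumSub-positive : ∀ (m k : ℕ) (F : Subset m → ℕ) → k ≤ m → (∀ s → 1 ≤ F s) → 1 ≤ sumSub m k F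
  sumSub-positive zero    zero    F k≤m h = h []
  sumSub-positive (suc m) zero    F k≤m h = sumSub-positive m zero _ z≤n (λ s → h (false ∷ s))
  sumSub-positive (suc m) (suc k) F (s≤s k≤m) h =
    ≤-trans (sumSub-positive m k _ k≤m (λ s → h (true ∷ s))) (m≤m+n _ _)

  -- Cycle systems, moments and their invariance.

  -- Cotransitivity leaves two cases: u′ is apart from v, or u′ is apart from u and the symmetry of g is used.
  constant-on-apart : ∀ {A : Set} (R : A → A → Set) (g : A → A → ℕ) →
    (∀ {u v} → R u v → R v u) → (∀ {u v} → R u v → ∀ w → R u w ⊎ R w v) →
    (∀ u v → g u v ≡ g v u) → (∀ {u u′ v} → R u v → R u′ v → g u v ≡ g u′ v) →
    ∀ {u v u′ v′} → R u v → R u′ v′ → g u v ≡ g u′ v′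
  constant-on-apart R g R-sym cotrans g-sym move {u} {v} {u′} {v′} uv u′v′ with cotrans uv u′
  ... | inj₂ u′v = trans (move uv u′v)
    (trans (g-sym u′ v) (trans (move (R-sym u′v) (R-sym u′v′)) (g-sym v′ u′)))
  ... | inj₁ uu′ = trans (g-sym u v) (trans (move (R-sym uv) (R-sym uu′))
    (trans (g-sym u′ u) (trans (move uu′ (R-sym u′v′)) (g-sym v′ u′))))

  -- The points of X through their adjacency matrices, with the action of the
  -- permutations of the vertices.
  record CycleSystem (n : ℕ) : Set where
    field
      M        : ℕ
      b        : Fin M → Fin n → Fin n → ℕ
      b-bool   : ∀ x u v → Boolean (b x u v)
      b-sym    : ∀ x u v → b x u v ≡ b x v u
      b-irrefl : ∀ x u → b x u u ≡ 0
      b-degree : ∀ x u → sum (b x u) ≡ 2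
      act      : Permutation′ n → Permutation′ M
      b-act    : ∀ σ x u v → b (act σ ⟨$⟩ʳ x) (σ ⟨$⟩ʳ u) (σ ⟨$⟩ʳ v) ≡ b x u v

  module Moments {n : ℕ} (cs : CycleSystem n) where
    open CycleSystem cs

    sum-act : ∀ σ (f : Fin M → ℕ) → sum f ≡ sum (λ x → f (act σ ⟨$⟩ʳ x))
    sum-act σ f = sum-permute f (act σ)

    moment : (Fin M → ℕ) → Fin n → Fin n → ℕ
    moment w u v = sum λ x → w x * b x u v

    moment-sym : ∀ w u v → moment w u v ≡ moment w v u
    moment-sym w u v = sum-cong λ x → cong (w x *_) (b-sym x u v)

    moment-irrefl : ∀ w u → moment w u u ≡ 0
    moment-irrefl w u = trans (sum-cong λ x → trans (cong (w x *_) (b-irrefl x u)) (*-zeroʳ (w x)))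
      (trans (sum-const M 0) (*-zeroʳ M))

    moment-degree : ∀ w u → sum (moment w u) ≡ 2 * sum w
    moment-degree w u = begin
      sum (λ v → sum λ x → w x * b x u v)  ≡⟨ sum-swap (λ v x → w x * b x u v) ⟩
      sum (λ x → sum λ v → w x * b x u v)  ≡⟨ (sum-cong λ x →
        trans (sum-*ˡ (w x) (b x u)) (trans (cong (w x *_) (b-degree x u)) (*-comm (w x) 2))) ⟩
      sum (λ x → 2 * w x)  ≡⟨ sum-*ˡ 2 w ⟩
      2 * sum w  ∎
      where open ≡-Reasoning

    moment-act : ∀ σ w u v →
      moment w (σ ⟨$⟩ʳ u) (σ ⟨$⟩ʳ v) ≡ moment (λ x → w (act σ ⟨$⟩ʳ x)) u v
    moment-act σ w u v = trans (sum-act σ _) (sum-cong λ x → cong (w _ *_) (b-act σ x u v))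

    moment-invariant : ∀ σ w → (∀ x → w (act σ ⟨$⟩ʳ x) ≡ w x) →
      ∀ u v → moment w (σ ⟨$⟩ʳ u) (σ ⟨$⟩ʳ v) ≡ moment w u v
    moment-invariant σ w inv u v =
      trans (moment-act σ w u v) (sum-cong λ x → cong (_* b x u v) (inv x))

    -- The transposition of `u` and `u′` fixes `v`, which differs from both.
    moment-move : ∀ w u u′ → (∀ x → w (act (Perm.transpose u u′) ⟨$⟩ʳ x) ≡ w x) →
      ∀ {v} → u ≢ v → u′ ≢ v → moment w u v ≡ moment w u′ v
    moment-move w u u′ inv {v} u≢v u′≢v = trans (sym (moment-invariant (Perm.transpose u u′) w inv u v))
      (cong₂ (moment w) (transpose-fst u u′) (transpose-other u u′ (u≢v ∘ sym) (u′≢v ∘ sym)))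

    ≢-cotransitive : ∀ {A : Set} → ((a b : A) → Dec (a ≡ b)) → {u v : A} → u ≢ v →
      ∀ w → u ≢ w ⊎ w ≢ v
    ≢-cotransitive _≟_ {u} {v} u≢v w with u ≟ w
    ... | no  u≢w  = inj₁ u≢w
    ... | yes refl = inj₂ u≢v

    -- The weight 1 is invariant under every permutation, so no edge is distinguished.
    count-constant : ∀ {u v u′ v′} → u ≢ v → u′ ≢ v′ →
      moment (λ _ → 1) u v ≡ moment (λ _ → 1) u′ v′
    count-constant = constant-on-apart _≢_ (moment (λ _ → 1)) (_∘ sym)
      (≢-cotransitive Fin._≟_) (moment-sym (λ _ → 1)) (λ {u} {u′} → moment-move (λ _ → 1) u u′ (λ _ → refl))

    pairs : Fin M → Fin ⌊ n /2⌋ → ℕ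
    pairs x i = b x (left i) (right i)

    pairs-bool : ∀ x i → Boolean (pairs x i)
    pairs-bool x i = b-bool x (left i) (right i)

    -- The monomial of a single subset of the matching.

    module OneSubset (s : Subset ⌊ n /2⌋) where

      k D r : ℕ
      k = size s
      D = sum λ i → ⟦ not (lookup s i) ⟧
      r = sum {n} λ v → ⟦ not (covers s v) ⟧

      ws : Fin M → ℕ
      ws x = prod s (pairs x)

      not+id : ∀ a → ⟦ not a ⟧ + ⟦ a ⟧ ≡ 1
      not+id true  = refl
      not+id false = refl

      r+2k : r + (k + k) ≡ n
      r+2k = begin
        r + (k + k)  ≡⟨ cong (r +_) (sum-covers s) ⟨
        r + sum {n} (λ v → ⟦ covers s v ⟧)  ≡⟨ sum-+ {n} _ _ ⟨
        sum {n} (λ v → ⟦ not (covers s v) ⟧ + ⟦ covers s v ⟧)  ≡⟨ sum-cong {n} (λ v → not+id (covers s v)) ⟩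
        sum {n} (λ _ → 1)  ≡⟨ sum-const n 1 ⟩
        n * 1  ≡⟨ *-identityʳ n ⟩
        n  ∎
        where open ≡-Reasoning

      D+k : D + k ≡ ⌊ n /2⌋
      D+k = begin
        D + k  ≡⟨ cong (D +_) (sum-size s) ⟨
        D + sum (λ v → ⟦ lookup s v ⟧)  ≡⟨ sum-+ _ _ ⟨
        sum (λ v → ⟦ not (lookup s v) ⟧ + ⟦ lookup s v ⟧)  ≡⟨ sum-cong (λ v → not+id (lookup s v)) ⟩
        sum {⌊ n /2⌋} (λ _ → 1)  ≡⟨ sum-const ⌊ n /2⌋ 1 ⟩
        ⌊ n /2⌋ * 1  ≡⟨ *-identityʳ _ ⟩
        ⌊ n /2⌋  ∎
        where open ≡-Reasoning

      W J : ℕ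
      W = sum ws
      J = sum λ i → moment ws (left i) (right i)

      ws-bool : ∀ x → Boolean (ws x)
      ws-bool x = prod-boolean s (pairs-bool x)

      -- Exchanging two uncovered vertices moves no endpoint of a chosen pair.
      ws-fixed : ∀ {u u′} → covers s u ≡ false → covers s u′ ≡ false →
        ∀ x → ws (act (Perm.transpose u u′) ⟨$⟩ʳ x) ≡ ws x
      ws-fixed {u} {u′} cu cu′ x = prod-cong s λ i sᵢ →
        trans (cong₂ (b _) (sym (fix (left i) (trans (covers-left s i) sᵢ)))
                           (sym (fix (right i) (trans (covers-right s i) sᵢ))))
              (b-act (Perm.transpose u u′) x (left i) (right i))
        where
        fix : ∀ v → covers s v ≡ true → Perm.transpose u u′ ⟨$⟩ʳ v ≡ v
        fix v cv = transpose-other u u′ (λ e → true≢false (trans (sym cv) (trans (cong (covers s) e) cu)))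
                                   (λ e → true≢false (trans (sym cv) (trans (cong (covers s) e) cu′)))
          where
          true≢false : true ≢ false
          true≢false ()

      Uncovered : Set
      Uncovered = ∃ λ v → covers {n} s v ≡ false

      uncovered-constant : ∀ (p q p′ q′ : Uncovered) → proj₁ p ≢ proj₁ q → proj₁ p′ ≢ proj₁ q′ →
        moment ws (proj₁ p) (proj₁ q) ≡ moment ws (proj₁ p′) (proj₁ q′)
      uncovered-constant p q p′ q′ = constant-on-apart
        {A = Uncovered} (λ p q → proj₁ p ≢ proj₁ q) (λ p q → moment ws (proj₁ p) (proj₁ q))
        (_∘ sym) (λ p≢q w → ≢-cotransitive Fin._≟_ p≢q (proj₁ w))
        (λ p q → moment-sym ws (proj₁ p) (proj₁ q))
        (λ { {u , cu} {u′ , cu′} → moment-move ws u u′ (ws-fixed cu cu′) })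
        {p} {q} {p′} {q′}

      ū : Fin n → ℕ
      ū v = ⟦ not (covers s v) ⟧

      -- Ordered pairs are summed, so this is twice the number of edges of `x` between uncovered
      -- vertices.
      inside : Fin M → ℕ
      inside x = sum λ u → sum λ v → ū u * ū v * b x u v

      -- Of the two edges at a covered vertex one is its chosen pair.
      covered-outside : ∀ x → ws x ≡ 1 → ∀ v → ⟦ covers s v ⟧ * sum (λ u → ū u * b x u v) ≤ ⟦ covers s v ⟧
      covered-outside x wx v with covers s v in cv
      ... | false = z≤n
      ... | true  = ≤-trans (≤-reflexive (+-identityʳ _)) (+-cancelʳ-≤ 1 _ _ (begin
        sum (λ u → ū u * b x u v) + 1  ≡⟨ cong (sum (λ u → ū u * b x u v) +_) mate-edge ⟨
        sum (λ u → ū u * b x u v) + ⟦ covers s (mate v) ⟧ * b x (mate v) v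
                                             ≤⟨ +-monoʳ-≤ _ (term≤sum (λ u → ⟦ covers s u ⟧ * b x u v) (mate v)) ⟩
        sum (λ u → ū u * b x u v) + sum (λ u → ⟦ covers s u ⟧ * b x u v)
                                             ≡⟨ sum-+ _ _ ⟨
        sum (λ u → ū u * b x u v + ⟦ covers s u ⟧ * b x u v)
                                             ≡⟨ (sum-cong λ u → trans (sym (*-distribʳ-+ (b x u v) (ū u) _))
                                                  (trans (cong (_* b x u v) (not+id (covers s u)))
                                                    (trans (*-identityˡ _) (b-sym x u v)))) ⟩
        sum (b x v)  ≡⟨ b-degree x v ⟩
        2  ∎))
        where
        open ≤-Reasoning
        mate-edge : ⟦ covers s (mate v) ⟧ * b x (mate v) v ≡ 1
        mate-edge with pair-of s v cv
        ... | i , sᵢ , inj₁ refl rewrite mate-left {n} i | covers-right {n} s i | sᵢ =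
          trans (+-identityʳ _) (trans (b-sym x _ _) (prod≡1 s wx i sᵢ))
        ... | i , sᵢ , inj₂ refl rewrite mate-right {n} i | covers-left {n} s i | sᵢ =
          trans (+-identityʳ _) (prod≡1 s wx i sᵢ)

      -- The degrees at the `r` uncovered vertices add up to 2r. Each of the 2k covered vertices
      -- takes at most one of these edge ends, by `covered-outside`; the others belong to edges
      -- inside.
      inside-bound : ∀ x → ws x ≡ 1 → r * 2 ≤ inside x + (k + k)
      inside-bound x wx = begin
        r * 2  ≡⟨ sum-*ʳ 2 ū ⟨
        sum (λ u → ū u * 2)  ≡⟨ (sum-cong λ u → cong (ū u *_) (sym (b-degree x u))) ⟩
        sum (λ u → ū u * sum (b x u))  ≡⟨ (sum-cong λ u → sym (sum-*ˡ (ū u) (b x u))) ⟩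
        sum (λ u → sum λ v → ū u * b x u v)  ≡⟨ (sum-cong λ u → sum-cong λ v → split u v) ⟩
        sum (λ u → sum λ v → ū u * ū v * b x u v + ⟦ covers s v ⟧ * (ū u * b x u v))
                                             ≡⟨ (sum-cong λ u → sum-+ _ _) ⟩
        sum (λ u → sum (λ v → ū u * ū v * b x u v) + sum λ v → ⟦ covers s v ⟧ * (ū u * b x u v))
                                             ≡⟨ sum-+ _ _ ⟩
        inside x + sum (λ u → sum λ v → ⟦ covers s v ⟧ * (ū u * b x u v))
                                             ≡⟨ cong (inside x +_) (sum-swap λ u v → ⟦ covers s v ⟧ * (ū u * b x u v)) ⟩
        inside x + sum (λ v → sum λ u → ⟦ covers s v ⟧ * (ū u * b x u v))
                                             ≡⟨ (cong (inside x +_) (sum-cong λ v → sum-*ˡ ⟦ covers s v ⟧ (λ u → ū u * b x u v))) ⟩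
        inside x + sum (λ v → ⟦ covers s v ⟧ * sum λ u → ū u * b x u v)
                                             ≤⟨ +-monoʳ-≤ (inside x) (sum-mono (covered-outside x wx)) ⟩
        inside x + sum {n} (λ v → ⟦ covers s v ⟧)
                                             ≡⟨ cong (inside x +_) (sum-covers s) ⟩
        inside x + (k + k)  ∎
        where
        open ≤-Reasoning
        split : ∀ u v → ū u * b x u v ≡ ū u * ū v * b x u v + ⟦ covers s v ⟧ * (ū u * b x u v)
        split u v = trans (trans (sym (*-identityˡ _)) (cong (_* (ū u * b x u v)) (sym (not+id (covers s v)))))
          (solve 4 (λ p q c d → (q :+ c) :* (p :* d) := p :* q :* d :+ c :* (p :* d)) refl
            (ū u) (ū v) ⟦ covers s v ⟧ (b x u v))
          where open +-*-Solver using (solve; _:+_; _:*_; _:=_; con)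

      -- Multiplication by the 0/1 weight turns the bound into one for every `x`, which can be
      -- summed over X.
      weighted-inside : ∀ x → r * 2 * ws x ≤ ws x * inside x + (k + k) * ws x
      weighted-inside x with ws-bool x
      ... | inj₁ e rewrite e | *-zeroʳ (r * 2) = z≤n
      ... | inj₂ e = begin
        r * 2 * ws x  ≤⟨ *-monoˡ-≤ (ws x) (inside-bound x e) ⟩
        (inside x + (k + k)) * ws x  ≡⟨ *-distribʳ-+ (ws x) (inside x) (k + k) ⟩
        inside x * ws x + (k + k) * ws x  ≡⟨ cong (_+ (k + k) * ws x) (*-comm (inside x) (ws x)) ⟩
        ws x * inside x + (k + k) * ws x  ∎
        where open ≤-Reasoning

      I : ℕ
      I = sum λ u → sum λ v → ū u * ū v * moment ws u v

      I-sum : sum (λ x → ws x * inside x) ≡ I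
      I-sum = begin
        sum (λ x → ws x * inside x)
          ≡⟨ (sum-cong λ x → trans (sym (sum-*ˡ (ws x) _)) (sum-cong λ u → sym (sum-*ˡ (ws x) _))) ⟩
        sum (λ x → sum λ u → sum λ v → ws x * (ū u * ū v * b x u v))
          ≡⟨ sum-swap (λ x u → sum λ v → ws x * (ū u * ū v * b x u v)) ⟩
        sum (λ u → sum λ x → sum λ v → ws x * (ū u * ū v * b x u v))
          ≡⟨ (sum-cong λ u → sum-swap (λ x v → ws x * (ū u * ū v * b x u v))) ⟩
        sum (λ u → sum λ v → sum λ x → ws x * (ū u * ū v * b x u v))
          ≡⟨ (sum-cong λ u → sum-cong λ v → trans
               (sum-cong λ x → solve 3 (λ w p q → w :* (p :* q) := p :* (w :* q)) refl (ws x) (ū u * ū v) (b x u v))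
               (sum-*ˡ (ū u * ū v) _)) ⟩
        I ∎
        where
        open ≡-Reasoning
        open +-*-Solver using (solve; _:+_; _:*_; _:=_; con)

      inside-total : r * 2 * W ≤ I + (k + k) * W
      inside-total = begin
        r * 2 * W  ≡⟨ sum-*ˡ (r * 2) ws ⟨
        sum (λ x → r * 2 * ws x)  ≤⟨ sum-mono weighted-inside ⟩
        sum (λ x → ws x * inside x + (k + k) * ws x)  ≡⟨ sum-+ _ _ ⟩
        sum (λ x → ws x * inside x) + sum (λ x → (k + k) * ws x)
                                                             ≡⟨ cong₂ _+_ I-sum (sum-*ˡ (k + k) ws) ⟩
        I + (k + k) * W  ∎
        where open ≤-Reasoning

      module _ (C : ℕ) (isC : ∀ u v → covers s u ≡ false → covers s v ≡ false → u ≢ v → moment ws u v ≡ C) where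

        -- The moments are `C` off the diagonal and vanish on it. Adding `r * C` fills in the
        -- diagonal, which avoids the factor r - 1.
        I-value : I + r * C ≡ r * r * C
        I-value = begin
          I + r * C  ≡⟨ cong (I +_) (sum-*ʳ C ū) ⟨
          I + sum (λ u → ū u * C)  ≡⟨ sum-+ _ _ ⟨
          sum (λ u → sum (λ v → ū u * ū v * moment ws u v) + ū u * C)  ≡⟨ sum-cong row ⟩
          sum (λ u → ū u * (r * C))  ≡⟨ sum-*ʳ (r * C) ū ⟩
          r * (r * C)  ≡⟨ *-assoc r r C ⟨
          r * r * C  ∎
          where
          open ≡-Reasoning
          entry : ∀ u → covers s u ≡ false → ∀ v →
            1 * ū v * moment ws u v + δ u v * C ≡ ū v * C
          entry u cu v with u Fin.≟ v
          ... | yes refl rewrite cu | moment-irrefl ws u = refl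
          ... | no  u≢v with covers s v in cv
          ...   | true  = refl
          ...   | false rewrite isC u v cu cv u≢v = trans (+-identityʳ _) refl
          row : ∀ u → sum (λ v → ū u * ū v * moment ws u v) + ū u * C ≡ ū u * (r * C)
          row u with covers s u in cu
          ... | true  = trans (+-identityʳ _) (trans (sum-const n 0) (*-zeroʳ n))
          ... | false = begin
            sum (λ v → 1 * ū v * moment ws u v) + 1 * C
              ≡⟨ cong (sum (λ v → 1 * ū v * moment ws u v) +_) (trans (*-identityˡ C) (sym (sum-δ u (λ _ → C)))) ⟩
            sum (λ v → 1 * ū v * moment ws u v) + sum (λ v → δ u v * C)  ≡⟨ sum-+ _ _ ⟨
            sum (λ v → 1 * ū v * moment ws u v + δ u v * C)  ≡⟨ sum-cong (entry u cu) ⟩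
            sum (λ v → ū v * C)  ≡⟨ sum-*ʳ C ū ⟩
            r * C  ≡⟨ *-identityˡ _ ⟨
            1 * (r * C)  ∎

      -- The weight vanishes on every cycle that misses a chosen pair, so a further factor for that
      -- pair changes nothing.
      moment-chosen : ∀ i → lookup s i ≡ true → moment ws (left i) (right i) ≡ W
      moment-chosen i sᵢ = sum-cong λ x → absorb x (ws-bool x)
        where
        absorb : ∀ x → Boolean (ws x) → ws x * pairs x i ≡ ws x
        absorb x (inj₁ e) rewrite e = refl
        absorb x (inj₂ e) = trans (cong (ws x *_) (prod≡1 s e i sᵢ)) (*-identityʳ (ws x))

      J-lower : k * W ≤ J
      J-lower = begin
        k * W  ≡⟨ cong (_* W) (sum-size s) ⟨
        sum (λ i → ⟦ lookup s i ⟧) * W  ≡⟨ sum-*ʳ W _ ⟨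
        sum (λ i → ⟦ lookup s i ⟧ * W)  ≤⟨ sum-mono chosen ⟩
        J  ∎
        where
        open ≤-Reasoning
        chosen : ∀ i → ⟦ lookup s i ⟧ * W ≤ moment ws (left i) (right i)
        chosen i with lookup s i in sᵢ
        ... | false = z≤n
        ... | true  = ≤-reflexive (trans (*-identityˡ W) (sym (moment-chosen i sᵢ)))

      some-unchosen : k < ⌊ n /2⌋ → ∃ λ i → lookup s i ≡ false
      some-unchosen = go s
        where
        go : ∀ {m} (t : Subset m) → size t < m → ∃ λ i → lookup t i ≡ false
        go (false ∷ t) _ = zero , refl
        go (true ∷ t) (s≤s h) with go t h
        ... | i , e = suc i , e

      -- Unlike 2rW + rC ≤ r²C + 2kW and J = kW + DC, from which it follows by
      -- eliminating C, this inequality is linear in W and J and can be summed over s.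
      J-linear : k < ⌊ n /2⌋ →
        2 * r * D * W + r * J + r * r * k * W ≤ r * r * J + r * k * W + 2 * k * D * W
      J-linear k<m with some-unchosen k<m
      ... | i , sᵢ = begin
        2 * r * D * W + r * J + r * r * k * W
          ≡⟨ cong (λ j → 2 * r * D * W + r * j + r * r * k * W) J-value ⟩
        2 * r * D * W + r * (k * W + D * C) + r * r * k * W
          ≡⟨ solve 5 (λ r D W k C → con 2 :* r :* D :* W :+ r :* (k :* W :+ D :* C) :+ r :* r :* k :* W
               := D :* (r :* con 2 :* W) :+ (r :* (k :* W :+ D :* C) :+ r :* r :* k :* W)) refl r D W k C ⟩
        D * (r * 2 * W) + (r * (k * W + D * C) + r * r * k * W)
          ≤⟨ +-monoˡ-≤ _ (*-monoʳ-≤ D inside-total) ⟩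
        D * (I + (k + k) * W) + (r * (k * W + D * C) + r * r * k * W)
          ≡⟨ solve 6 (λ r D W k C I → D :* (I :+ (k :+ k) :* W) :+ (r :* (k :* W :+ D :* C) :+ r :* r :* k :* W)
               := D :* (I :+ r :* C) :+ (con 2 :* k :* D :* W :+ r :* k :* W :+ r :* r :* k :* W)) refl r D W k C I ⟩
        D * (I + r * C) + (2 * k * D * W + r * k * W + r * r * k * W)
          ≡⟨ cong (λ z → D * z + (2 * k * D * W + r * k * W + r * r * k * W)) (I-value C isC) ⟩
        D * (r * r * C) + (2 * k * D * W + r * k * W + r * r * k * W)
          ≡⟨ solve 5 (λ r D W k C → D :* (r :* r :* C) :+ (con 2 :* k :* D :* W :+ r :* k :* W :+ r :* r :* k :* W)
               := r :* r :* (k :* W :+ D :* C) :+ r :* k :* W :+ con 2 :* k :* D :* W) refl r D W k C ⟩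
        r * r * (k * W + D * C) + r * k * W + 2 * k * D * W
          ≡⟨ cong (λ j → r * r * j + r * k * W + 2 * k * D * W) J-value ⟨
        r * r * J + r * k * W + 2 * k * D * W ∎
        where
        open ≤-Reasoning
        open +-*-Solver using (solve; _:+_; _:*_; _:=_; con)
        -- The common moment of two uncovered vertices is read off at an unchosen pair, which exists
        -- because k < ⌊n/2⌋.
        C : ℕ
        C = moment ws (left i) (right i)
        cov-l : ∀ j → lookup s j ≡ false → covers {n} s (left j) ≡ false
        cov-l j e = trans (covers-left s j) e
        cov-r : ∀ j → lookup s j ≡ false → covers {n} s (right j) ≡ false
        cov-r j e = trans (covers-right s j) e
        isC : ∀ u v → covers s u ≡ false → covers s v ≡ false → u ≢ v → moment ws u v ≡ C
        isC u v cu cv u≢v = uncovered-constant (u , cu) (v , cv)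
          (left i , cov-l i sᵢ) (right i , cov-r i sᵢ) u≢v (left≢right i)
        value : ∀ j → moment ws (left j) (right j) ≡ ⟦ lookup s j ⟧ * W + ⟦ not (lookup s j) ⟧ * C
        value j with lookup s j in sⱼ
        ... | true  = trans (moment-chosen j sⱼ) (sym (trans (+-identityʳ _) (*-identityˡ W)))
        ... | false = trans (isC (left j) (right j) (cov-l j sⱼ) (cov-r j sⱼ) (left≢right j)) (sym (*-identityˡ C))
        J-value : J ≡ k * W + D * C
        J-value = trans (sum-cong value) (trans (sum-+ _ _)
          (cong₂ _+_ (trans (sum-*ʳ W _) (cong (_* W) (sum-size s))) (sum-*ʳ C _)))

  -- Automorphisms of the matching.

  mate-cases : ∀ {n} (v : Fin n) → (∃ λ i → v ≡ left i) ⊎ (∃ λ i → v ≡ right i) ⊎ mate v ≡ v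
  mate-cases {suc zero}    zero          = inj₂ (inj₂ refl)
  mate-cases {suc (suc n)} zero          = inj₁ (zero , refl)
  mate-cases {suc (suc n)} (suc zero)    = inj₂ (inj₁ (zero , refl))
  mate-cases {suc (suc n)} (suc (suc v)) with mate-cases v
  ... | inj₁ (i , refl)        = inj₁ (suc i , refl)
  ... | inj₂ (inj₁ (i , refl)) = inj₂ (inj₁ (suc i , refl))
  ... | inj₂ (inj₂ e)          = inj₂ (inj₂ (cong suc² e))

  single-exists : ∀ n → odd n ≡ 1 → ∃ λ (l : Fin n) → mate l ≡ l
  single-exists (suc zero)    _ = zero , refl
  single-exists (suc (suc n)) e with single-exists n e
  ... | l , p = suc² l , cong suc² p

  odd-bool : ∀ n → Boolean (odd n)
  odd-bool zero          = inj₁ refl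
  odd-bool (suc zero)    = inj₂ refl
  odd-bool (suc (suc n)) = odd-bool n

  -- If `u` and `u′` lie in different pairs, the product of the transpositions of `u` with `u′` and
  -- of their mates works; otherwise the identity or the transposition of one pair does. Fixing
  -- everything off the two pairs allows the other end of an edge to be held still.
  matching-swap : ∀ {n} (u u′ : Fin n) → mate u ≢ u → mate u′ ≢ u′ → ∃ λ (σ : Permutation′ n) →
    (∀ v → σ ⟨$⟩ʳ mate v ≡ mate (σ ⟨$⟩ʳ v)) × σ ⟨$⟩ʳ u ≡ u′ ×
    (∀ v → v ≢ u → v ≢ u′ → v ≢ mate u → v ≢ mate u′ → σ ⟨$⟩ʳ v ≡ v)
  matching-swap {n} u u′ mu≢u mu′≢u′ with u′ Fin.≟ u | u′ Fin.≟ mate u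
  ... | yes refl | _ = Perm.id , (λ _ → refl) , refl , λ _ _ _ _ _ → refl
  ... | no _ | yes refl = σ , comm , transpose-fst u (mate u) ,
    λ v v≢u v≢u′ _ _ → transpose-other u (mate u) v≢u v≢u′
    where
    σ = Perm.transpose u (mate u)
    comm : ∀ v → σ ⟨$⟩ʳ mate v ≡ mate (σ ⟨$⟩ʳ v)
    comm v = go (v Fin.≟ u) (v Fin.≟ mate u)
      where
      go : Dec (v ≡ u) → Dec (v ≡ mate u) → σ ⟨$⟩ʳ mate v ≡ mate (σ ⟨$⟩ʳ v)
      go (yes refl) _ = trans (transpose-snd u (mate u))
        (sym (trans (cong mate (transpose-fst u (mate u))) (mate-involutive u)))
      go (no _) (yes refl) = trans (cong (σ ⟨$⟩ʳ_) (mate-involutive u))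
        (trans (transpose-fst u (mate u)) (sym (cong mate (transpose-snd u (mate u)))))
      go (no v≢u) (no v≢mu) = trans
        (transpose-other u (mate u) (λ e → v≢mu (trans (sym (mate-involutive v)) (cong mate e)))
          (λ e → v≢u (mate-injective e)))
        (sym (cong mate (transpose-other u (mate u) v≢u v≢mu)))
  ... | no u′≢u | no u′≢mu = σ , comm , at-u , λ v a b c d → at-other v a b c d
    where
    τ = Perm.transpose u u′
    τ′ = Perm.transpose (mate u) (mate u′)
    σ = τ ∘ₚ τ′
    u≢mu′ : u ≢ mate u′
    u≢mu′ e = u′≢mu (trans (sym (mate-involutive u′)) (cong mate (sym e)))
    at-u : σ ⟨$⟩ʳ u ≡ u′
    at-u = trans (cong (τ′ ⟨$⟩ʳ_) (transpose-fst u u′)) (transpose-other _ _ u′≢mu (mu′≢u′ ∘ sym))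
    at-u′ : σ ⟨$⟩ʳ u′ ≡ u
    at-u′ = trans (cong (τ′ ⟨$⟩ʳ_) (transpose-snd u u′)) (transpose-other _ _ (mu≢u ∘ sym) u≢mu′)
    at-mu : σ ⟨$⟩ʳ mate u ≡ mate u′
    at-mu = trans (cong (τ′ ⟨$⟩ʳ_) (transpose-other u u′ mu≢u (u′≢mu ∘ sym))) (transpose-fst (mate u) (mate u′))
    at-mu′ : σ ⟨$⟩ʳ mate u′ ≡ mate u
    at-mu′ = trans (cong (τ′ ⟨$⟩ʳ_) (transpose-other u u′ (u≢mu′ ∘ sym) mu′≢u′)) (transpose-snd (mate u) (mate u′))
    at-other : ∀ v → v ≢ u → v ≢ u′ → v ≢ mate u → v ≢ mate u′ → σ ⟨$⟩ʳ v ≡ v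
    at-other v a b c d = trans (cong (τ′ ⟨$⟩ʳ_) (transpose-other u u′ a b)) (transpose-other _ _ c d)
    comm : ∀ v → σ ⟨$⟩ʳ mate v ≡ mate (σ ⟨$⟩ʳ v)
    comm v = go (v Fin.≟ u) (v Fin.≟ u′) (v Fin.≟ mate u) (v Fin.≟ mate u′)
      where
      unmate : ∀ {z} → mate v ≡ z → v ≡ mate z
      unmate e = trans (sym (mate-involutive v)) (cong mate e)
      go : Dec (v ≡ u) → Dec (v ≡ u′) → Dec (v ≡ mate u) → Dec (v ≡ mate u′) →
        σ ⟨$⟩ʳ mate v ≡ mate (σ ⟨$⟩ʳ v)
      go (yes refl) _ _ _ = trans at-mu (sym (cong mate at-u))
      go (no _) (yes refl) _ _ = trans at-mu′ (sym (cong mate at-u′))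
      go (no _) (no _) (yes refl) _ = trans (cong (σ ⟨$⟩ʳ_) (mate-involutive u))
        (trans at-u (sym (trans (cong mate at-mu) (mate-involutive u′))))
      go (no _) (no _) (no _) (yes refl) = trans (cong (σ ⟨$⟩ʳ_) (mate-involutive u′))
        (trans at-u′ (sym (trans (cong mate at-mu′) (mate-involutive u))))
      go (no a) (no b) (no c) (no d) = trans
        (at-other (mate v) (λ e → c (unmate e)) (λ e → d (unmate e)) (a ∘ mate-injective) (b ∘ mate-injective))
        (sym (cong mate (at-other v a b c d)))

  -- The weight C(j, k) and its moments.

  module Weights {n′ : ℕ} (cs : CycleSystem (4 + n′)) (k : ℕ) where
    open CycleSystem cs
    open Moments cs public

    n m : ℕ
    n = 4 + n′
    m = ⌊ n /2⌋

    -- As prod s is 0 or 1 it is its own square, so w is a sum of squares of monomials of degree k.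
    w : Fin M → ℕ
    w x = sumSub m k λ s → prod s (pairs x)

    -- In this form the weight visibly depends only on the number of matching edges on `x`, so its
    -- invariance needs no permutation of subsets.
    w-choose : ∀ x → w x ≡ choose (sum (pairs x)) k
    w-choose x = sumSub-prod m k (pairs-bool x)

    -- A sum over vertices, unlike one over pairs with a left and a right end, can be reindexed by
    -- any permutation that commutes with `mate`.
    double-pairs : ∀ x → sum (λ v → b x v (mate v)) ≡ sum (pairs x) + sum (pairs x)
    double-pairs x = begin
      sum (λ v → b x v (mate v))
        ≡⟨ sum-pairs (λ v → b x v (mate v)) ⟩
      sum (λ i → b x (left i) (mate (left i)) + b x (right i) (mate (right i)))
        + sum (λ v → single v * b x v (mate v))
        ≡⟨ cong₂ _+_ (sum-cong matched) (trans (sum-cong unmatched) (trans (sum-const n 0) (*-zeroʳ n))) ⟩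
      sum (λ i → pairs x i + pairs x i) + 0
        ≡⟨ +-identityʳ _ ⟩
      sum (λ i → pairs x i + pairs x i)
        ≡⟨ sum-+ (pairs x) (pairs x) ⟩
      sum (pairs x) + sum (pairs x) ∎
      where
      open ≡-Reasoning
      matched : ∀ i → b x (left i) (mate (left i)) + b x (right i) (mate (right i)) ≡ pairs x i + pairs x i
      matched i rewrite mate-left {n} i | mate-right {n} i = cong (pairs x i +_) (b-sym x _ _)
      unmatched : ∀ v → single v * b x v (mate v) ≡ 0
      unmatched v with mate v Fin.≟ v
      ... | yes e = trans (+-identityʳ _) (trans (cong (b x v) e) (b-irrefl x v))
      ... | no  _ = refl

    Preserving : Permutation′ n → Set
    Preserving σ = ∀ v → σ ⟨$⟩ʳ mate v ≡ mate (σ ⟨$⟩ʳ v)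

    w-invariant : ∀ σ → Preserving σ → ∀ x → w (act σ ⟨$⟩ʳ x) ≡ w x
    w-invariant σ comm x = trans (w-choose _) (trans (cong (λ j → choose j k) same) (sym (w-choose x)))
      where
      open ≡-Reasoning
      y = act σ ⟨$⟩ʳ x
      doubled : sum (pairs y) + sum (pairs y) ≡ sum (pairs x) + sum (pairs x)
      doubled = begin
        sum (pairs y) + sum (pairs y)  ≡⟨ double-pairs y ⟨
        sum (λ v → b y v (mate v))  ≡⟨ sum-permute (λ v → b y v (mate v)) σ ⟩
        sum (λ v → b y (σ ⟨$⟩ʳ v) (mate (σ ⟨$⟩ʳ v)))
          ≡⟨ (sum-cong λ v → trans (cong (b y _) (sym (comm v))) (b-act σ x v (mate v))) ⟩
        sum (λ v → b x v (mate v))  ≡⟨ double-pairs x ⟩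
        sum (pairs x) + sum (pairs x)  ∎
      same : sum (pairs y) ≡ sum (pairs x)
      same = *-cancelˡ-≡ _ _ 2 (trans (cong (sum (pairs y) +_) (+-identityʳ _))
        (trans doubled (sym (cong (sum (pairs x) +_) (+-identityʳ _)))))

    g : Fin n → Fin n → ℕ
    g = moment w

    g-sym : ∀ u v → g u v ≡ g v u
    g-sym = moment-sym w

    W : ℕ
    W = sum w

    g-preserved : ∀ σ → Preserving σ → ∀ u v → g (σ ⟨$⟩ʳ u) (σ ⟨$⟩ʳ v) ≡ g u v
    g-preserved σ comm = moment-invariant σ w (w-invariant σ comm)

    Matched : Set
    Matched = ∃ λ v → mate {n} v ≢ v

    g-mates : ∀ {u u′} → mate u ≢ u → mate u′ ≢ u′ → g u (mate u) ≡ g u′ (mate u′)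
    g-mates {u} {u′} p p′ with matching-swap u u′ p p′
    ... | σ , comm , σu , _ = trans (sym (g-preserved σ comm u (mate u)))
      (cong₂ g σu (trans (comm u) (cong mate σu)))

    g-move : ∀ {u u′ v} → mate u ≢ u → mate u′ ≢ u′ →
      v ≢ u → v ≢ u′ → v ≢ mate u → v ≢ mate u′ → g u v ≡ g u′ v
    g-move {u} {u′} {v} p p′ a b c d with matching-swap u u′ p p′
    ... | σ , comm , σu , fix = trans (sym (g-preserved σ comm u v)) (cong₂ g σu (fix v a b c d))

    Apart : Fin n → Fin n → Set
    Apart u v = v ≢ u × v ≢ mate u

    Apart-sym : ∀ {u v} → Apart u v → Apart v u
    Apart-sym {u} {v} (p , q) = p ∘ sym , λ e → q (sym (trans (cong mate e) (mate-involutive v)))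

    g-apart : ∀ {u v u′ v′} → mate u ≢ u → mate v ≢ v → mate u′ ≢ u′ → mate v′ ≢ v′ →
      Apart u v → Apart u′ v′ → g u v ≡ g u′ v′
    g-apart {u} {v} {u′} {v′} mu mv mu′ mv′ = constant-on-apart
      {A = Matched} (λ p q → Apart (proj₁ p) (proj₁ q)) (λ p q → g (proj₁ p) (proj₁ q))
      Apart-sym (λ { {u , _} {v , _} R (t , _) → cotrans u v t R })
      (λ p q → g-sym (proj₁ p) (proj₁ q))
      (λ { {u , p} {u′ , p′} {v , _} (a , c) (b , d) → g-move p p′ a b c d })
      {u , mu} {v , mv} {u′ , mu′} {v′ , mv′}
      where
      cotrans : ∀ u v t → Apart u v → Apart u t ⊎ Apart t v
      cotrans u v t (p , q) with t Fin.≟ u | t Fin.≟ mate u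
      ... | yes refl | _        = inj₂ (p , q)
      ... | no _     | yes refl = inj₂ (q , λ e → p (trans e (mate-involutive u)))
      ... | no a     | no c     = inj₁ (a , c)

    -- Both `v` and `v′` are matched, since `l` is the only unmatched vertex; an automorphism of the
    -- matching takes one to the other and fixes `l`.
    g-single : ∀ {l v v′} → mate l ≡ l → v ≢ l → v′ ≢ l → g l v ≡ g l v′
    g-single {l} {v} {v′} ml v≢l v′≢l = trans (g-sym l v) (trans
      (g-move (λ e → v≢l (single-unique e ml)) (λ e → v′≢l (single-unique e ml))
        (v≢l ∘ sym) (v′≢l ∘ sym) (λ e → v≢l (unmate e)) (λ e → v′≢l (unmate e)))
      (g-sym v′ l))
      where
      unmate : ∀ {z} → l ≡ mate z → z ≡ l
      unmate e = mate-injective (trans (sym e) (sym ml))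

    g₀ g₁ g₂ : ℕ
    g₀ = g zero (suc zero)
    -- Vertex 2 lies in a second pair because n ≥ 4; among three vertices it would be the unmatched
    -- one.
    g₁ = g zero (suc (suc zero))
    -- For odd n the value at an edge of the single vertex, otherwise 0.
    g₂ = sum λ l → single l * g l zero

    g-matched : ∀ {u} → mate u ≢ u → g u (mate u) ≡ g₀
    g-matched mu = g-mates mu (λ ())

    g-unmatched : ∀ {u v} → mate u ≢ u → mate v ≢ v → Apart u v → g u v ≡ g₁
    g-unmatched mu mv R = g-apart mu mv (λ ()) (λ ()) R ((λ ()) , (λ ()))

    g-at-single : ∀ {l v} → mate l ≡ l → v ≢ l → g l v ≡ g₂
    g-at-single {l} {v} ml v≢l = trans (g-single ml v≢l z≢l)
      (sym (trans (sum-cong λ u → cong (_* g u zero) (is-l u)) (sum-δ l (λ u → g u zero))))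
      where
      z≢l : zero ≢ l
      z≢l refl = contradiction ml (λ ())
      is-l : ∀ u → single u ≡ δ l u
      is-l u with mate u Fin.≟ u | l Fin.≟ u
      ... | yes _  | yes _    = refl
      ... | yes mu | no  l≢u  = contradiction (single-unique ml mu) l≢u
      ... | no  ¬p | yes refl = contradiction ml ¬p
      ... | no  _  | no  _    = refl

    single-yes : ∀ {v : Fin n} → mate v ≡ v → single v ≡ 1
    single-yes {v} e = trans (cong (λ z → δ z v) e) (δ-refl v)

    -- The values of g, with the corrections on both sides so that no subtraction occurs.
    g-values : ∀ u v → u ≢ v →
      g u v + (δ (mate u) v * g₁ + (single u + single v) * g₁) ≡
      g₁ + (δ (mate u) v * g₀ + (single u + single v) * g₂)
    g-values u v u≢v = by-cases (mate u Fin.≟ u) (mate v Fin.≟ v) (mate u Fin.≟ v)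
      where
      Goal : ℕ → ℕ → ℕ → Set
      Goal d p q = g u v + (d * g₁ + (p + q) * g₁) ≡ g₁ + (d * g₀ + (p + q) * g₂)
      at : ∀ {d p q} → δ (mate u) v ≡ d → single u ≡ p → single v ≡ q → Goal d p q →
        Goal (δ (mate u) v) (single u) (single v)
      at refl refl refl h = h
      swap+ : ∀ a c → a ≡ c → a + (0 + (1 + 0) * g₁) ≡ g₁ + (0 + (1 + 0) * c)
      swap+ a .a refl = solve 2 (λ a h → a :+ (con 0 :+ con 1 :* h) := h :+ (con 0 :+ con 1 :* a)) refl a g₁
        where open +-*-Solver using (solve; _:+_; _:*_; _:=_; con)
      by-cases : Dec (mate u ≡ u) → Dec (mate v ≡ v) → Dec (mate u ≡ v) →
        Goal (δ (mate u) v) (single u) (single v)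
      by-cases (yes mu) (yes mv) _ = contradiction (single-unique mu mv) u≢v
      by-cases (yes mu) (no mv) _ = at (δ-≢ (λ e → u≢v (trans (sym mu) e))) (single-yes mu) (δ-≢ mv)
        (swap+ _ _ (g-at-single mu (u≢v ∘ sym)))
      by-cases (no mu) (yes mv) _ = at (δ-≢ (λ e → u≢v (mate-injective (trans e (sym mv)))))
        (δ-≢ mu) (single-yes mv) (swap+ _ _ (trans (g-sym u v) (g-at-single mv u≢v)))
      by-cases (no mu) (no mv) (yes e) = at (trans (cong (λ z → δ z v) e) (δ-refl v)) (δ-≢ mu) (δ-≢ mv)
        (trans (cong (_+ (1 * g₁ + 0)) (trans (cong (g u) (sym e)) (g-matched mu)))
          (solve 2 (λ a h → a :+ (con 1 :* h :+ con 0) := h :+ (con 1 :* a :+ con 0)) refl g₀ g₁))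
        where open +-*-Solver using (solve; _:+_; _:*_; _:=_; con)
      by-cases (no mu) (no mv) (no ¬e) = at (δ-≢ ¬e) (δ-≢ mu) (δ-≢ mv)
        (cong (_+ 0) (g-unmatched mu mv (u≢v ∘ sym , ¬e ∘ sym)))

    sum-δ′ : ∀ (u : Fin n) c → sum (λ v → δ u v * c) ≡ c
    sum-δ′ u c = sum-δ u (λ _ → c)

    -- The row of vertex 0 adds up to 2W and consists of one g₀, `odd n` times g₂, n - 2 - `odd n`
    -- times g₁, and a zero on the diagonal. The terms on the left complete it to n times g₁.
    degree-zero : 2 * W + (2 * g₁ + odd n * g₁) ≡ n * g₁ + (g₀ + odd n * g₂)
    degree-zero = begin
      2 * W + (2 * g₁ + odd n * g₁)
        ≡⟨ solve 3 (λ a h o → a :+ (con 2 :* h :+ o :* h) := a :+ (h :+ (h :+ o :* h))) refl (2 * W) g₁ (odd n) ⟩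
      2 * W + (g₁ + (g₁ + odd n * g₁))
        ≡⟨ cong₂ _+_ (sym (moment-degree w zero)) (cong₂ _+_ (sym (sum-δ′ zero g₁))
             (cong₂ _+_ (sym (sum-δ′ (suc zero) g₁)) (trans (cong (_* g₁) (sym (sum-single {n}))) (sym (sum-*ʳ {n} g₁ single))))) ⟩
      sum (g zero) + (sum (λ v → δ zero v * g₁) + (sum (λ v → δ (suc zero) v * g₁) + sum {n} (λ v → single v * g₁)))
        ≡⟨ trans (sum-+ _ _) (cong (sum (g zero) +_) (trans (sum-+ _ _) (cong (sum (λ v → δ zero v * g₁) +_) (sum-+ _ _)))) ⟨
      sum (λ v → g zero v + (δ zero v * g₁ + (δ (suc zero) v * g₁ + single v * g₁)))
        ≡⟨ sum-cong entry ⟩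
      sum (λ v → g₁ + (δ (suc zero) v * g₀ + single v * g₂))
        ≡⟨ trans (sum-+ _ _) (cong (sum {n} (λ _ → g₁) +_) (sum-+ _ _)) ⟩
      sum {n} (λ _ → g₁) + (sum (λ v → δ (suc zero) v * g₀) + sum {n} (λ v → single v * g₂))
        ≡⟨ cong₂ _+_ (sum-const n g₁) (cong₂ _+_ (sum-δ′ (suc zero) g₀) (trans (sum-*ʳ {n} g₂ single) (cong (_* g₂) (sum-single {n})))) ⟩
      n * g₁ + (g₀ + odd n * g₂) ∎
      where
      open ≡-Reasoning
      open +-*-Solver using (solve; _:+_; _:*_; _:=_; con)
      entry : ∀ v → g zero v + (δ zero v * g₁ + (δ (suc zero) v * g₁ + single v * g₁)) ≡
        g₁ + (δ (suc zero) v * g₀ + single v * g₂)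
      entry zero = cong₂ _+_ (moment-irrefl w zero) (trans (+-identityʳ _) (trans (+-identityʳ _) (sym (+-identityʳ g₁))))
      entry (suc v) = g-values zero (suc v) (λ ())

    degree-single : odd n ≡ 1 → 2 * W + g₂ ≡ n * g₂
    degree-single e with single-exists n e
    ... | l , ml = begin
      2 * W + g₂  ≡⟨ cong₂ _+_ (sym (moment-degree w l)) (sym (sum-δ′ l g₂)) ⟩
      sum (g l) + sum (λ v → δ l v * g₂)  ≡⟨ sum-+ _ _ ⟨
      sum (λ v → g l v + δ l v * g₂)  ≡⟨ sum-cong entry ⟩
      sum {n} (λ _ → g₂)  ≡⟨ sum-const n g₂ ⟩
      n * g₂  ∎
      where
      open ≡-Reasoning
      entry : ∀ v → g l v + δ l v * g₂ ≡ g₂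
      entry v with l Fin.≟ v
      ... | yes refl = trans (cong (_+ 1 * g₂) (moment-irrefl w l)) (*-identityˡ g₂)
      ... | no  l≢v  = trans (+-identityʳ _) (g-at-single ml (l≢v ∘ sym))

    module _ (s : Subset m) where
      open OneSubset s public using () renaming (ws to wₛ; W to Wₛ; J to Jₛ)

    W-sum : W ≡ sumSub m k Wₛ
    W-sum = sumSub-sum m k (λ s x → prod s (pairs x))

    g-sum : ∀ u v → g u v ≡ sumSub m k (λ s → moment (wₛ s) u v)
    g-sum u v = trans (sum-cong λ x → trans (*-comm (w x) (b x u v)) (trans
        (sym (sumSub-* m k (b x u v) (λ s → wₛ s x)))
        (sumSub-cong m k (λ s _ → *-comm (b x u v) (wₛ s x)))))
      (sumSub-sum m k (λ s x → wₛ s x * b x u v))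

    J-sum : m * g₀ ≡ sumSub m k Jₛ
    J-sum = begin
      m * g₀  ≡⟨ sum-const m g₀ ⟨
      sum {m} (λ _ → g₀)  ≡⟨ sum-cong value ⟨
      sum (λ i → g (left i) (right i))  ≡⟨ sum-cong (λ i → g-sum (left i) (right i)) ⟩
      sum (λ i → sumSub m k (λ s → moment (wₛ s) (left i) (right i)))
                                                                   ≡⟨ sumSub-sum m k (λ s i → moment (wₛ s) (left i) (right i)) ⟩
      sumSub m k Jₛ  ∎
      where
      open ≡-Reasoning
      value : ∀ i → g (left i) (right i) ≡ g₀
      value i = trans (cong (g (left i)) (sym (mate-left i)))
        (g-matched (λ e → left≢right i (sym (trans (sym (mate-left i)) e))))

    J-lower : k * W ≤ m * g₀
    J-lower = begin
      k * W  ≡⟨ trans (cong (k *_) W-sum) (sym (sumSub-* m k k Wₛ)) ⟩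
      sumSub m k (λ s → k * Wₛ s)  ≤⟨ sumSub-mono m k (λ { s refl → OneSubset.J-lower s }) ⟩
      sumSub m k Jₛ  ≡⟨ J-sum ⟨
      m * g₀  ∎
      where open ≤-Reasoning

    J-linear : ∀ D r → k < m → D + k ≡ m → r + (k + k) ≡ n →
      (2 * r * D + r * r * k) * W + r * (m * g₀) ≤ r * r * (m * g₀) + (r * k + 2 * k * D) * W
    J-linear D r k<m D+k r+2k = begin
      a * W + r * (m * g₀)  ≡⟨ cong₂ (λ x y → a * x + r * y) W-sum J-sum ⟩
      a * sumSub m k Wₛ + r * sumSub m k Jₛ  ≡⟨ cong₂ _+_ (sumSub-* m k a Wₛ) (sumSub-* m k r Jₛ) ⟨
      sumSub m k (λ s → a * Wₛ s) + sumSub m k (λ s → r * Jₛ s)  ≡⟨ sumSub-+ m k _ _ ⟨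
      sumSub m k (λ s → a * Wₛ s + r * Jₛ s)  ≤⟨ sumSub-mono m k each ⟩
      sumSub m k (λ s → r * r * Jₛ s + c * Wₛ s)  ≡⟨ sumSub-+ m k _ _ ⟩
      sumSub m k (λ s → r * r * Jₛ s) + sumSub m k (λ s → c * Wₛ s)
        ≡⟨ cong₂ _+_ (sumSub-* m k (r * r) Jₛ) (sumSub-* m k c Wₛ) ⟩
      r * r * sumSub m k Jₛ + c * sumSub m k Wₛ  ≡⟨ cong₂ (λ x y → r * r * y + c * x) W-sum J-sum ⟨
      r * r * (m * g₀) + c * W  ∎
      where
      open ≤-Reasoning
      a c : ℕ
      a = 2 * r * D + r * r * k
      c = r * k + 2 * k * D
      each : ∀ s → size s ≡ k → a * Wₛ s + r * Jₛ s ≤ r * r * Jₛ s + c * Wₛ s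
      -- The numbers of unchosen pairs and of uncovered vertices depend on `s` only through its
      -- size, so all summands have the same coefficients.
      each s refl with +-cancelʳ-≡ (size s) D (OneSubset.D s) (trans D+k (sym (OneSubset.D+k s)))
                     | +-cancelʳ-≡ (size s + size s) r (OneSubset.r s) (trans r+2k (sym (OneSubset.r+2k s)))
      ... | refl | refl = begin
        a * Wₛ s + r * Jₛ s
          ≡⟨ solve 5 (λ r D k W J → (con 2 :* r :* D :+ r :* r :* k) :* W :+ r :* J
               := con 2 :* r :* D :* W :+ r :* J :+ r :* r :* k :* W) refl r D k (Wₛ s) (Jₛ s) ⟩
        2 * r * D * Wₛ s + r * Jₛ s + r * r * k * Wₛ s
          ≤⟨ OneSubset.J-linear s k<m ⟩
        r * r * Jₛ s + r * k * Wₛ s + 2 * k * D * Wₛ s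
          ≡⟨ solve 5 (λ r D k W J → r :* r :* J :+ r :* k :* W :+ con 2 :* k :* D :* W
               := r :* r :* J :+ (r :* k :+ con 2 :* k :* D) :* W) refl r D k (Wₛ s) (Jₛ s) ⟩
        r * r * Jₛ s + c * Wₛ s ∎
        where open +-*-Solver using (solve; _:+_; _:*_; _:=_; con)

    -- A cycle through the whole matching has positive weight. Later this makes G positive, so that
    -- it can be cancelled.
    W-positive : k ≤ m → ∀ x → (∀ i → pairs x i ≡ 1) → 1 ≤ W
    W-positive k≤m x h = ≤-trans
      (sumSub-positive m k _ k≤m (λ s → ≤-reflexive (sym (prod-one s))))
      (term≤sum w x)
      where
      ones : ∀ {m} (s : Subset m) → prod s (λ _ → 1) ≡ 1
      ones []          = refl
      ones (true  ∷ s) = trans (+-identityʳ _) (ones s)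
      ones (false ∷ s) = ones s
      prod-one : ∀ (s : Subset m) → prod s (pairs x) ≡ 1
      prod-one s = trans (prod-cong s (λ i _ → h i)) (ones s)

  -- Rotations of the matching along a tour.

  record Rotations (n : ℕ) : Set where
    field
      nx       : Fin n → Fin n
      nx-left  : ∀ i → nx (left i) ≡ right i
      nx-nx    : ∀ v → nx (nx v) ≢ v
      rot      : Fin n → Permutation′ n
      rot-nx   : ∀ ρ v → rot ρ ⟨$⟩ʳ nx v ≡ nx (rot ρ ⟨$⟩ʳ v)
      -- This encodes that the images of `v` under the rotations meet every position exactly once.
      rot-sum  : ∀ v (f : Fin n → ℕ) → sum (λ ρ → f (rot ρ ⟨$⟩ʳ v)) ≡ sum f

    consecutive : Fin n → Fin n → ℕ
    consecutive i j = δ (nx i) j + δ (nx j) i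

    nx-irrefl : ∀ v → nx v ≢ v
    nx-irrefl v e = nx-nx v (trans (cong nx e) e)

    -- Each pair is counted once, at its left end: from its right end `nx` leaves the pair, by
    -- `nx-nx`.
    count-forward : sum (λ v → δ (mate v) (nx v)) ≡ ⌊ n /2⌋
    count-forward = begin
      sum (λ v → δ (mate v) (nx v))
        ≡⟨ sum-pairs (λ v → δ (mate v) (nx v)) ⟩
      sum (λ i → δ (mate (left i)) (nx (left i)) + δ (mate (right i)) (nx (right i)))
        + sum (λ v → single v * δ (mate v) (nx v))
        ≡⟨ cong₂ _+_ (sum-cong matched) (sum-cong unmatched) ⟩
      sum {⌊ n /2⌋} (λ _ → 1) + sum {n} (λ _ → 0)
        ≡⟨ cong₂ _+_ (trans (sum-const ⌊ n /2⌋ 1) (*-identityʳ _)) (trans (sum-const n 0) (*-zeroʳ n)) ⟩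
      ⌊ n /2⌋ + 0
        ≡⟨ +-identityʳ _ ⟩
      ⌊ n /2⌋ ∎
      where
      open ≡-Reasoning
      matched : ∀ i → δ (mate (left i)) (nx (left i)) + δ (mate (right i)) (nx (right i)) ≡ 1
      matched i rewrite mate-left {n} i | mate-right {n} i | nx-left i =
        cong₂ _+_ (δ-refl (right {n} i)) (δ-≢ λ e → nx-nx (left i) (trans (cong nx (nx-left i)) (sym e)))
      unmatched : ∀ v → single v * δ (mate v) (nx v) ≡ 0
      unmatched v with mate v Fin.≟ v
      ... | yes e = trans (+-identityʳ _) (δ-≢ λ e′ → nx-irrefl v (trans (sym e′) e))
      ... | no  _ = refl

    δ-sym : ∀ (u v : Fin n) → δ u v ≡ δ v u
    δ-sym u v with u Fin.≟ v
    ... | yes refl = sym (δ-refl u)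
    ... | no  u≢v  = sym (δ-≢ (u≢v ∘ sym))

    mates-consecutive : ∀ {u v} → u ≢ v → mate u ≡ v → v ≡ nx u ⊎ u ≡ nx v
    mates-consecutive {u} {v} u≢v e with mate-cases u
    ... | inj₁ (i , refl)        = inj₁ (trans (sym e) (trans (mate-left i) (sym (nx-left i))))
    ... | inj₂ (inj₁ (i , refl)) = inj₂ (trans (sym (nx-left i)) (cong nx (trans (sym (mate-right i)) e)))
    ... | inj₂ (inj₂ e′)         = contradiction (trans (sym e′) e) u≢v

    rot-injective : ∀ ρ {u v} → rot ρ ⟨$⟩ʳ u ≡ rot ρ ⟨$⟩ʳ v → u ≡ v
    rot-injective ρ e = trans (sym (Perm.inverseˡ (rot ρ))) (trans (cong (rot ρ ⟨$⟩ˡ_) e) (Perm.inverseˡ (rot ρ)))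

    -- Rotations preserve succession and mates are consecutive, so only consecutive positions can
    -- become mates. For these the image of `i` or of `j` runs through all positions, and
    -- `count-forward` applies.
    count-matched : ∀ i j → i ≢ j →
      sum (λ ρ → δ (mate (rot ρ ⟨$⟩ʳ i)) (rot ρ ⟨$⟩ʳ j)) ≡ ⌊ n /2⌋ * consecutive i j
    count-matched i j i≢j = by-cases (nx i Fin.≟ j) (nx j Fin.≟ i)
      where
      by-cases : Dec (nx i ≡ j) → Dec (nx j ≡ i) →
        sum (λ ρ → δ (mate (rot ρ ⟨$⟩ʳ i)) (rot ρ ⟨$⟩ʳ j)) ≡ ⌊ n /2⌋ * consecutive i j
      by-cases (yes refl) _ = trans (sum-cong λ ρ → cong (δ (mate (rot ρ ⟨$⟩ʳ i))) (rot-nx ρ i))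
        (trans (rot-sum i (λ v → δ (mate v) (nx v))) (trans count-forward
          (sym (trans (cong (⌊ n /2⌋ *_) (cong₂ _+_ (δ-refl (nx i)) (δ-≢ (nx-nx i)))) (*-identityʳ _)))))
      by-cases (no i↛j) (yes refl) = trans
        (sum-cong λ ρ → trans (cong (λ z → δ (mate z) (rot ρ ⟨$⟩ʳ j)) (rot-nx ρ j)) (mate-δ (nx (rot ρ ⟨$⟩ʳ j)) (rot ρ ⟨$⟩ʳ j)))
        (trans (rot-sum j (λ v → δ (mate v) (nx v))) (trans count-forward
          (sym (trans (cong (⌊ n /2⌋ *_) (cong₂ _+_ (δ-≢ i↛j) (δ-refl (nx j)))) (*-identityʳ _)))))
        where
        mate-δ : ∀ u v → δ (mate u) v ≡ δ (mate v) u
        mate-δ u v with mate u Fin.≟ v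
        ... | yes refl rewrite mate-involutive u = sym (δ-refl u)
        ... | no  ¬e   = sym (δ-≢ λ e → ¬e (trans (cong mate (sym e)) (mate-involutive v)))
      by-cases (no i↛j) (no j↛i) = trans (sum-cong λ ρ → δ-≢ (never ρ))
        (trans (trans (sum-const n 0) (*-zeroʳ n))
          (sym (trans (cong (⌊ n /2⌋ *_) (cong₂ _+_ (δ-≢ i↛j) (δ-≢ j↛i))) (*-zeroʳ ⌊ n /2⌋))))
        where
        never : ∀ ρ → mate (rot ρ ⟨$⟩ʳ i) ≢ rot ρ ⟨$⟩ʳ j
        never ρ e with mates-consecutive (i≢j ∘ rot-injective ρ) e
        ... | inj₁ j=ni = i↛j (rot-injective ρ (trans (rot-nx ρ i) (sym j=ni)))
        ... | inj₂ i=nj = j↛i (rot-injective ρ (trans (rot-nx ρ j) (sym i=nj)))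

  module TourWeights {n′ : ℕ} (cs : CycleSystem (4 + n′)) (k : ℕ) (R : Rotations (4 + n′))
    (x₀ : Fin (CycleSystem.M cs)) (t : Permutation′ (4 + n′))
    (tour : ∀ i j → CycleSystem.b cs x₀ (t ⟨$⟩ʳ i) (t ⟨$⟩ʳ j) ≡ Rotations.consecutive R i j) where
    open CycleSystem cs
    open Weights cs k public
    open Rotations R

    -- `∘ₚ` applies its left argument first: a vertex is replaced by its position on the tour, which
    -- is then rotated.
    τ : Fin n → Permutation′ n
    τ ρ = Perm.flip t ∘ₚ rot ρ

    -- The matching is placed on the tour in all rotated positions.
    w-tour : Fin M → ℕ
    w-tour x = sum λ ρ → w (act (τ ρ) ⟨$⟩ʳ x)

    moment-tour : ∀ u v → moment w-tour u v ≡ sum λ ρ → g (τ ρ ⟨$⟩ʳ u) (τ ρ ⟨$⟩ʳ v)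
    moment-tour u v = begin
      sum (λ x → w-tour x * b x u v)
        ≡⟨ (sum-cong λ x → sum-*ʳ (b x u v) (λ ρ → w (act (τ ρ) ⟨$⟩ʳ x))) ⟨
      sum (λ x → sum λ ρ → w (act (τ ρ) ⟨$⟩ʳ x) * b x u v)
        ≡⟨ sum-swap (λ x ρ → w (act (τ ρ) ⟨$⟩ʳ x) * b x u v) ⟩
      sum (λ ρ → moment (λ x → w (act (τ ρ) ⟨$⟩ʳ x)) u v)
        ≡⟨ (sum-cong λ ρ → moment-act (τ ρ) w u v) ⟨
      sum (λ ρ → g (τ ρ ⟨$⟩ʳ u) (τ ρ ⟨$⟩ʳ v)) ∎
      where open ≡-Reasoning

    -- This is `g-values` summed over the rotations. The ends of an edge of `x₀` become mates in
    -- ⌊n/2⌋ of them, those of other edges in none, and every vertex is the unmatched one in `odd n`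
    -- of them.
    tour-values : ∀ u v → u ≢ v →
      moment w-tour u v + (m * b x₀ u v * g₁ + 2 * odd n * g₁) ≡
      n * g₁ + (m * b x₀ u v * g₀ + 2 * odd n * g₂)
    tour-values u v u≢v = begin
      moment w-tour u v + (m * b x₀ u v * g₁ + 2 * odd n * g₁)
        ≡⟨ cong₂ _+_ (moment-tour u v) (cong₂ _+_ (sym (matched g₁)) (sym (singles g₁))) ⟩
      sum (λ ρ → G ρ) + (sum (λ ρ → d ρ * g₁) + sum (λ ρ → s ρ * g₁))
        ≡⟨ trans (sum-+ _ _) (cong (sum G +_) (sum-+ _ _)) ⟨
      sum (λ ρ → G ρ + (d ρ * g₁ + s ρ * g₁))
        ≡⟨ (sum-cong λ ρ → g-values (τ ρ ⟨$⟩ʳ u) (τ ρ ⟨$⟩ʳ v) (i≢j ∘ rot-injective ρ)) ⟩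
      sum (λ ρ → g₁ + (d ρ * g₀ + s ρ * g₂))
        ≡⟨ trans (sum-+ _ _) (cong (sum {n} (λ _ → g₁) +_) (sum-+ _ _)) ⟩
      sum {n} (λ _ → g₁) + (sum (λ ρ → d ρ * g₀) + sum (λ ρ → s ρ * g₂))
        ≡⟨ cong₂ _+_ (sum-const n g₁) (cong₂ _+_ (matched g₀) (singles g₂)) ⟩
      n * g₁ + (m * b x₀ u v * g₀ + 2 * odd n * g₂) ∎
      where
      open ≡-Reasoning
      i j : Fin n
      i = t ⟨$⟩ˡ u
      j = t ⟨$⟩ˡ v
      i≢j : i ≢ j
      i≢j e = u≢v (trans (sym (Perm.inverseʳ t)) (trans (cong (t ⟨$⟩ʳ_) e) (Perm.inverseʳ t)))
      G d s : Fin n → ℕ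
      G ρ = g (τ ρ ⟨$⟩ʳ u) (τ ρ ⟨$⟩ʳ v)
      d ρ = δ (mate (τ ρ ⟨$⟩ʳ u)) (τ ρ ⟨$⟩ʳ v)
      s ρ = single (τ ρ ⟨$⟩ʳ u) + single (τ ρ ⟨$⟩ʳ v)
      x₀-edge : b x₀ u v ≡ consecutive i j
      x₀-edge = trans (cong₂ (b x₀) (sym (Perm.inverseʳ t)) (sym (Perm.inverseʳ t))) (tour i j)
      matched : ∀ c → sum (λ ρ → d ρ * c) ≡ m * b x₀ u v * c
      matched c = trans (sum-*ʳ c d) (cong (_* c) (trans (count-matched i j i≢j) (cong (m *_) (sym x₀-edge))))
      singles : ∀ c → sum (λ ρ → s ρ * c) ≡ 2 * odd n * c
      singles c = trans (sum-*ʳ c s) (cong (_* c) (begin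
        sum s  ≡⟨ sum-+ _ _ ⟩
        sum (λ ρ → single (τ ρ ⟨$⟩ʳ u)) + sum (λ ρ → single (τ ρ ⟨$⟩ʳ v))
                                     ≡⟨ cong₂ _+_ (rot-sum i single) (rot-sum j single) ⟩
        sum (single {n}) + sum (single {n})
          ≡⟨ cong₂ _+_ (sum-single {n}) (trans (sum-single {n}) (sym (+-identityʳ (odd n)))) ⟩
        2 * odd n  ∎))

    -- Renamed by its own positions, `x₀` follows the standard tour and so contains the whole
    -- matching: the witness for `W-positive`.
    tour-pairs : ∀ i → pairs (act (Perm.flip t) ⟨$⟩ʳ x₀) i ≡ 1
    tour-pairs i = begin
      b (act (Perm.flip t) ⟨$⟩ʳ x₀) (left i) (right i)
        ≡⟨ cong₂ (b _) (Perm.inverseˡ t) (Perm.inverseˡ t) ⟨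
      b (act (Perm.flip t) ⟨$⟩ʳ x₀) (t ⟨$⟩ˡ (t ⟨$⟩ʳ left i)) (t ⟨$⟩ˡ (t ⟨$⟩ʳ right i))
        ≡⟨ b-act (Perm.flip t) x₀ _ _ ⟩
      b x₀ (t ⟨$⟩ʳ left i) (t ⟨$⟩ʳ right i)
        ≡⟨ tour (left i) (right i) ⟩
      δ (nx (left i)) (right i) + δ (nx (right i)) (left i)
        ≡⟨ cong₂ _+_ (trans (cong (λ z → δ z (right i)) (nx-left i)) (δ-refl (right {n} i)))
             (δ-≢ λ e → nx-nx (left i) (trans (cong nx (nx-left i)) e)) ⟩
      1 ∎
      where open ≡-Reasoning

  -- Polynomial inequalities in n and k.

  module Polynomials where
    open +-*-Solver using (solve; _:+_; _:*_; _:=_; con)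
    open ≤-Reasoning

    -- Once J/W is at least q/p, it remains to compare A/B with q/p, a question without `W` and `J`.
    transfer : ∀ p q A B W J .{{_ : NonZero p}} → q * W ≤ p * J → p * A ≤ B * q → A * W ≤ B * J
    transfer p q A B W J h c = *-cancelˡ-≤ p (begin
      p * (A * W)  ≡⟨ *-assoc p A W ⟨
      p * A * W  ≤⟨ *-monoˡ-≤ W c ⟩
      B * q * W  ≡⟨ *-assoc B q W ⟩
      B * (q * W)  ≤⟨ *-monoʳ-≤ B h ⟩
      B * (p * J)  ≡⟨ solve 3 (λ B p J → B :* (p :* J) := p :* (B :* J)) refl B p J ⟩
      p * (B * J)  ∎)

    -- In the next four lemmas n is the number of vertices, k the degree, and r = n − 2k;
    -- k = r + d and r = k + 1 + d (k = 1 + p) in the two cases r ≤ k and k < r.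

    even-small : ∀ r d → 4 ≤ r + d → let k = r + d ; n = k + k + r in ∀ ν → n ≡ 2 + ν →
      ν * (k * (n * n)) + n * (n * n + 10 * k) ≤ (n * n + 10 * k) * (1 + ν) * k
    -- The terms added to both sides complete ν and 1 + ν to 2 + ν, which is n, so that both sides
    -- become polynomials in r and d.
    even-small r d 4≤k ν n≡ = +-cancelʳ-≤ (2 * (k * (n * n)) + (n * n + 10 * k) * k) _ _ (begin
      ν * (k * (n * n)) + n * (n * n + 10 * k) + (2 * (k * (n * n)) + (n * n + 10 * k) * k)
        ≡⟨ solve 3 (λ ν k n → ν :* (k :* (n :* n)) :+ n :* (n :* n :+ con 10 :* k) :+ (con 2 :* (k :* (n :* n)) :+ (n :* n :+ con 10 :* k) :* k)
             := (con 2 :+ ν) :* (k :* (n :* n)) :+ n :* (n :* n :+ con 10 :* k) :+ (n :* n :+ con 10 :* k) :* k)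
                 refl ν k n ⟩
      (2 + ν) * (k * (n * n)) + n * (n * n + 10 * k) + (n * n + 10 * k) * k
        ≡⟨ cong (λ z → z * (k * (n * n)) + n * (n * n + 10 * k) + (n * n + 10 * k) * k) n≡ ⟨
      n * (k * (n * n)) + n * (n * n + 10 * k) + (n * n + 10 * k) * k
        ≡⟨ solve 2 (λ r d → let k = r :+ d ; n = k :+ k :+ r in
             n :* (k :* (n :* n)) :+ n :* (n :* n :+ con 10 :* k) :+ (n :* n :+ con 10 :* k) :* k
             := n :* n :* n :* k :+ n :* n :* n :+ n :* n :* k :+ (con 40 :* r :* r :+ con 70 :* r :* d :+ con 30 :* d :* d))
                 refl r d ⟩
      n * n * n * k + n * n * n + n * n * k + (40 * r * r + 70 * r * d + 30 * d * d)
        -- The slack is chosen so that the quadratic terms become 4 times a form whose multiple by k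
        -- occurs on the right; then 4 ≤ k applies.
        ≤⟨ m≤m+n _ (8 * r * r + 70 * r * d + 30 * d * d + d * d * d) ⟩
      n * n * n * k + n * n * n + n * n * k + (40 * r * r + 70 * r * d + 30 * d * d) + (8 * r * r + 70 * r * d + 30 * d * d + d * d * d)
        ≡⟨ solve 3 (λ a r d → a :+ (con 40 :* r :* r :+ con 70 :* r :* d :+ con 30 :* d :* d) :+ (con 8 :* r :* r :+ con 70 :* r :* d :+ con 30 :* d :* d :+ d :* d :* d)
             := a :+ (con 4 :* (con 12 :* r :* r :+ con 35 :* r :* d :+ con 15 :* d :* d) :+ d :* d :* d))
                 refl (n * n * n * k + n * n * n + n * n * k) r d ⟩
      n * n * n * k + n * n * n + n * n * k + (4 * (12 * r * r + 35 * r * d + 15 * d * d) + d * d * d)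
        ≤⟨ +-monoʳ-≤ (n * n * n * k + n * n * n + n * n * k) (+-monoˡ-≤ (d * d * d) (*-monoˡ-≤ (12 * r * r + 35 * r * d + 15 * d * d) 4≤k)) ⟩
      n * n * n * k + n * n * n + n * n * k + (k * (12 * r * r + 35 * r * d + 15 * d * d) + d * d * d)
        ≡⟨ solve 2 (λ r d → let k = r :+ d ; n = k :+ k :+ r in
             n :* n :* n :* k :+ n :* n :* n :+ n :* n :* k :+ (k :* (con 12 :* r :* r :+ con 35 :* r :* d :+ con 15 :* d :* d) :+ d :* d :* d)
             := (n :* n :+ con 10 :* k) :* n :* k :+ con 2 :* (k :* (n :* n))) refl r d ⟩
      (n * n + 10 * k) * n * k + 2 * (k * (n * n))
        ≡⟨ cong (λ z → (n * n + 10 * k) * z * k + 2 * (k * (n * n))) n≡ ⟩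
      (n * n + 10 * k) * (2 + ν) * k + 2 * (k * (n * n))
        ≡⟨ solve 4 (λ ν k c B → B :* (con 2 :+ ν) :* k :+ c
             := B :* (con 1 :+ ν) :* k :+ (c :+ B :* k)) refl ν k (2 * (k * (n * n))) (n * n + 10 * k) ⟩
      (n * n + 10 * k) * (1 + ν) * k + (2 * (k * (n * n)) + (n * n + 10 * k) * k) ∎)
      where
      k n : ℕ
      k = r + d
      n = k + k + r

    odd-small : ∀ r d → 3 ≤ r + d → let k = r + d ; n = k + k + r in ∀ ν → n ≡ 3 + ν →
      ν * (k * (n * n)) + (1 + ν) * (n * n + 10 * k) ≤ (n * n + 10 * k) * (1 + ν) * k
    odd-small r d 3≤k ν n≡ = +-cancelʳ-≤ (3 * (k * (n * n)) + 2 * B + 2 * B * k) _ _ (begin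
      ν * (k * (n * n)) + (1 + ν) * B + (3 * (k * (n * n)) + 2 * B + 2 * B * k)
        ≡⟨ solve 4 (λ ν c B k → ν :* c :+ (con 1 :+ ν) :* B :+ (con 3 :* c :+ con 2 :* B :+ con 2 :* B :* k)
             := (con 3 :+ ν) :* c :+ (con 3 :+ ν) :* B :+ con 2 :* B :* k) refl ν (k * (n * n)) B k ⟩
      (3 + ν) * (k * (n * n)) + (3 + ν) * B + 2 * B * k
        ≡⟨ cong (λ z → z * (k * (n * n)) + z * B + 2 * B * k) n≡ ⟨
      n * (k * (n * n)) + n * B + 2 * B * k
        ≡⟨ solve 2 (λ r d → let k = r :+ d ; n = k :+ k :+ r ; B = n :* n :+ con 10 :* k in
             n :* (k :* (n :* n)) :+ n :* B :+ con 2 :* B :* k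
             := n :* n :* n :* k :+ n :* n :* n :+ con 2 :* (n :* n :* k) :+ (con 50 :* r :* r :+ con 90 :* r :* d :+ con 40 :* d :* d))
                 refl r d ⟩
      c + (50 * r * r + 90 * r * d + 40 * d * d)
        ≤⟨ m≤m+n _ (4 * r * r + 39 * r * d + 13 * d * d + d * d * d) ⟩
      c + (50 * r * r + 90 * r * d + 40 * d * d) + (4 * r * r + 39 * r * d + 13 * d * d + d * d * d)
        ≡⟨ solve 3 (λ a r d → a :+ (con 50 :* r :* r :+ con 90 :* r :* d :+ con 40 :* d :* d) :+ (con 4 :* r :* r :+ con 39 :* r :* d :+ con 13 :* d :* d :+ d :* d :* d)
             := a :+ (con 3 :* (con 12 :* r :* r :+ con 35 :* r :* d :+ con 15 :* d :* d) :+ (con 18 :* r :* r :+ con 24 :* r :* d :+ con 8 :* d :* d :+ d :* d :* d)))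
                 refl c r d ⟩
      c + (3 * (12 * r * r + 35 * r * d + 15 * d * d) + (18 * r * r + 24 * r * d + 8 * d * d + d * d * d))
        ≤⟨ +-monoʳ-≤ c (+-monoˡ-≤ _ (*-monoˡ-≤ (12 * r * r + 35 * r * d + 15 * d * d) 3≤k)) ⟩
      c + (k * (12 * r * r + 35 * r * d + 15 * d * d) + (18 * r * r + 24 * r * d + 8 * d * d + d * d * d))
        ≤⟨ m≤m+n _ (20 * k) ⟩
      c + (k * (12 * r * r + 35 * r * d + 15 * d * d) + (18 * r * r + 24 * r * d + 8 * d * d + d * d * d)) + 20 * k
        ≡⟨ solve 2 (λ r d → let k = r :+ d ; n = k :+ k :+ r ; B = n :* n :+ con 10 :* k in
             n :* n :* n :* k :+ n :* n :* n :+ con 2 :* (n :* n :* k)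
               :+ (k :* (con 12 :* r :* r :+ con 35 :* r :* d :+ con 15 :* d :* d) :+ (con 18 :* r :* r :+ con 24 :* r :* d :+ con 8 :* d :* d :+ d :* d :* d)) :+ con 20 :* k
             := B :* n :* k :+ (con 3 :* (k :* (n :* n)) :+ con 2 :* B)) refl r d ⟩
      B * n * k + (3 * (k * (n * n)) + 2 * B)
        ≡⟨ cong (λ z → B * z * k + (3 * (k * (n * n)) + 2 * B)) n≡ ⟩
      B * (3 + ν) * k + (3 * (k * (n * n)) + 2 * B)
        ≡⟨ solve 4 (λ ν k c B → B :* (con 3 :+ ν) :* k :+ (c :+ con 2 :* B)
             := B :* (con 1 :+ ν) :* k :+ (c :+ con 2 :* B :+ con 2 :* B :* k)) refl ν k (3 * (k * (n * n))) B ⟩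
      B * (1 + ν) * k + (3 * (k * (n * n)) + 2 * B + 2 * B * k) ∎)
      where
      k n B c : ℕ
      k = r + d
      n = k + k + r
      B = n * n + 10 * k
      c = n * n * n * k + n * n * n + 2 * (n * n * k)

    even-large : ∀ p d → let k = 1 + p ; ν = 2 + 3 * p + d ; n = 2 + ν ; B = n * n + 10 * k in
      (k + d) * (ν * (k * (n * n)) + n * B) ≤ B * (1 + ν) * (1 + d + k * k + k * d)
    -- In terms of p and d, where n = 4 + 3p + d, the difference of the two sides has only
    -- nonnegative coefficients.
    even-large p d = ≤-trans (m≤m+n _ _) (≤-reflexive
      (solve 2 (λ p d → let k = con 1 :+ p ; ν = con 2 :+ con 3 :* p :+ d ; n = con 2 :+ ν ; B = n :* n :+ con 10 :* k in
        (k :+ d) :* (ν :* (k :* (n :* n)) :+ n :* B)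
          :+ con 2 :* k :* (con 10 :+ con 9 :* p :+ con 6 :* p :* p :+ con 6 :* p :* p :* p :+ con 15 :* d
               :+ con 27 :* p :* d :+ con 14 :* p :* p :* d :+ con 5 :* d :* d :+ con 4 :* p :* d :* d)
        := B :* (con 1 :+ ν) :* (con 1 :+ d :+ k :* k :+ k :* d)) refl p d))

    odd-large : ∀ p d → let k = 1 + p ; r = 1 + (k + d) ; ν = 1 + 3 * p + d ; n = 3 + ν ; B = n * n + 10 * k in
      r * (ν * (k * (n * n)) + (1 + ν) * B) ≤ B * (1 + ν) * (r + k * (k + d))
    odd-large p d = ≤-trans (m≤m+n _ _) (≤-reflexive
      (solve 2 (λ p d → let k = con 1 :+ p ; r = con 1 :+ (k :+ d) ; ν = con 1 :+ con 3 :* p :+ d ; n = con 3 :+ ν ; B = n :* n :+ con 10 :* k in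
        r :* (ν :* (k :* (n :* n)) :+ (con 1 :+ ν) :* B)
          :+ k :* (con 20 :+ con 38 :* p :+ con 32 :* p :* p :+ con 12 :* p :* p :* p :+ con 30 :* d
               :+ con 54 :* p :* d :+ con 28 :* p :* p :* d :+ con 10 :* d :* d :+ con 8 :* p :* d :* d)
        := B :* (con 1 :+ ν) :* (r :+ k :* (k :+ d))) refl p d))

  -- From the bounds on J to the bound on n W / G.

  module Estimates where
    open Polynomials
    open +-*-Solver using (solve; _:+_; _:*_; _:=_; con)
    open ≤-Reasoning

    -- The degree equation turns ν m g₁ into n W - m g₀, which leaves a comparison of W with J = m
    -- g₀. For c = k n² and B = n² + 10k the conclusion says n W / G ≤ n/k + 10/n.
    even-final : ∀ ν m c B W g₀ g₁ .{{_ : NonZero ν}} → m + m ≡ 2 + ν → 2 * W ≡ ν * g₁ + g₀ →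
      (ν * c + (2 + ν) * B) * W ≤ B * (1 + ν) * (m * g₀) → c * W + B * (m * g₁) ≤ B * (m * g₀)
    even-final ν m c B W g₀ g₁ 2m deg h = *-cancelˡ-≤ ν (+-cancelʳ-≤ (B * (m * g₀)) _ _ (begin
      ν * (c * W + B * (m * g₁)) + B * (m * g₀)
        ≡⟨ solve 7 (λ ν m c B W g₀ g₁ → ν :* (c :* W :+ B :* (m :* g₁)) :+ B :* (m :* g₀)
             := ν :* c :* W :+ B :* m :* (ν :* g₁ :+ g₀)) refl ν m c B W g₀ g₁ ⟩
      ν * c * W + B * m * (ν * g₁ + g₀)
        ≡⟨ cong (λ z → ν * c * W + B * m * z) deg ⟨
      ν * c * W + B * m * (2 * W)
        ≡⟨ solve 5 (λ ν m c B W → ν :* c :* W :+ B :* m :* (con 2 :* W)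
             := (ν :* c :+ (m :+ m) :* B) :* W) refl ν m c B W ⟩
      (ν * c + (m + m) * B) * W
        ≡⟨ cong (λ z → (ν * c + z * B) * W) 2m ⟩
      (ν * c + (2 + ν) * B) * W
        ≤⟨ h ⟩
      B * (1 + ν) * (m * g₀)
        ≡⟨ solve 3 (λ B ν J → B :* (con 1 :+ ν) :* J := ν :* (B :* J) :+ B :* J) refl B ν (m * g₀) ⟩
      ν * (B * (m * g₀)) + B * (m * g₀) ∎))

    -- After multiplication by m the unmatched vertex accounts for m g₂ = W in the degree equation,
    -- hence the factor 1 + ν = n - 2 where the even case has n.
    odd-final : ∀ ν m c B W g₀ g₁ .{{_ : NonZero ν}} → (1 + ν) * W ≡ ν * (m * g₁) + m * g₀ →
      (ν * c + (1 + ν) * B) * W ≤ B * (1 + ν) * (m * g₀) → c * W + B * (m * g₁) ≤ B * (m * g₀)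
    odd-final ν m c B W g₀ g₁ deg h = *-cancelˡ-≤ ν (+-cancelʳ-≤ (B * (m * g₀)) _ _ (begin
      ν * (c * W + B * (m * g₁)) + B * (m * g₀)
        ≡⟨ solve 6 (λ ν c B W G₀ G₁ → ν :* (c :* W :+ B :* G₁) :+ B :* G₀
             := ν :* c :* W :+ B :* (ν :* G₁ :+ G₀)) refl ν c B W (m * g₀) (m * g₁) ⟩
      ν * c * W + B * (ν * (m * g₁) + m * g₀)
        ≡⟨ cong (λ z → ν * c * W + B * z) deg ⟨
      ν * c * W + B * ((1 + ν) * W)
        ≡⟨ solve 4 (λ ν c B W → ν :* c :* W :+ B :* ((con 1 :+ ν) :* W)
             := (ν :* c :+ (con 1 :+ ν) :* B) :* W) refl ν c B W ⟩
      (ν * c + (1 + ν) * B) * W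
        ≤⟨ h ⟩
      B * (1 + ν) * (m * g₀)
        ≡⟨ solve 3 (λ B ν J → B :* (con 1 :+ ν) :* J := ν :* (B :* J) :+ B :* J) refl B ν (m * g₀) ⟩
      ν * (B * (m * g₀)) + B * (m * g₀) ∎))

    Linear : (D r k W J : ℕ) → Set
    Linear D r k W J = (2 * r * D + r * r * k) * W + r * J ≤ r * r * J + (r * k + 2 * k * D) * W

    -- All uncovered vertices are paired, so 2D = r and a factor r cancels. What remains is J ≥ (k +
    -- (r - k)/(r - 1)) W.
    linear-even : ∀ D k d W J → D + D ≡ 1 + (k + d) → Linear D (1 + (k + d)) k W J →
      (1 + d + k * k + k * d) * W ≤ (k + d) * J
    linear-even D k d W J 2D h = +-cancelʳ-≤ (2 * k * W + J) _ _ (*-cancelˡ-≤ r (begin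
      r * ((1 + d + k * k + k * d) * W + (2 * k * W + J))
        ≡⟨ solve 4 (λ k d W J → let r = con 1 :+ (k :+ d) in
             r :* ((con 1 :+ d :+ k :* k :+ k :* d) :* W :+ (con 2 :* k :* W :+ J))
                  := (r :* r :+ r :* r :* k) :* W :+ r :* J) refl k d W J ⟩
      (r * r + r * r * k) * W + r * J
        ≡⟨ cong (λ z → (r * z + r * r * k) * W + r * J) 2D ⟨
      (r * (D + D) + r * r * k) * W + r * J
        ≡⟨ solve 5 (λ r D k W J → (r :* (D :+ D) :+ r :* r :* k) :* W :+ r :* J
             := (con 2 :* r :* D :+ r :* r :* k) :* W :+ r :* J) refl r D k W J ⟩
      (2 * r * D + r * r * k) * W + r * J
        ≤⟨ h ⟩
      r * r * J + (r * k + 2 * k * D) * W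
        ≡⟨ solve 5 (λ r D k W J → r :* r :* J :+ (r :* k :+ con 2 :* k :* D) :* W
             := r :* r :* J :+ (r :* k :+ k :* (D :+ D)) :* W) refl r D k W J ⟩
      r * r * J + (r * k + k * (D + D)) * W
        ≡⟨ cong (λ z → r * r * J + (r * k + k * z) * W) 2D ⟩
      r * r * J + (r * k + k * r) * W
        ≡⟨ solve 4 (λ k d W J → let r = con 1 :+ (k :+ d) in
             r :* r :* J :+ (r :* k :+ k :* r) :* W := r :* ((k :+ d) :* J :+ (con 2 :* k :* W :+ J))) refl k d W J ⟩
      r * ((k + d) * J + (2 * k * W + J)) ∎))
      where
      r : ℕ
      r = 1 + (k + d)

    -- One uncovered vertex is unmatched, so 2D = r - 1, and this factor cancels. What remains is J
    -- ≥ (k + (r - k)/r) W.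
    linear-odd : ∀ D k e W J .{{_ : NonZero e}} → D + D ≡ e → Linear D (1 + e) k W J →
      (1 + e + k * e) * W ≤ (1 + e) * J
    linear-odd D k e W J 2D h = *-cancelˡ-≤ e (+-cancelʳ-≤ (e * (k * W) + (r * k * W + r * J)) _ _ (begin
      e * ((1 + e + k * e) * W) + (e * (k * W) + (r * k * W + r * J))
        ≡⟨ solve 4 (λ k e W J → let r = con 1 :+ e in
             e :* ((con 1 :+ e :+ k :* e) :* W) :+ (e :* (k :* W) :+ (r :* k :* W :+ r :* J))
                  := (r :* e :+ r :* r :* k) :* W :+ r :* J) refl k e W J ⟩
      (r * e + r * r * k) * W + r * J
        ≡⟨ cong (λ z → (r * z + r * r * k) * W + r * J) 2D ⟨
      (r * (D + D) + r * r * k) * W + r * J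
        ≡⟨ solve 5 (λ r D k W J → (r :* (D :+ D) :+ r :* r :* k) :* W :+ r :* J
             := (con 2 :* r :* D :+ r :* r :* k) :* W :+ r :* J) refl r D k W J ⟩
      (2 * r * D + r * r * k) * W + r * J
        ≤⟨ h ⟩
      r * r * J + (r * k + 2 * k * D) * W
        ≡⟨ solve 5 (λ r D k W J → r :* r :* J :+ (r :* k :+ con 2 :* k :* D) :* W
             := r :* r :* J :+ (r :* k :+ k :* (D :+ D)) :* W) refl r D k W J ⟩
      r * r * J + (r * k + k * (D + D)) * W
        ≡⟨ cong (λ z → r * r * J + (r * k + k * z) * W) 2D ⟩
      r * r * J + (r * k + k * e) * W
        ≡⟨ solve 4 (λ k e W J → let r = con 1 :+ e in
             r :* r :* J :+ (r :* k :+ k :* e) :* W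
                  := e :* (r :* J) :+ (e :* (k :* W) :+ (r :* k :* W :+ r :* J))) refl k e W J ⟩
      e * (r * J) + (e * (k * W) + (r * k * W + r * J)) ∎))
      where
      r : ℕ
      r = 1 + e

    module Estimate {n′ : ℕ} (cs : CycleSystem (4 + n′)) (k : ℕ) where
      open Weights cs k

      B : ℕ
      B = n * n + 10 * k

      -- For r ≤ k the improvement is not positive, but then n ≤ 3k and J ≥ k W is enough. For k < r
      -- the improved bound is available because some pair is unchosen.
      estimate : 9 ≤ n → 1 ≤ k → k ≤ m → k * (n * n) * W + B * (m * g₁) ≤ B * (m * g₀)
      estimate 9≤n 1≤k k≤m = by-parity (odd-bool n)
        where
        D : ℕ
        D = m ∸ k
        D+k : D + k ≡ m
        D+k = m∸n+n≡m k≤m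
        Goal : Set
        Goal = k * (n * n) * W + B * (m * g₁) ≤ B * (m * g₀)
        r+2k : ∀ {o} → odd n ≡ o → D + D + o + (k + k) ≡ n
        r+2k {o} e = trans (solve 3 (λ D o k → D :+ D :+ o :+ (k :+ k) := (D :+ k) :+ (D :+ k) :+ o) refl D o k)
          (trans (cong₂ _+_ (cong₂ _+_ D+k D+k) (sym e)) (sym (halves n)))
        k<m : 0 < D → k < m
        k<m 0<D = ≤-trans (+-monoˡ-≤ k 0<D) (≤-reflexive D+k)
        0<D+D⇒0<D : ∀ {x} → 0 < x → D + D ≡ x → 0 < D
        0<D+D⇒0<D 0<x e with D
        ... | zero  = ≤-trans 0<x (≤-reflexive (sym e))
        ... | suc _ = s≤s z≤n

        even-case : odd n ≡ 0 → ∀ r → D + D ≡ r → r + (k + k) ≡ n → Goal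
        even-case e r 2D r+2k = even-final (2 + n′) m (k * (n * n)) B W g₀ g₁ 2m deg (main (r ≤? k))
          where
          ν : ℕ
          ν = 2 + n′
          2m : m + m ≡ n
          2m = trans (sym (+-identityʳ _)) (trans (cong (m + m +_) (sym e)) (sym (halves n)))
          deg : 2 * W ≡ ν * g₁ + g₀
          deg = +-cancelʳ-≡ (2 * g₁) _ _ (trans (sym (cong (2 * W +_) (+-identityʳ (2 * g₁))))
            (trans (subst (λ o → 2 * W + (2 * g₁ + o * g₁) ≡ n * g₁ + (g₀ + o * g₂)) e degree-zero)
              (solve 3 (λ ν h a → (con 2 :+ ν) :* h :+ (a :+ con 0) := ν :* h :+ a :+ con 2 :* h) refl ν g₁ g₀)))
          main : Dec (r ≤ k) → (ν * (k * (n * n)) + n * B) * W ≤ B * (1 + ν) * (m * g₀)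
          main (yes r≤k) = small (k ∸ r) (m+[n∸m]≡n r≤k)
            where
            -- As n ≤ 3k, a value k ≤ 3 would force n = 9, which is odd.
            4≤k : 4 ≤ k
            4≤k = ≰⇒> λ k≤3 → contradiction (trans (sym e) (cong odd (nine k≤3))) λ ()
              where
              nine : k ≤ 3 → n ≡ 9
              nine k≤3 = ≤-antisym (subst (_≤ 9) r+2k
                (+-mono-≤ (≤-trans r≤k k≤3) (+-mono-≤ k≤3 k≤3))) 9≤n
            small : ∀ d → r + d ≡ k → (ν * (k * (n * n)) + n * B) * W ≤ B * (1 + ν) * (m * g₀)
            small d refl with trans (+-comm (k + k) r) r+2k
            ... | n≡ = ≤-trans (*-monoˡ-≤ W
                (subst (λ n → ν * (k * (n * n)) + n * (n * n + 10 * k) ≤ (n * n + 10 * k) * (1 + ν) * k) n≡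
                  (even-small r d 4≤k ν n≡)))
              (≤-trans (≤-reflexive (*-assoc (B * (1 + ν)) k W)) (*-monoʳ-≤ (B * (1 + ν)) J-lower))
          main (no r≰k) = large k refl (r ∸ suc k) (m+[n∸m]≡n (≰⇒> r≰k)) 1≤k
            where
            lin : Linear D r k W (m * g₀)
            lin = J-linear D r (k<m (0<D+D⇒0<D (≤-trans (s≤s z≤n) (≰⇒> r≰k)) 2D)) D+k r+2k
            large : ∀ k′ → k′ ≡ k → ∀ d → suc k′ + d ≡ r → 1 ≤ k′ → (ν * (k * (n * n)) + n * B) * W ≤ B * (1 + ν) * (m * g₀)
            large (suc p) refl d refl _ =
              transfer (k + d) (1 + d + k * k + k * d) (ν * (k * (n * n)) + n * B) (B * (1 + ν)) W (m * g₀)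
              (linear-even D k d W (m * g₀) 2D lin)
              (subst (λ ν → (k + d) * (ν * (k * ((2 + ν) * (2 + ν))) + (2 + ν) * ((2 + ν) * (2 + ν) + 10 * k))
                  ≤ ((2 + ν) * (2 + ν) + 10 * k) * (1 + ν) * (1 + d + k * k + k * d))
                (+-cancelˡ-≡ 2 _ _ (trans (solve 2 (λ p d → con 4 :+ con 3 :* p :+ d
                     := con 2 :+ p :+ d :+ (con 1 :+ p :+ (con 1 :+ p))) refl p d) r+2k))
                (even-large p d))

        odd-case : odd n ≡ 1 → ∀ r → D + D + 1 ≡ r → r + (k + k) ≡ n → Goal
        odd-case e r 2D+1 r+2k = odd-final (1 + n′) m (k * (n * n)) B W g₀ g₁ deg (main (r ≤? k))
          where
          ν : ℕ
          ν = 1 + n′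
          2m+1 : m + m + 1 ≡ n
          2m+1 = trans (cong (m + m +_) (sym e)) (sym (halves n))
          -- The degree equation at the unmatched vertex is 2W = (n - 1) g₂, and n - 1 = 2m.
          W≡mg₂ : W ≡ m * g₂
          W≡mg₂ = *-cancelˡ-≡ W (m * g₂) 2 (+-cancelʳ-≡ g₂ _ _ (trans (degree-single e)
            (trans (cong (_* g₂) (sym 2m+1)) (solve 2 (λ m a → (m :+ m :+ con 1) :* a
                 := con 2 :* (m :* a) :+ a) refl m g₂))))
          deg₁ : 2 * W ≡ ν * g₁ + g₀ + g₂
          deg₁ = +-cancelʳ-≡ (3 * g₁) _ _ (trans
            (solve 2 (λ a h → a :+ con 3 :* h := a :+ (con 2 :* h :+ con 1 :* h)) refl (2 * W) g₁)
            (trans (subst (λ o → 2 * W + (2 * g₁ + o * g₁) ≡ n * g₁ + (g₀ + o * g₂)) e degree-zero)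
              (solve 4 (λ ν h a c → (con 3 :+ ν) :* h :+ (a :+ con 1 :* c)
                   := ν :* h :+ a :+ c :+ con 3 :* h) refl ν g₁ g₀ g₂)))
          deg : (1 + ν) * W ≡ ν * (m * g₁) + m * g₀
          deg = +-cancelʳ-≡ W _ _ (begin-equality
            (1 + ν) * W + W  ≡⟨ solve 2 (λ ν W → (con 1 :+ ν) :* W :+ W := (con 2 :+ ν) :* W) refl ν W ⟩
            (2 + ν) * W  ≡⟨ cong (_* W) (suc-injective (trans (sym 2m+1) (+-comm (m + m) 1))) ⟩
            (m + m) * W  ≡⟨ solve 2 (λ m W → (m :+ m) :* W := m :* (con 2 :* W)) refl m W ⟩
            m * (2 * W)  ≡⟨ cong (m *_) deg₁ ⟩
            m * (ν * g₁ + g₀ + g₂)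
              ≡⟨ solve 5 (λ m ν h a c → m :* (ν :* h :+ a :+ c)
                   := ν :* (m :* h) :+ m :* a :+ m :* c) refl m ν g₁ g₀ g₂ ⟩
            ν * (m * g₁) + m * g₀ + m * g₂  ≡⟨ cong (ν * (m * g₁) + m * g₀ +_) W≡mg₂ ⟨
            ν * (m * g₁) + m * g₀ + W  ∎)
          main : Dec (r ≤ k) → (ν * (k * (n * n)) + (1 + ν) * B) * W ≤ B * (1 + ν) * (m * g₀)
          main (yes r≤k) = small (k ∸ r) (m+[n∸m]≡n r≤k)
            where
            3≤k : 3 ≤ k
            3≤k = ≰⇒> λ k≤2 → contradiction (≤-trans 9≤n (subst (_≤ 6) r+2k
              (+-mono-≤ (≤-trans r≤k k≤2) (+-mono-≤ k≤2 k≤2)))) (<⇒≱ (s≤s (s≤s (s≤s (s≤s (s≤s (s≤s (s≤s z≤n))))))))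
            small : ∀ d → r + d ≡ k → (ν * (k * (n * n)) + (1 + ν) * B) * W ≤ B * (1 + ν) * (m * g₀)
            small d refl with trans (+-comm (k + k) r) r+2k
            ... | n≡ = ≤-trans (*-monoˡ-≤ W
                (subst (λ n → ν * (k * (n * n)) + (1 + ν) * (n * n + 10 * k) ≤ (n * n + 10 * k) * (1 + ν) * k) n≡
                  (odd-small r d 3≤k ν n≡)))
              (≤-trans (≤-reflexive (*-assoc (B * (1 + ν)) k W)) (*-monoʳ-≤ (B * (1 + ν)) J-lower))
          main (no r≰k) = large k refl (r ∸ suc k) (m+[n∸m]≡n (≰⇒> r≰k)) 1≤k
            where
            large : ∀ k′ → k′ ≡ k → ∀ d → suc k′ + d ≡ r → 1 ≤ k′ → (ν * (k * (n * n)) + (1 + ν) * B) * W ≤ B * (1 + ν) * (m * g₀)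
            large (suc p) refl d refl _ =
              transfer (1 + (k + d)) (1 + (k + d) + k * (k + d)) (ν * (k * (n * n)) + (1 + ν) * B) (B * (1 + ν)) W (m * g₀)
              (linear-odd D k (k + d) W (m * g₀) 2D lin)
              (subst (λ ν → r * (ν * (k * ((3 + ν) * (3 + ν))) + (1 + ν) * ((3 + ν) * (3 + ν) + 10 * k))
                  ≤ ((3 + ν) * (3 + ν) + 10 * k) * (1 + ν) * (r + k * (k + d)))
                (+-cancelˡ-≡ 3 _ _ (trans (solve 2 (λ p d → con 4 :+ con 3 :* p :+ d
                     := con 2 :+ p :+ d :+ (con 1 :+ p :+ (con 1 :+ p))) refl p d) r+2k))
                (odd-large p d))
              where
              2D : D + D ≡ k + d
              2D = suc-injective (trans (+-comm 1 (D + D)) 2D+1)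
              lin : Linear D r k W (m * g₀)
              lin = J-linear D r (k<m (0<D+D⇒0<D (s≤s z≤n) 2D)) D+k r+2k

        by-parity : odd n ≡ 0 ⊎ odd n ≡ 1 → Goal
        by-parity (inj₁ e) = even-case e (D + D) refl (trans (cong (_+ (k + k)) (sym (+-identityʳ (D + D)))) (r+2k e))
        by-parity (inj₂ e) = odd-case e (D + D + 1) refl (r+2k e)

  -- Certificates: the combinatorial input for one cycle.

  open Estimates using (module Estimate)

  -- The interface between counting and real numbers. All fields concern natural numbers: G is A -
  -- A′, and β - β′ is the moment at the edges off `x₀`. The weight `w` is the rotated one and `W`
  -- the total before rotation, so the total of `w` is `n * W`.
  record Certificate {n : ℕ} (cs : CycleSystem n) (k : ℕ) (x₀ : Fin (CycleSystem.M cs)) : Set₁ where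
    open CycleSystem cs
    open Moments cs using (moment)
    field
      w : Fin M → ℕ
      -- An induction principle: `w` is a sum of monomials of degree `k`, each taken over pairs of a
      -- relabelled matching.
      w-squares : (K : (Fin M → ℕ) → Set) → K (λ _ → 0) → (∀ {f g} → K f → K g → K (λ x → f x + g x)) →
        (∀ {f g} → (∀ x → f x ≡ g x) → K f → K g) →
        (∀ (σ : Permutation′ n) (s : Subset ⌊ n /2⌋) → size s ≡ k →
          K (λ x → prod s λ i → b x (σ ⟨$⟩ʳ left i) (σ ⟨$⟩ʳ right i))) →
        K w
      W T A A′ β β′ : ℕ
      values : ∀ u v → u ≢ v → moment w u v + (A′ * b x₀ u v + β′) ≡ β + A * b x₀ u v
      count : ∀ u v → u ≢ v → moment (λ _ → 1) u v ≡ T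
      count-total : 2 * M + T ≡ n * T
      values-total : 2 * (n * W) + 2 * A′ + n * β′ + β ≡ n * β + 2 * A + β′
      estimate : k * (n * n) * W + (n * n + 10 * k) * A′ ≤ (n * n + 10 * k) * A
      W-positive : 1 ≤ W

  sum-closed : ∀ {A : Set} (K : (A → ℕ) → Set) → K (λ _ → 0) → (∀ {f g} → K f → K g → K (λ x → f x + g x)) →
    (∀ {f g} → (∀ x → f x ≡ g x) → K f → K g) →
    ∀ {m} (F : Fin m → A → ℕ) → (∀ i → K (F i)) → K (λ x → sum λ i → F i x)
  sum-closed K K0 K+ K≡ {zero}  F h = K≡ (λ x → sym (sum-zero _)) K0
  sum-closed K K0 K+ K≡ {suc m} F h = K≡ (λ x → sym (sum-suc _))
    (K+ (h zero) (sum-closed K K0 K+ K≡ (λ i → F (suc i)) (λ i → h (suc i))))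

  module _ {n′ : ℕ} (cs : CycleSystem (4 + n′)) (R : Rotations (4 + n′)) (k : ℕ)
    (x₀ : Fin (CycleSystem.M cs)) (t : Permutation′ (4 + n′))
    (tour : ∀ i j → CycleSystem.b cs x₀ (t ⟨$⟩ʳ i) (t ⟨$⟩ʳ j) ≡ Rotations.consecutive R i j) where
    open CycleSystem cs
    open TourWeights cs k R x₀ t tour
    open Rotations R

    private
      β β′ : ℕ
      β  = n * g₁ + 2 * odd n * g₂
      β′ = 2 * odd n * g₁

      values′ : ∀ u v → u ≢ v → moment w-tour u v + (m * g₁ * b x₀ u v + β′) ≡ β + m * g₀ * b x₀ u v
      values′ u v u≢v = trans
        (cong (λ z → moment w-tour u v + (z + β′)) (solve 3 (λ m g b → m :* g :* b
             := m :* b :* g) refl m g₁ (b x₀ u v)))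
        (trans (tour-values u v u≢v)
          (solve 5 (λ m g b p q → p :+ (m :* b :* g :+ q)
               := p :+ q :+ m :* g :* b) refl m g₀ (b x₀ u v) (n * g₁) (2 * odd n * g₂)))
        where open +-*-Solver using (solve; _:+_; _:*_; _:=_; con)

      sum-w-tour : sum w-tour ≡ n * W
      sum-w-tour = trans (sum-swap λ x ρ → w (act (τ ρ) ⟨$⟩ʳ x)) (trans
        (sum-cong λ ρ → sym (sum-act (τ ρ) w)) (sum-const n W))

      -- The degree equation at vertex 0 for the weight 1, with T filling the vanishing diagonal
      -- entry.
      count-total′ : 2 * M + moment (λ _ → 1) zero (suc zero) ≡ n * moment (λ _ → 1) zero (suc zero)
      count-total′ = begin
        2 * M + T
          ≡⟨ cong₂ _+_ (trans (cong (2 *_) (trans (sym (*-identityʳ M)) (sym (sum-const M 1)))) (sym (moment-degree (λ _ → 1) zero))) (sym (sum-δ′ zero T)) ⟩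
        sum (moment (λ _ → 1) zero) + sum (λ v → δ zero v * T)
          ≡⟨ sum-+ (moment (λ _ → 1) zero) (λ v → δ zero v * T) ⟨
        sum (λ v → moment (λ _ → 1) zero v + δ zero v * T)  ≡⟨ sum-cong entry ⟩
        sum {n} (λ _ → T)  ≡⟨ sum-const n T ⟩
        n * T  ∎
        where
        open ≡-Reasoning
        T : ℕ
        T = moment (λ _ → 1) zero (suc zero)
        entry : ∀ v → moment (λ _ → 1) zero v + δ zero v * T ≡ T
        entry zero    = trans (cong (_+ (T + 0)) (moment-irrefl (λ _ → 1) zero)) (+-identityʳ T)
        entry (suc v) = trans (+-identityʳ _) (count-constant (λ ()) (λ ()))

      values-total′ : 2 * (n * W) + 2 * (m * g₁) + n * β′ + β ≡ n * β + 2 * (m * g₀) + β′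
      values-total′ = begin
        2 * (n * W) + 2 * A′ + n * β′ + β
          ≡⟨ solve 4 (λ a c d e → a :+ c :+ d :+ e := a :+ (c :+ d) :+ e) refl (2 * (n * W)) (2 * A′) (n * β′) β ⟩
        2 * (n * W) + (2 * A′ + n * β′) + β
          ≡⟨ cong₂ _+_ (cong₂ _+_ (trans (cong (2 *_) (sym sum-w-tour)) (sym (moment-degree w-tour zero)))
               (cong₂ _+_ (trans (*-comm 2 A′) (sym (row A′))) (sym (sum-const n β′)))) (sym (sum-δ′ zero β)) ⟩
        sum (moment w-tour zero) + (sum (λ v → A′ * b x₀ zero v) + sum {n} (λ _ → β′)) + sum (λ v → δ zero v * β)
          ≡⟨ trans (sum-+ _ _) (cong (_+ sum (λ v → δ zero v * β)) (trans (sum-+ _ _) (cong (sum (moment w-tour zero) +_) (sum-+ _ _)))) ⟨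
        sum (λ v → moment w-tour zero v + (A′ * b x₀ zero v + β′) + δ zero v * β)
          ≡⟨ sum-cong entry ⟩
        sum (λ v → β + A * b x₀ zero v + δ zero v * β′)
          ≡⟨ trans (sum-+ _ _) (cong (_+ sum (λ v → δ zero v * β′)) (sum-+ _ _)) ⟩
        sum {n} (λ _ → β) + sum (λ v → A * b x₀ zero v) + sum (λ v → δ zero v * β′)
          ≡⟨ cong₂ _+_ (cong₂ _+_ (sum-const n β) (trans (row A) (*-comm A 2))) (sum-δ′ zero β′) ⟩
        n * β + 2 * A + β′ ∎
        where
        open ≡-Reasoning
        open +-*-Solver using (solve; _:+_; _:*_; _:=_; con)
        A A′ : ℕ
        A  = m * g₀
        A′ = m * g₁
        row : ∀ c → sum (λ v → c * b x₀ zero v) ≡ c * 2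
        row c = trans (sum-*ˡ c (b x₀ zero)) (cong (c *_) (b-degree x₀ zero))
        entry : ∀ v → moment w-tour zero v + (A′ * b x₀ zero v + β′) + δ zero v * β ≡ β + A * b x₀ zero v + δ zero v * β′
        entry zero rewrite moment-irrefl w-tour zero | b-irrefl x₀ zero =
          solve 4 (λ a c p q → a :* con 0 :+ q :+ con 1 :* p := p :+ c :* con 0 :+ con 1 :* q) refl A′ A β β′
        entry (suc v) = cong (_+ 0) (values′ zero (suc v) (λ ()))

    tour-certificate : 9 ≤ n → 1 ≤ k → k ≤ m → Certificate cs k x₀
    tour-certificate 9≤n 1≤k k≤m = record
      { w = w-tour
      ; w-squares = λ K K0 K+ K≡ Ksq →
          sum-closed K K0 K+ K≡ (λ ρ x → w (act (τ ρ) ⟨$⟩ʳ x)) λ ρ →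
            sumSub-closed K K0 K+ m k (λ s x → prod s (pairs (act (τ ρ) ⟨$⟩ʳ x))) λ s e →
              -- Acting on `x` by `τ ρ` has the same effect as moving the matching by the inverse
              -- permutation.
              K≡ (λ x → prod-cong s λ i _ → moved ρ x i) (Ksq (Perm.flip (τ ρ)) s e)
      ; W = W ; T = moment (λ _ → 1) zero (suc zero) ; A = m * g₀ ; A′ = m * g₁ ; β = β ; β′ = β′
      ; values = values′
      ; count = λ u v u≢v → count-constant u≢v λ ()
      ; count-total = count-total′
      ; values-total = values-total′
      ; estimate = Estimate.estimate cs k 9≤n 1≤k k≤m
      ; W-positive = W-positive k≤m (act (Perm.flip t) ⟨$⟩ʳ x₀) tour-pairs
      }
      where
      moved : ∀ ρ x i → b x (τ ρ ⟨$⟩ˡ left i) (τ ρ ⟨$⟩ˡ right i) ≡ pairs (act (τ ρ) ⟨$⟩ʳ x) i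
      moved ρ x i = trans (sym (b-act (τ ρ) x _ _))
        (cong₂ (b (act (τ ρ) ⟨$⟩ʳ x)) (Perm.inverseʳ (τ ρ)) (Perm.inverseʳ (τ ρ)))

  certificate : ∀ {n} (cs : CycleSystem n) (R : Rotations n) k (x₀ : Fin (CycleSystem.M cs)) (t : Permutation′ n) →
    (∀ i j → CycleSystem.b cs x₀ (t ⟨$⟩ʳ i) (t ⟨$⟩ʳ j) ≡ Rotations.consecutive R i j) →
    9 ≤ n → 1 ≤ k → k ≤ ⌊ n /2⌋ → Certificate cs k x₀
  certificate {suc (suc (suc (suc n′)))} cs R k x₀ t tour 9≤n =
    tour-certificate cs R k x₀ t tour 9≤n
  certificate {suc zero}             cs R k x₀ t tour (s≤s ())
  certificate {suc (suc zero)}       cs R k x₀ t tour (s≤s (s≤s ()))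
  certificate {suc (suc (suc zero))} cs R k x₀ t tour (s≤s (s≤s (s≤s ())))

  -- The cyclic successor on positions.

  toℕ-next : ∀ {n} (i : Fin n) → suc (toℕ i) < n → toℕ (next i) ≡ suc (toℕ i)
  toℕ-next {suc n} i h = trans (Fin.toℕ-fromℕ< (m%n<n (suc (toℕ i)) (suc n))) (m<n⇒m%n≡m h)

  toℕ-next-last : ∀ {n} (i : Fin n) → suc (toℕ i) ≡ n → toℕ (next i) ≡ 0
  toℕ-next-last {suc n} i h = trans (Fin.toℕ-fromℕ< (m%n<n (suc (toℕ i)) (suc n)))
    (trans (cong (_% suc n) h) (n%n≡0 (suc n)))

  module NextCycle (n′ : ℕ) where
    n : ℕ
    n = 4 + n′

    steps : ℕ → Fin n → Fin n
    steps k i = fold i next k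

    toℕ-steps-zero : ∀ k → k < n → toℕ (steps k zero) ≡ k
    toℕ-steps-zero zero    _ = refl
    toℕ-steps-zero (suc k) h = trans (toℕ-next (steps k zero) (subst (λ z → suc z < n) (sym IH) h)) (cong suc IH)
      where
      IH : toℕ (steps k zero) ≡ k
      IH = toℕ-steps-zero k (<-trans (n<1+n k) h)

    from-zero : ∀ (i : Fin n) → steps (toℕ i) zero ≡ i
    from-zero i = Fin.toℕ-injective (toℕ-steps-zero (toℕ i) (Fin.toℕ<n i))

    steps-comm : ∀ j k i → steps j (steps k i) ≡ steps k (steps j i)
    steps-comm j k i = trans (sym (fold-+ i next j)) (trans (cong (fold i next) (+-comm j k)) (fold-+ i next k))

    -- Every `i` is an iterate of `zero` and iterates commute, so it is enough to follow the orbit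
    -- of `zero`.
    steps-n : ∀ i → steps n i ≡ i
    steps-n i = begin
      steps n i  ≡⟨ cong (steps n) (from-zero i) ⟨
      steps n (steps (toℕ i) zero)  ≡⟨ steps-comm n (toℕ i) zero ⟩
      steps (toℕ i) (steps n zero)
        ≡⟨ cong (steps (toℕ i)) (Fin.toℕ-injective (toℕ-next-last _ (cong suc (toℕ-steps-zero _ (n<1+n _))))) ⟩
      steps (toℕ i) zero  ≡⟨ from-zero i ⟩
      i  ∎
      where open ≡-Reasoning

    next-perm : Permutation′ n
    -- One step is undone by n - 1 = 3 + n′ further steps.
    next-perm = Perm.permutation next (steps (3 + n′)) steps-n
      λ i → trans (steps-comm (3 + n′) 1 i) (steps-n i)

    power : ℕ → Permutation′ n
    power zero    = Perm.id
    power (suc k) = power k ∘ₚ next-perm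

    power-steps : ∀ k i → power k ⟨$⟩ʳ i ≡ steps k i
    power-steps zero    i = refl
    power-steps (suc k) i = cong next (power-steps k i)

    next² : ∀ v → next (next v) ≢ v
    next² v e with m≤n⇒m<n∨m≡n (Fin.toℕ<n v)
    ... | inj₂ last = contradiction
      (trans (sym (toℕ-next (next v) (subst (λ z → suc z < n) (sym z) (s≤s (s≤s z≤n))))) (cong toℕ e))
      λ e′ → contradiction (trans (cong suc (trans (cong suc (sym z)) e′)) last) λ ()
      where
      z : toℕ (next v) ≡ 0
      z = toℕ-next-last v last
    ... | inj₁ v+1<n with m≤n⇒m<n∨m≡n v+1<n
    ...   | inj₁ v+2<n = contradiction
      (trans (sym (trans (toℕ-next (next v) (subst (λ z → suc z < n) (sym z) v+2<n)) (cong suc z))) (cong toℕ e)) (m+1+n≢m′ (toℕ v))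
      where
      z : toℕ (next v) ≡ suc (toℕ v)
      z = toℕ-next v v+1<n
      m+1+n≢m′ : ∀ m → suc (suc m) ≢ m
      m+1+n≢m′ m e = <⇒≢ (<-trans (n<1+n m) (n<1+n (suc m))) (sym e)
    ...   | inj₂ last = contradiction
      (trans (cong (2 +_) (trans (sym (toℕ-next-last (next v) (trans (cong suc (toℕ-next v v+1<n)) last))) (cong toℕ e))) last) λ ()

    rotations : Rotations n
    rotations = record
      { nx = next
      ; nx-left = λ i → Fin.toℕ-injective (trans
          (toℕ-next (left i) (subst (_< n) (toℕ-right {n} i) (Fin.toℕ<n (right i)))) (sym (toℕ-right {n} i)))
      ; nx-nx = next²
      ; rot = λ ρ → power (toℕ ρ)
      ; rot-nx = λ ρ v → trans (power-steps (toℕ ρ) (next v)) (trans (steps-comm (toℕ ρ) 1 v) (cong next (sym (power-steps (toℕ ρ) v))))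
      ; rot-sum = λ v f → trans (sum-cong λ ρ → cong f (exchange ρ v)) (sym (sum-permute f (power (toℕ v))))
      }
      where
      -- Rotation is addition modulo n, hence symmetric in `ρ` and `v`. The sum over `ρ` thereby
      -- becomes a reindexing by one permutation.
      exchange : ∀ ρ v → power (toℕ ρ) ⟨$⟩ʳ v ≡ power (toℕ v) ⟨$⟩ʳ ρ
      exchange ρ v = trans (power-steps (toℕ ρ) v) (trans
        (trans (cong (steps (toℕ ρ)) (sym (from-zero v))) (trans (steps-comm (toℕ ρ) (toℕ v) zero) (cong (steps (toℕ v)) (from-zero ρ))))
        (sym (power-steps (toℕ v) ρ)))

  -- The points of X as a cycle system.

  injective⇒permutation : ∀ {n} (f : Fin n → Fin n) → Injective _≡_ _≡_ f → ∃ λ (π : Permutation′ n) → ∀ i → π ⟨$⟩ʳ i ≡ f i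
  injective⇒permutation {n} f inj =
    Perm.permutation f (proj₁ ∘ pre) (proj₂ ∘ pre) (λ i → inj (proj₂ (pre (f i)))) , λ _ → refl
    where
    pre′ : ∀ {n} (f : Fin n → Fin n) → Injective _≡_ _≡_ f → ∀ j → ∃ λ i → f i ≡ j
    pre′ {suc n} f inj j with Fin.any? (λ i → f i Fin.≟ j)
    ... | yes found = found
    -- A missed value could be removed from the codomain, which would leave an injection into a
    -- smaller set.
    ... | no  ¬found = contradiction
      (Fin.injective⇒≤ {f = λ i → Fin.punchOut (λ e → ¬found (i , sym e))}
        (λ e → inj (Fin.punchOut-injective {i = j} _ _ e))) 1+n≰n
    pre : ∀ j → ∃ λ i → f i ≡ j
    pre = pre′ f inj

  lookup-injective : ∀ {A : Set} {xs : List A} → UniqueL xs → ∀ i j → List.lookup xs i ≡ List.lookup xs j → i ≡ j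
  lookup-injective (_ ∷ _)  zero    zero    _ = refl
  lookup-injective (x∉ ∷ _) zero    (suc j) e = contradiction e (All.lookup x∉ (∈-lookup j))
  lookup-injective (x∉ ∷ _) (suc i) zero    e = contradiction (sym e) (All.lookup x∉ (∈-lookup i))
  lookup-injective (_ ∷ u)  (suc i) (suc j) e = cong suc (lookup-injective u i j e)

  ⟦⟧-injective : ∀ {a b} → ⟦ a ⟧ ≡ ⟦ b ⟧ → a ≡ b
  ⟦⟧-injective {true}  {true}  _ = refl
  ⟦⟧-injective {false} {false} _ = refl

  -- The form 4 + n′ is confined to this place; what follows works with a variable `n` and these
  -- facts about `next`.
  next-facts : ∀ n → 4 ≤ n → ∃ λ (R : Rotations n) → ∃ λ (σ : Permutation′ n) →
    (∀ v → Rotations.nx R v ≡ next v) × (∀ v → σ ⟨$⟩ʳ v ≡ next v)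
  next-facts (suc (suc (suc (suc n′)))) (s≤s (s≤s (s≤s (s≤s _)))) =
    NextCycle.rotations n′ , NextCycle.next-perm n′ , (λ _ → refl) , (λ _ → refl)

  module Tours (n : ℕ) (R : Rotations n) (next-perm : Permutation′ n)
    (nx≡next : ∀ v → Rotations.nx R v ≡ next v) (next-perm≡next : ∀ v → next-perm ⟨$⟩ʳ v ≡ next v) where
    open Rotations R using (δ-sym)

    next² : ∀ v → next (next v) ≢ v
    next² v e = Rotations.nx-nx R v (trans (nx≡next _) (trans (cong next (nx≡next v)) e))

    nx-irrefl : ∀ v → next v ≢ v
    nx-irrefl v e = next² v (trans (cong next e) e)

    consecutive : Fin n → Fin n → ℕ
    consecutive i j = δ (next i) j + δ (next j) i

    edge-index : ∀ {u v : Fin n} → u ≢ v → ∃ λ e → edge n e Joins u , v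
    edge-index {u} {v} u≢v with Fin.<-cmp u v
    ... | tri< u<v _ _ = Any.index p , inj₁ (sym (Any.lookup-index p))
      where
      p : (u , v) ∈ edges n
      p = ∈-filter⁺ (uncurry Fin._<?_) (∈-cartesianProduct⁺ (∈-allFin u) (∈-allFin v)) u<v
    ... | tri≈ _ u≡v _ = contradiction u≡v u≢v
    ... | tri> _ _ v<u = Any.index p , inj₂ (sym (Any.lookup-index p))
      where
      p : (v , u) ∈ edges n
      p = ∈-filter⁺ (uncurry Fin._<?_) (∈-cartesianProduct⁺ (∈-allFin v) (∈-allFin u)) v<u

    edge-≢ : ∀ e → proj₁ (edge n e) ≢ proj₂ (edge n e)
    edge-≢ e eq = Fin.<⇒≢ (proj₂ (∈-filter⁻ (uncurry Fin._<?_) {xs = cartesianProduct (allFin n) (allFin n)} (∈-lookup e))) eq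

    tour-perm : (t : Vec (Fin n) n) → Unique t → ∃ λ (π : Permutation′ n) → ∀ i → π ⟨$⟩ʳ i ≡ Vec.lookup t i
    tour-perm t u = injective⇒permutation (Vec.lookup t) (λ {i} {j} → UniqueVec.lookup-injective u i j)

    opaque

      -- Recovers one of the orderings that deduplication has identified; being opaque, the choice
      -- is never inspected.
      tour-exists : ∀ x → ∃ λ t → Unique t × List.lookup (X n) x ≡ incidence {n} t
      tour-exists x = from-map
        (∈-map⁻ incidence {xs = tours n} (∈-deduplicate⁻ (Vec.≡-dec Bool._≟_) (List.map incidence (tours n)) (∈-lookup x)))
        where
        from-map : ∀ {s} → (∃ λ t → t ∈ tours n × s ≡ incidence {n} t) → ∃ λ t → Unique t × s ≡ incidence {n} t
        from-map (t , t∈ , e) = t , proj₂ (∈-filter⁻ unique? {xs = words (allFin n) n} t∈) , e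

    π : Fin (∣X∣ n) → Permutation′ n
    π x = proj₁ (tour-perm _ (proj₁ (proj₂ (tour-exists x))))

    -- The adjacency matrix of the closed walk σ₀ σ₁ … σₙ₋₁ σ₀.
    adjacency : Permutation′ n → Fin n → Fin n → ℕ
    adjacency σ u v = consecutive (σ ⟨$⟩ˡ u) (σ ⟨$⟩ˡ v)

    adjacency-sym : ∀ σ u v → adjacency σ u v ≡ adjacency σ v u
    adjacency-sym σ u v = +-comm (δ (next (σ ⟨$⟩ˡ u)) (σ ⟨$⟩ˡ v)) _

    adjacency-irrefl : ∀ σ u → adjacency σ u u ≡ 0
    adjacency-irrefl σ u = cong₂ _+_ (δ-≢ (nx-irrefl _)) (δ-≢ (nx-irrefl _))

    δ-yes : ∀ {u v : Fin n} → u ≡ v → δ u v ≡ 1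
    δ-yes {u} refl = δ-refl u

    -- A walk without repeated vertices can traverse an edge only from the position of one of its
    -- ends, so these two positions decide the search over all of them.
    bits : ∀ (t : Vec (Fin n) n) (σ : Permutation′ n) → (∀ i → σ ⟨$⟩ʳ i ≡ Vec.lookup t i) →
      ∀ e → ⟦ Vec.lookup (incidence t) e ⟧ ≡ adjacency σ (proj₁ (edge n e)) (proj₂ (edge n e))
    bits t σ σt e = trans (cong ⟦_⟧ (Vec.lookup∘tabulate _ e)) (value (next i Fin.≟ j) (next j Fin.≟ i))
      where
      u v i j : Fin n
      u = proj₁ (edge n e)
      v = proj₂ (edge n e)
      i = σ ⟨$⟩ˡ u
      j = σ ⟨$⟩ˡ v
      Step : Set
      Step = ∃ λ l → edge n e Joins Vec.lookup t l , Vec.lookup t (next l)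
      step? : Dec Step
      step? = Fin.any? λ l → joins? (edge n e) (Vec.lookup t l) (Vec.lookup t (next l))
      preimage : ∀ {w l} → w ≡ Vec.lookup t l → σ ⟨$⟩ˡ w ≡ l
      preimage {l = l} p = trans (cong (σ ⟨$⟩ˡ_) (trans p (sym (σt l)))) (Perm.inverseˡ σ)
      forward : Step → next i ≡ j ⊎ next j ≡ i
      forward (l , inj₁ p) = inj₁ (trans (cong next (preimage (,-injectiveˡ p))) (sym (preimage (,-injectiveʳ p))))
      forward (l , inj₂ p) = inj₂ (trans (cong next (preimage (,-injectiveʳ p))) (sym (preimage (,-injectiveˡ p))))
      image : ∀ {w l} → σ ⟨$⟩ˡ w ≡ l → w ≡ Vec.lookup t l
      image {l = l} p = trans (sym (Perm.inverseʳ σ)) (trans (cong (σ ⟨$⟩ʳ_) p) (σt l))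
      value : Dec (next i ≡ j) → Dec (next j ≡ i) → ⟦ does step? ⟧ ≡ consecutive i j
      value (yes p) b = trans (cong ⟦_⟧ (dec-true step? (i , inj₁ (cong₂ _,_ (image refl) (image (sym p))))))
        (sym (cong₂ _+_ (δ-yes p) (δ-≢ (λ q → next² i (trans (cong next p) q)))))
      value (no p) (yes q) = trans (cong ⟦_⟧ (dec-true step? (j , inj₂ (cong₂ _,_ (image (sym q)) (image refl)))))
        (sym (cong₂ _+_ (δ-≢ p) (δ-yes q)))
      value (no p) (no q) = trans (cong ⟦_⟧ (dec-false step? λ s → case′ (forward s)))
        (sym (cong₂ _+_ (δ-≢ p) (δ-≢ q)))
        where
        case′ : ¬ (next i ≡ j ⊎ next j ≡ i)
        case′ (inj₁ h) = p h
        case′ (inj₂ h) = q h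

    b : Fin (∣X∣ n) → Fin n → Fin n → ℕ
    b x = adjacency (π x)

    b-edge : ∀ x e → ⟦ Vec.lookup (List.lookup (X n) x) e ⟧ ≡ b x (proj₁ (edge n e)) (proj₂ (edge n e))
    b-edge x e = trans (cong (λ s → ⟦ Vec.lookup s e ⟧) (proj₂ (proj₂ (tour-exists x))))
      (bits (proj₁ (tour-exists x)) (π x) (proj₂ (tour-perm _ (proj₁ (proj₂ (tour-exists x))))) e)

    joins-adjacency : ∀ σ {u v} e → edge n e Joins u , v → adjacency σ (proj₁ (edge n e)) (proj₂ (edge n e)) ≡ adjacency σ u v
    joins-adjacency σ e (inj₁ p) = cong (λ d → adjacency σ (proj₁ d) (proj₂ d)) p
    joins-adjacency σ {u} {v} e (inj₂ p) = trans (cong (λ d → adjacency σ (proj₁ d) (proj₂ d)) p) (adjacency-sym σ v u)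

    b-joins : ∀ x {u v} e → edge n e Joins u , v → ⟦ Vec.lookup (List.lookup (X n) x) e ⟧ ≡ b x u v
    b-joins x e p = trans (b-edge x e) (joins-adjacency (π x) e p)

    ∈-words : ∀ {m} (f : Fin m → Fin n) → Vec.tabulate f ∈ words (allFin n) m
    ∈-words {zero}  f = here refl
    ∈-words {suc m} f = ∈-cartesianProductWith⁺ _∷_ (∈-allFin (f zero)) (∈-words (f ∘ suc))

    perm-injective : ∀ (σ : Permutation′ n) {i j} → σ ⟨$⟩ʳ i ≡ σ ⟨$⟩ʳ j → i ≡ j
    perm-injective σ e = trans (sym (Perm.inverseˡ σ)) (trans (cong (σ ⟨$⟩ˡ_) e) (Perm.inverseˡ σ))

    opaque

      position-exists : ∀ (σ : Permutation′ n) → ∃ λ x → List.lookup (X n) x ≡ incidence {n} (Vec.tabulate (σ ⟨$⟩ʳ_))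
      position-exists σ = Any.index cycle∈X , sym (Any.lookup-index cycle∈X)
        where
        cycle∈X : incidence {n} (Vec.tabulate (σ ⟨$⟩ʳ_)) ∈ X n
        cycle∈X = ∈-deduplicate⁺ (Vec.≡-dec Bool._≟_) (∈-map⁺ incidence
          (∈-filter⁺ unique? (∈-words (σ ⟨$⟩ʳ_)) (UniqueVec.tabulate⁺ (perm-injective σ))))

    position : Permutation′ n → Fin (∣X∣ n)
    position σ = proj₁ (position-exists σ)

    -- `π (position σ)` may be another ordering of the same cycle; the matrices agree because both
    -- are read off from one incidence vector.
    b-position : ∀ σ u v → b (position σ) u v ≡ adjacency σ u v
    b-position σ u v = by-cases (u Fin.≟ v)
      where
      by-cases : Dec (u ≡ v) → b (position σ) u v ≡ adjacency σ u v
      by-cases (yes u≡v) = subst (λ v → b (position σ) u v ≡ adjacency σ u v) u≡v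
        (trans (adjacency-irrefl (π (position σ)) u) (sym (adjacency-irrefl σ u)))
      by-cases (no u≢v) = at (edge-index u≢v)
        where
        at : (∃ λ e → edge n e Joins u , v) → b (position σ) u v ≡ adjacency σ u v
        at (e , p) = trans (sym (b-joins (position σ) e p)) (trans
          (cong (λ s → ⟦ Vec.lookup s e ⟧) (proj₂ (position-exists σ)))
          (trans (bits (Vec.tabulate (σ ⟨$⟩ʳ_)) σ (λ i → sym (Vec.lookup∘tabulate (σ ⟨$⟩ʳ_) i)) e) (joins-adjacency σ e p)))

    bits-determine : ∀ (s s′ : Subset (N n)) → (∀ e → Vec.lookup s e ≡ Vec.lookup s′ e) → s ≡ s′
    bits-determine s s′ h = trans (sym (Vec.tabulate∘lookup s)) (trans (Vec.tabulate-cong h) (Vec.tabulate∘lookup s′))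

    -- Points of X are positions in a list without repetitions. This turns equations between
    -- matrices into equations between points and so makes `act` invertible, although orderings are
    -- not preserved.
    b-determines : ∀ x y → (∀ u v → b x u v ≡ b y u v) → x ≡ y
    b-determines x y h = lookup-injective
      (UniqueList.deduplicate-! (Vec.≡-dec Bool._≟_) (List.map incidence (tours n))) x y
      (bits-determine (List.lookup (X n) x) (List.lookup (X n) y) λ e →
        ⟦⟧-injective (trans (b-edge x e) (trans (h _ _) (sym (b-edge y e)))))

    moved : Permutation′ n → Fin (∣X∣ n) → Fin (∣X∣ n)
    moved σ x = position (π x ∘ₚ σ)

    b-moved : ∀ σ x u v → b (moved σ x) u v ≡ b x (σ ⟨$⟩ˡ u) (σ ⟨$⟩ˡ v)
    b-moved σ x u v = b-position (π x ∘ₚ σ) u v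

    act : Permutation′ n → Permutation′ (∣X∣ n)
    act σ = Perm.permutation (moved σ) (moved (Perm.flip σ))
      (λ x → b-determines _ x λ u v → trans (b-moved σ _ u v) (trans (b-moved (Perm.flip σ) x _ _)
        (cong₂ (b x) (Perm.inverseʳ σ) (Perm.inverseʳ σ))))
      (λ x → b-determines _ x λ u v → trans (b-moved (Perm.flip σ) _ u v) (trans (b-moved σ x _ _)
        (cong₂ (b x) (Perm.inverseˡ σ) (Perm.inverseˡ σ))))

    -- One neighbour is the successor, the other the predecessor; the latter is counted by
    -- reindexing along `next-perm`.
    adjacency-degree : ∀ σ u → sum (adjacency σ u) ≡ 2
    adjacency-degree σ u = begin
      sum (λ v → consecutive i (σ ⟨$⟩ˡ v))  ≡⟨ sum-permute (consecutive i) (Perm.flip σ) ⟨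
      sum (consecutive i)  ≡⟨ sum-+ (δ (next i)) (λ j → δ (next j) i) ⟩
      sum (δ (next i)) + sum (λ j → δ (next j) i)  ≡⟨ cong₂ _+_ (δ-total (next i)) (trans
        (trans (sum-cong λ j → cong (λ z → δ z i) (sym (next-perm≡next j))) (sym (sum-permute (λ j → δ j i) next-perm))) (trans (sum-cong (λ j → δ-sym j i)) (δ-total i))) ⟩
      2  ∎
      where
      open ≡-Reasoning
      i : Fin n
      i = σ ⟨$⟩ˡ u
      δ-total : ∀ i → sum (δ i) ≡ 1
      δ-total i = trans (sum-cong (λ j → sym (*-identityʳ (δ i j)))) (sum-δ i (λ _ → 1))

    adjacency-bool : ∀ σ u v → Boolean (adjacency σ u v)
    adjacency-bool σ u v = value (next i Fin.≟ j) (next j Fin.≟ i)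
      where
      i j : Fin n
      i = σ ⟨$⟩ˡ u
      j = σ ⟨$⟩ˡ v
      value : Dec (next i ≡ j) → Dec (next j ≡ i) → Boolean (consecutive i j)
      value (yes p) _ = inj₂ (cong₂ _+_ (δ-yes p) (δ-≢ (λ q → next² i (trans (cong next p) q))))
      value (no p) (yes q) = inj₂ (cong₂ _+_ (δ-≢ p) (δ-yes q))
      value (no p) (no q)  = inj₁ (cong₂ _+_ (δ-≢ p) (δ-≢ q))

    cycles : CycleSystem n
    cycles = record
      { M = ∣X∣ n
      ; b = b
      ; b-bool = λ x → adjacency-bool (π x)
      ; b-sym = λ x → adjacency-sym (π x)
      ; b-irrefl = λ x → adjacency-irrefl (π x)
      ; b-degree = λ x → adjacency-degree (π x)
      ; act = act
      ; b-act = λ σ x u v → trans (b-moved σ x _ _) (cong₂ (b x) (Perm.inverseˡ σ) (Perm.inverseˡ σ))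
      }

    b-tour : ∀ x i j → b x (π x ⟨$⟩ʳ i) (π x ⟨$⟩ʳ j) ≡ Rotations.consecutive R i j
    b-tour x i j = trans (cong₂ consecutive (Perm.inverseˡ (π x)) (Perm.inverseˡ (π x)))
      (sym (cong₂ (λ p q → δ p j + δ q i) (nx≡next i) (nx≡next j)))

  -- Sums over the list of edges.

  sumList : ∀ {A : Set} → (A → ℕ) → List A → ℕ
  sumList h []       = 0
  sumList h (a ∷ as) = h a + sumList h as

  sum-lookup : ∀ {A : Set} (h : A → ℕ) as → sum (λ i → h (List.lookup as i)) ≡ sumList h as
  sum-lookup h []       = sum-zero _
  sum-lookup h (a ∷ as) = trans (sum-suc _) (cong (h a +_) (sum-lookup h as))

  sumList-++ : ∀ {A : Set} (h : A → ℕ) as bs → sumList h (as ++ bs) ≡ sumList h as + sumList h bs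
  sumList-++ h []       bs = refl
  sumList-++ h (a ∷ as) bs = trans (cong (h a +_) (sumList-++ h as bs)) (sym (+-assoc (h a) _ _))

  sumList-map : ∀ {A B : Set} (h : B → ℕ) (f : A → B) as → sumList h (List.map f as) ≡ sumList (h ∘ f) as
  sumList-map h f []       = refl
  sumList-map h f (a ∷ as) = cong (h (f a) +_) (sumList-map h f as)

  sumList-cong : ∀ {A : Set} {h h′ : A → ℕ} → (∀ a → h a ≡ h′ a) → ∀ as → sumList h as ≡ sumList h′ as
  sumList-cong e []       = refl
  sumList-cong e (a ∷ as) = cong₂ _+_ (e a) (sumList-cong e as)

  sumList-filter : ∀ {A : Set} {P : A → Set} (P? : ∀ a → Dec (P a)) (h : A → ℕ) as →
    sumList h (filter P? as) ≡ sumList (λ a → ⟦ does (P? a) ⟧ * h a) as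
  sumList-filter P? h [] = refl
  sumList-filter P? h (a ∷ as) with does (P? a)
  ... | true  = cong₂ _+_ (sym (+-identityʳ (h a))) (sumList-filter P? h as)
  ... | false = sumList-filter P? h as

  sumList-product : ∀ {A B : Set} (h : A × B → ℕ) as bs →
    sumList h (cartesianProduct as bs) ≡ sumList (λ a → sumList (λ b → h (a , b)) bs) as
  sumList-product h []       bs = refl
  sumList-product h (a ∷ as) bs = trans (sumList-++ h (List.map (a ,_) bs) _)
    (cong₂ _+_ (sumList-map h (a ,_) bs) (sumList-product h as bs))

  sumList-tabulate : ∀ {A : Set} {n} (h : A → ℕ) (f : Fin n → A) → sumList h (List.tabulate f) ≡ sum (h ∘ f)
  sumList-tabulate {n = zero}  h f = sym (sum-zero _)
  sumList-tabulate {n = suc n} h f = trans (cong (h (f zero) +_) (sumList-tabulate h (f ∘ suc))) (sym (sum-suc _))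

  sum-edges : ∀ n (h : Fin n → Fin n → ℕ) →
    sum (λ e → uncurry h (edge n e)) ≡ sum (λ u → sum λ v → ⟦ does (u Fin.<? v) ⟧ * h u v)
  sum-edges n h = begin
    sum (λ e → uncurry h (edge n e))
      ≡⟨ sum-lookup (uncurry h) (edges n) ⟩
    sumList (uncurry h) (edges n)
      ≡⟨ sumList-filter (uncurry Fin._<?_) (uncurry h) (cartesianProduct (allFin n) (allFin n)) ⟩
    sumList (λ p → ⟦ does (uncurry Fin._<?_ p) ⟧ * uncurry h p) (cartesianProduct (allFin n) (allFin n))
      ≡⟨ sumList-product _ (allFin n) (allFin n) ⟩
    sumList (λ u → sumList (λ v → ⟦ does (u Fin.<? v) ⟧ * h u v) (allFin n)) (allFin n)
      ≡⟨ sumList-cong (λ u → sumList-tabulate _ id) (allFin n) ⟩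
    sumList (λ u → sum λ v → ⟦ does (u Fin.<? v) ⟧ * h u v) (allFin n)
      ≡⟨ sumList-tabulate _ id ⟩
    sum (λ u → sum λ v → ⟦ does (u Fin.<? v) ⟧ * h u v) ∎
    where open ≡-Reasoning

  -- Expresses the degree at `w` through edge coordinates, so that the constant function 1 can be
  -- shown to be linear on X. Each edge at `w` is listed in exactly one of its two orientations.
  incident-sum : ∀ n (h : Fin n → Fin n → ℕ) → (∀ u v → h u v ≡ h v u) → (∀ u → h u u ≡ 0) → ∀ w →
    sum (λ e → (δ w (proj₁ (edge n e)) + δ w (proj₂ (edge n e))) * h (proj₁ (edge n e)) (proj₂ (edge n e))) ≡ sum (h w)
  incident-sum n h h-sym h-irrefl w = begin
    sum (λ e → (δ w (proj₁ (edge n e)) + δ w (proj₂ (edge n e))) * h (proj₁ (edge n e)) (proj₂ (edge n e)))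
      ≡⟨ sum-edges n (λ u v → (δ w u + δ w v) * h u v) ⟩
    sum (λ u → sum λ v → lt u v * ((δ w u + δ w v) * h u v))
      ≡⟨ (sum-cong λ u → trans (sum-cong λ v → expand (lt u v) (δ w u) (δ w v) (h u v)) (sum-+ _ _)) ⟩
    sum (λ u → sum (λ v → δ w u * (lt u v * h u v)) + sum (λ v → δ w v * (lt u v * h u v)))
      ≡⟨ sum-+ _ _ ⟩
    sum (λ u → sum (λ v → δ w u * (lt u v * h u v))) + sum (λ u → sum (λ v → δ w v * (lt u v * h u v)))
      ≡⟨ cong₂ _+_ (trans (sum-cong λ u → sum-*ˡ (δ w u) _) (sum-δ w (λ u → sum λ v → lt u v * h u v)))
           (sum-cong λ u → sum-δ w (λ v → lt u v * h u v)) ⟩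
    sum (λ v → lt w v * h w v) + sum (λ u → lt u w * h u w)
      ≡⟨ sum-+ _ _ ⟨
    sum (λ v → lt w v * h w v + lt v w * h v w)
      ≡⟨ sum-cong trichotomy ⟩
    sum (h w) ∎
    where
    open ≡-Reasoning
    lt : Fin n → Fin n → ℕ
    lt u v = ⟦ does (u Fin.<? v) ⟧
    expand : ∀ c p q a → c * ((p + q) * a) ≡ p * (c * a) + q * (c * a)
    expand = solve 4 (λ c p q a → c :* ((p :+ q) :* a) := p :* (c :* a) :+ q :* (c :* a)) refl
      where open +-*-Solver using (solve; _:+_; _:*_; _:=_)
    yes-lt : ∀ {u v} → u Fin.< v → lt u v ≡ 1
    yes-lt {u} {v} p = cong ⟦_⟧ (dec-true (u Fin.<? v) p)
    not-lt : ∀ {u v} → ¬ (u Fin.< v) → lt u v ≡ 0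
    not-lt {u} {v} p = cong ⟦_⟧ (dec-false (u Fin.<? v) p)
    trichotomy : ∀ v → lt w v * h w v + lt v w * h v w ≡ h w v
    trichotomy v with Fin.<-cmp w v
    ... | tri< p _ q = trans (cong₂ _+_ (cong (_* h w v) (yes-lt p)) (cong (_* h v w) (not-lt q)))
      (trans (+-identityʳ _) (+-identityʳ _))
    ... | tri≈ p e q = trans (cong₂ _+_ (cong (_* h w v) (not-lt p)) (cong (_* h v w) (not-lt q)))
      (sym (trans (cong (h w) (sym e)) (h-irrefl w)))
    ... | tri> p _ q = trans (cong₂ _+_ (cong (_* h w v) (not-lt p)) (cong (_* h v w) (yes-lt q)))
      (trans (+-identityʳ _) (h-sym v w))

-- The lower bound on f(x₀) over an ordered ring.

module OrderedRings where

  open import Algebra.Bundles using (CommutativeRing)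
  import Algebra.Properties.Group as GroupProperties
  import Algebra.Properties.Semiring.Mult as SemiringMult
  import Algebra.Properties.Semiring.Sum as SemiringSum
  import Algebra.Solver.Ring.NaturalCoefficients.Default as NaturalCoefficients
  open import Data.Bool.Base using (true; false)
  open import Data.Fin.Base using (Fin; zero; suc)
  open import Data.Fin.Permutation as Perm using (Permutation′; _⟨$⟩ʳ_; _⟨$⟩ˡ_)
  open import Data.Fin.Subset using (Subset) renaming (∣_∣ to size)
  open import Data.List.Base as List using ()
  open import Data.Nat.Base as ℕ using (ℕ; zero; suc; NonZero; ⌊_/2⌋)
  import Data.Nat.Properties as ℕ
  open import Data.Product.Base using (∃; _,_; proj₁; proj₂) renaming (_×_ to _∧_)
  open import Data.Sum.Base using (inj₁; inj₂)
  open import Data.Vec.Base using (Vec; []; _∷_)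
  open import Data.Vec.Bounded.Base as Vec≤ using (Vec≤)
  open import Level using (0ℓ)
  open import Relation.Binary.PropositionalEquality as ≡ using (_≡_; _≢_)
  open Combinatorics using (sum; sum-zero; sum-suc; left; right; left≢right; prod; prod-boolean; Boolean;
    CycleSystem; module CycleSystem; module Moments; Certificate; module Certificate)

  -- The laws of the real numbers on which the argument rests; abstracting them keeps Cauchy
  -- sequences out of the algebra below.
  record DivisibleOrderedRing : Set₁ where
    field
      commutativeRing : CommutativeRing 0ℓ 0ℓ
    open CommutativeRing commutativeRing public
    open SemiringMult semiring public using (_×_; ×-homo-+; ×1-homo-*)

    infix 9 ↑_
    ↑_ : ℕ → Carrier
    ↑ a = a × 1#

    field
      Nonneg      : Carrier → Set
      nonneg-resp : ∀ {x y} → x ≈ y → Nonneg x → Nonneg y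
      nonneg-+    : ∀ {x y} → Nonneg x → Nonneg y → Nonneg (x + y)
      nonneg-0    : Nonneg 0#
      nonneg-1    : Nonneg 1#
      1/          : ∀ a .{{_ : NonZero a}} → Carrier
      1/-inverse  : ∀ a .{{_ : NonZero a}} → ↑ a * 1/ a ≈ 1#
      nonneg-1/   : ∀ a .{{_ : NonZero a}} {x} → Nonneg x → Nonneg (x * 1/ a)

  module LowerBound (R : DivisibleOrderedRing) where
    open DivisibleOrderedRing R hiding (zero)
    open SemiringSum semiring using () renaming (sum to ∑; sum-cong-≋ to ∑-cong; ∑-distrib-+ to ∑-+; ∑-comm to ∑-swap;
      *-distribˡ-sum to ∑-*ˡ; *-distribʳ-sum to ∑-*ʳ)
    open GroupProperties +-group using () renaming (∙-cancelʳ to +-cancelʳ)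
    open NaturalCoefficients commutativeSemiring using (solve; _:+_; _:*_; _:=_)
    open import Relation.Binary.Reasoning.Setoid setoid

    ↑-+ : ∀ a b → ↑ (a ℕ.+ b) ≈ ↑ a + ↑ b
    ↑-+ a b = ×-homo-+ 1# a b

    ↑-* : ∀ a b → ↑ (a ℕ.* b) ≈ ↑ a * ↑ b
    ↑-* a b = ×1-homo-* a b

    ↑-1 : ↑ 1 ≈ 1#
    ↑-1 = +-identityʳ 1#

    nonneg-↑ : ∀ a → Nonneg (↑ a)
    nonneg-↑ zero    = nonneg-0
    nonneg-↑ (suc a) = nonneg-+ nonneg-1 (nonneg-↑ a)

    nonneg-↑* : ∀ a {x} → Nonneg x → Nonneg (↑ a * x)
    nonneg-↑* zero    {x} _ = nonneg-resp (sym (zeroˡ x)) nonneg-0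
    nonneg-↑* (suc a) {x} h = nonneg-resp
      (sym (trans (distribʳ x 1# (↑ a)) (+-congʳ (*-identityˡ x)))) (nonneg-+ h (nonneg-↑* a h))

    ↑-sum : ∀ {m} (f : Fin m → ℕ) → ↑ (sum f) ≈ ∑ (λ i → ↑ (f i))
    ↑-sum {zero}  f = reflexive (≡.cong ↑_ (sum-zero f))
    ↑-sum {suc m} f = trans (reflexive (≡.cong ↑_ (sum-suc f)))
      (trans (↑-+ (f zero) _) (+-congˡ (↑-sum (λ i → f (suc i)))))

    ↑-cancel : ∀ a .{{_ : NonZero a}} {x y} → ↑ a * x ≈ ↑ a * y → x ≈ y
    ↑-cancel a {x} {y} h = trans (insert x) (trans (*-congʳ h) (sym (insert y)))
      where
      insert : ∀ z → z ≈ (↑ a * z) * 1/ a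
      insert z = begin
        z  ≈⟨ *-identityʳ z ⟨
        z * 1#  ≈⟨ *-congˡ (1/-inverse a) ⟨
        z * (↑ a * 1/ a)  ≈⟨ solve 3 (λ z a r → z :* (a :* r) := (a :* z) :* r) refl z (↑ a) (1/ a) ⟩
        (↑ a * z) * 1/ a  ∎

    nonneg-cancel : ∀ a .{{_ : NonZero a}} {x} → Nonneg (↑ a * x) → Nonneg x
    nonneg-cancel a {x} h = nonneg-resp
      (trans (solve 3 (λ x a r → (a :* x) :* r := x :* (a :* r)) refl x (↑ a) (1/ a))
        (trans (*-congˡ (1/-inverse a)) (*-identityʳ x)))
      (nonneg-1/ a h)

    module _ {n : ℕ} (cs : CycleSystem n) (k : ℕ) .{{_ : NonZero n}} .{{_ : NonZero k}}
      (x₀ : Fin (CycleSystem.M cs)) (cert : Certificate cs k x₀)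
      {E : ℕ} (src tgt : Fin E → Fin n) (src≢tgt : ∀ e → src e ≢ tgt e)
      (c : Fin E → Carrier) (f : Fin (CycleSystem.M cs) → Carrier)
      (f-linear : ∀ x → f x ≈ ∑ (λ e → c e * ↑ CycleSystem.b cs x (src e) (tgt e)))
      (f-average : ∑ f ≈ ↑ CycleSystem.M cs)
      (f-squares : ∀ (σ : Permutation′ n) (s : Subset ⌊ n /2⌋) → size s ≡ k →
        Nonneg (∑ λ x → ↑ prod s (λ i → CycleSystem.b cs x (σ ⟨$⟩ʳ left i) (σ ⟨$⟩ʳ right i)) * f x)) where
      open CycleSystem cs
      open Moments cs using (moment)
      open Certificate cert

      -- Since `f` is linear, a weighted sum of `f` depends on the weight only through its moments.
      weighted : ∀ g → ∑ (λ x → ↑ g x * f x) ≈ ∑ (λ e → c e * ↑ moment g (src e) (tgt e))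
      weighted g = begin
        ∑ (λ x → ↑ g x * f x)
          ≈⟨ ∑-cong (λ x → trans (*-congˡ (f-linear x)) (∑-*ˡ (↑ g x) (λ e → c e * ↑ b x (src e) (tgt e)))) ⟩
        ∑ (λ x → ∑ λ e → ↑ g x * (c e * ↑ b x (src e) (tgt e)))
          ≈⟨ ∑-swap (λ x e → ↑ g x * (c e * ↑ b x (src e) (tgt e))) ⟩
        ∑ (λ e → ∑ λ x → ↑ g x * (c e * ↑ b x (src e) (tgt e)))
          ≈⟨ ∑-cong (λ e → trans
               (∑-cong λ x → trans (solve 3 (λ g c b → g :* (c :* b)
                    := c :* (g :* b)) refl (↑ g x) (c e) (↑ b x (src e) (tgt e)))
                 (*-congˡ (sym (↑-* (g x) (b x (src e) (tgt e))))))
               (trans (sym (∑-*ˡ (c e) (λ x → ↑ (g x ℕ.* b x (src e) (tgt e)))))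
                (*-congˡ (sym (↑-sum (λ x → g x ℕ.* b x (src e) (tgt e))))))) ⟩
        ∑ (λ e → c e * ↑ moment g (src e) (tgt e)) ∎

      Y γ F : Carrier
      Y = ∑ (λ x → ↑ w x * f x)
      γ = ∑ c
      F = f x₀

      Y-nonneg : Nonneg Y
      Y-nonneg = w-squares (λ g → Nonneg (∑ λ x → ↑ g x * f x))
        (nonneg-resp (sym (trans (∑-cong λ x → zeroˡ (f x)) (∑-zero M))) nonneg-0)
        (λ {g} {h} p q → nonneg-resp (sym (trans
          (∑-cong λ x → trans (*-congʳ (↑-+ (g x) (h x))) (distribʳ (f x) _ _))
          (∑-+ (λ x → ↑ g x * f x) (λ x → ↑ h x * f x)))) (nonneg-+ p q))
        (λ e → nonneg-resp (∑-cong λ x → *-congʳ (reflexive (≡.cong ↑_ (e x)))))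
        f-squares
        where
        ∑-zero : ∀ m → ∑ {m} (λ _ → 0#) ≈ 0#
        ∑-zero zero    = refl
        ∑-zero (suc m) = trans (+-identityˡ _) (∑-zero m)

      scaled : ∀ a → ∑ (λ e → c e * ↑ a) ≈ ↑ a * γ
      scaled a = trans (sym (∑-*ʳ (↑ a) c)) (*-comm γ (↑ a))

      multiple : ∀ a → ∑ (λ e → c e * (↑ a * ↑ b x₀ (src e) (tgt e))) ≈ ↑ a * F
      multiple a = trans
        (∑-cong λ e → solve 3 (λ c a b → c :* (a :* b) := a :* (c :* b)) refl (c e) (↑ a) (↑ b x₀ (src e) (tgt e)))
        (trans (sym (∑-*ˡ (↑ a) (λ e → c e * ↑ b x₀ (src e) (tgt e)))) (*-congˡ (sym (f-linear x₀))))

      -- The equation `values`, multiplied by the coefficients of `f` and summed over the edges: the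
      -- coordinates of `x₀` produce `F`, the constants produce `γ`.
      values-sum : Y + (↑ A′ * F + ↑ β′ * γ) ≈ ↑ β * γ + ↑ A * F
      values-sum = begin
        Y + (↑ A′ * F + ↑ β′ * γ)
          ≈⟨ +-cong (weighted w) (+-cong (sym (multiple A′)) (sym (scaled β′))) ⟩
        ∑ (λ e → c e * ↑ m e) + (∑ (λ e → c e * (↑ A′ * ↑ b₀ e)) + ∑ (λ e → c e * ↑ β′))
          ≈⟨ trans (∑-+ (λ e → c e * ↑ m e) (λ e → c e * (↑ A′ * ↑ b₀ e) + c e * ↑ β′))
               (+-congˡ (∑-+ (λ e → c e * (↑ A′ * ↑ b₀ e)) (λ e → c e * ↑ β′))) ⟨
        ∑ (λ e → c e * ↑ m e + (c e * (↑ A′ * ↑ b₀ e) + c e * ↑ β′))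
          ≈⟨ ∑-cong (λ e → entry e) ⟩
        ∑ (λ e → c e * ↑ β + c e * (↑ A * ↑ b₀ e))
          ≈⟨ ∑-+ (λ e → c e * ↑ β) (λ e → c e * (↑ A * ↑ b₀ e)) ⟩
        ∑ (λ e → c e * ↑ β) + ∑ (λ e → c e * (↑ A * ↑ b₀ e))
          ≈⟨ +-cong (scaled β) (multiple A) ⟩
        ↑ β * γ + ↑ A * F ∎
        where
        m b₀ : Fin E → ℕ
        m e = moment w (src e) (tgt e)
        b₀ e = b x₀ (src e) (tgt e)
        entry : ∀ e → c e * ↑ m e + (c e * (↑ A′ * ↑ b₀ e) + c e * ↑ β′) ≈ c e * ↑ β + c e * (↑ A * ↑ b₀ e)
        entry e = begin
          c e * ↑ m e + (c e * (↑ A′ * ↑ b₀ e) + c e * ↑ β′)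
            ≈⟨ solve 4 (λ c m p q → c :* m :+ (c :* p :+ c :* q)
                 := c :* (m :+ (p :+ q))) refl (c e) (↑ m e) (↑ A′ * ↑ b₀ e) (↑ β′) ⟩
          c e * (↑ m e + (↑ A′ * ↑ b₀ e + ↑ β′))
            ≈⟨ *-congˡ (trans (↑-+ (m e) _) (+-congˡ (trans (↑-+ (A′ ℕ.* b₀ e) β′) (+-congʳ (↑-* A′ (b₀ e)))))) ⟨
          c e * ↑ (m e ℕ.+ (A′ ℕ.* b₀ e ℕ.+ β′))
            ≈⟨ *-congˡ (reflexive (≡.cong ↑_ (values (src e) (tgt e) (src≢tgt e)))) ⟩
          c e * ↑ (β ℕ.+ A ℕ.* b₀ e)
            ≈⟨ *-congˡ (trans (↑-+ β _) (+-congˡ (↑-* A (b₀ e)))) ⟩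
          c e * (↑ β + ↑ A * ↑ b₀ e)
            ≈⟨ distribˡ (c e) _ _ ⟩
          c e * ↑ β + c e * (↑ A * ↑ b₀ e) ∎

      M≈Tγ : ↑ M ≈ ↑ T * γ
      M≈Tγ = begin
        ↑ M  ≈⟨ f-average ⟨
        ∑ f  ≈⟨ ∑-cong (λ x → trans (*-congʳ ↑-1) (*-identityˡ (f x))) ⟨
        ∑ (λ x → ↑ 1 * f x)  ≈⟨ weighted (λ _ → 1) ⟩
        ∑ (λ e → c e * ↑ moment (λ _ → 1) (src e) (tgt e))
                                         ≈⟨ ∑-cong (λ e → *-congˡ (reflexive (≡.cong ↑_ (count (src e) (tgt e) (src≢tgt e))))) ⟩
        ∑ (λ e → c e * ↑ T)  ≈⟨ scaled T ⟩
        ↑ T * γ  ∎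

      -- γ is eliminated by 2|X|γ + |X| = n|X|.
      2Mγ : ↑ (2 ℕ.* M) * γ + ↑ M ≈ ↑ n * ↑ M
      2Mγ = begin
        ↑ (2 ℕ.* M) * γ + ↑ M  ≈⟨ +-congˡ M≈Tγ ⟩
        ↑ (2 ℕ.* M) * γ + ↑ T * γ  ≈⟨ trans (*-congʳ (↑-+ (2 ℕ.* M) T)) (distribʳ γ _ _) ⟨
        ↑ (2 ℕ.* M ℕ.+ T) * γ  ≈⟨ *-congʳ (reflexive (≡.cong ↑_ count-total)) ⟩
        ↑ (n ℕ.* T) * γ  ≈⟨ *-congʳ (↑-* n T) ⟩
        ↑ n * ↑ T * γ  ≈⟨ *-assoc (↑ n) (↑ T) γ ⟩
        ↑ n * (↑ T * γ)  ≈⟨ *-congˡ M≈Tγ ⟨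
        ↑ n * ↑ M  ∎

      instance
        2M-nonZero : NonZero (2 ℕ.* M)
        2M-nonZero = ℕ.>-nonZero (ℕ.≤-trans (positive x₀) (ℕ.m≤m+n M _))
          where
          positive : ∀ {m} → Fin m → 1 ℕ.≤ m
          positive {suc m} _ = ℕ.s≤s ℕ.z≤n

      double : ∀ a → ↑ (2 ℕ.* a) ≈ ↑ a + ↑ a
      double a = trans (↑-+ a _) (+-congˡ (reflexive (≡.cong ↑_ (ℕ.+-identityʳ a))))

      values-total↑ : ↑ (n ℕ.* W) + ↑ (n ℕ.* W) + (↑ A′ + ↑ A′) + ↑ n * ↑ β′ + ↑ β ≈ ↑ n * ↑ β + (↑ A + ↑ A) + ↑ β′
      values-total↑ = begin
        ↑ (n ℕ.* W) + ↑ (n ℕ.* W) + (↑ A′ + ↑ A′) + ↑ n * ↑ β′ + ↑ β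
          ≈⟨ +-congʳ (+-cong (+-cong (double (n ℕ.* W)) (double A′)) (↑-* n β′)) ⟨
        ↑ (2 ℕ.* (n ℕ.* W)) + ↑ (2 ℕ.* A′) + ↑ (n ℕ.* β′) + ↑ β
          ≈⟨ trans (↑-+ (2 ℕ.* (n ℕ.* W) ℕ.+ 2 ℕ.* A′ ℕ.+ n ℕ.* β′) β) (+-congʳ (trans (↑-+ (2 ℕ.* (n ℕ.* W) ℕ.+ 2 ℕ.* A′) (n ℕ.* β′)) (+-congʳ (↑-+ (2 ℕ.* (n ℕ.* W)) (2 ℕ.* A′))))) ⟨
        ↑ (2 ℕ.* (n ℕ.* W) ℕ.+ 2 ℕ.* A′ ℕ.+ n ℕ.* β′ ℕ.+ β)
          ≈⟨ reflexive (≡.cong ↑_ values-total) ⟩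
        ↑ (n ℕ.* β ℕ.+ 2 ℕ.* A ℕ.+ β′)
          ≈⟨ trans (↑-+ (n ℕ.* β ℕ.+ 2 ℕ.* A) β′) (+-congʳ (↑-+ (n ℕ.* β) (2 ℕ.* A))) ⟩
        ↑ (n ℕ.* β) + ↑ (2 ℕ.* A) + ↑ β′
          ≈⟨ +-congʳ (+-cong (↑-* n β) (double A)) ⟩
        ↑ n * ↑ β + (↑ A + ↑ A) + ↑ β′ ∎

      -- The subtraction-free form of Y = n W + (A - A′)(F - 1). After multiplication by 2|X|, `2Mγ`
      -- removes γ, and `values-total↑` lets β and β′ cancel.
      balance : Y + ↑ A′ * F + ↑ A ≈ ↑ (n ℕ.* W) + ↑ A′ + ↑ A * F
      balance = ↑-cancel (2 ℕ.* M) (+-cancelʳ (↑ M * (↑ n * ↑ β′ + ↑ β)) _ _ (begin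
        ↑ (2 ℕ.* M) * (Y + a′ * F + a) + ↑ M * (↑ n * ↑ β′ + ↑ β)
          ≈⟨ +-congʳ (*-congʳ (double M)) ⟩
        (↑ M + ↑ M) * (Y + a′ * F + a) + ↑ M * (↑ n * ↑ β′ + ↑ β)
          ≈⟨ solve 8 (λ M Y a′ F a n p q → (M :+ M) :* (Y :+ a′ :* F :+ a) :+ M :* (n :* p :+ q)
               := (M :+ M) :* (Y :+ a′ :* F) :+ (n :* M) :* p :+ M :* (a :+ a) :+ M :* q)
                   refl (↑ M) Y a′ F a (↑ n) (↑ β′) (↑ β) ⟩
        (↑ M + ↑ M) * (Y + a′ * F) + (↑ n * ↑ M) * ↑ β′ + ↑ M * (a + a) + ↑ M * ↑ β
          ≈⟨ +-congʳ (+-congʳ (+-congˡ (*-congʳ (sym 2Mγ′)))) ⟩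
        (↑ M + ↑ M) * (Y + a′ * F) + ((↑ M + ↑ M) * γ + ↑ M) * ↑ β′ + ↑ M * (a + a) + ↑ M * ↑ β
          ≈⟨ solve 8 (λ M Y a′ F a γ p q → (M :+ M) :* (Y :+ a′ :* F) :+ ((M :+ M) :* γ :+ M) :* p :+ M :* (a :+ a) :+ M :* q
               := (M :+ M) :* (Y :+ (a′ :* F :+ p :* γ)) :+ (M :* p :+ M :* (a :+ a) :+ M :* q))
                   refl (↑ M) Y a′ F a γ (↑ β′) (↑ β) ⟩
        (↑ M + ↑ M) * (Y + (a′ * F + ↑ β′ * γ)) + (↑ M * ↑ β′ + ↑ M * (a + a) + ↑ M * ↑ β)
          ≈⟨ +-congʳ (*-congˡ values-sum) ⟩
        (↑ M + ↑ M) * (↑ β * γ + a * F) + (↑ M * ↑ β′ + ↑ M * (a + a) + ↑ M * ↑ β)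
          ≈⟨ solve 6 (λ M F a γ p q → (M :+ M) :* (q :* γ :+ a :* F) :+ (M :* p :+ M :* (a :+ a) :+ M :* q)
               := ((M :+ M) :* γ :+ M) :* q :+ (M :+ M) :* (a :* F) :+ M :* (p :+ (a :+ a)))
                   refl (↑ M) F a γ (↑ β′) (↑ β) ⟩
        ((↑ M + ↑ M) * γ + ↑ M) * ↑ β + (↑ M + ↑ M) * (a * F) + ↑ M * (↑ β′ + (a + a))
          ≈⟨ +-congʳ (+-congʳ (*-congʳ 2Mγ′)) ⟩
        (↑ n * ↑ M) * ↑ β + (↑ M + ↑ M) * (a * F) + ↑ M * (↑ β′ + (a + a))
          ≈⟨ solve 6 (λ M F a n p q → (n :* M) :* q :+ (M :+ M) :* (a :* F) :+ M :* (p :+ (a :+ a))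
               := M :* (n :* q :+ (a :+ a) :+ p) :+ (M :+ M) :* (a :* F)) refl (↑ M) F a (↑ n) (↑ β′) (↑ β) ⟩
        ↑ M * (↑ n * ↑ β + (a + a) + ↑ β′) + (↑ M + ↑ M) * (a * F)
          ≈⟨ +-congʳ (*-congˡ values-total↑) ⟨
        ↑ M * (ω + ω + (a′ + a′) + ↑ n * ↑ β′ + ↑ β) + (↑ M + ↑ M) * (a * F)
          ≈⟨ solve 8 (λ M F a a′ n p q ω → M :* (ω :+ ω :+ (a′ :+ a′) :+ n :* p :+ q) :+ (M :+ M) :* (a :* F)
               := (M :+ M) :* (ω :+ a′ :+ a :* F) :+ M :* (n :* p :+ q)) refl (↑ M) F a a′ (↑ n) (↑ β′) (↑ β) ω ⟩
        (↑ M + ↑ M) * (ω + a′ + a * F) + ↑ M * (↑ n * ↑ β′ + ↑ β)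
          ≈⟨ +-congʳ (*-congʳ (double M)) ⟨
        ↑ (2 ℕ.* M) * (ω + a′ + a * F) + ↑ M * (↑ n * ↑ β′ + ↑ β) ∎))
        where
        a a′ ω : Carrier
        a = ↑ A
        a′ = ↑ A′
        ω = ↑ (n ℕ.* W)
        2Mγ′ : (↑ M + ↑ M) * γ + ↑ M ≈ ↑ n * ↑ M
        2Mγ′ = trans (+-congʳ (*-congʳ (sym (double M)))) 2Mγ

      -- G times the element in question equals `k * n` times Y plus `S`, the slack in the estimate.
      -- Here d is f(x₀) - 1, so the result says that f(x₀) - 1 is at least -(n/k + 10/n).
      lower-bound : ∀ d → F ≈ d + 1# → Nonneg (↑ (k ℕ.* n) * d + ↑ (n ℕ.* n ℕ.+ 10 ℕ.* k))
      lower-bound d F≈ = nonneg-cancel G (nonneg-resp (sym G-multiple)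
        (nonneg-+ (nonneg-↑* (k ℕ.* n) Y-nonneg) (nonneg-↑ S)))
        where
        B : ℕ
        B = n ℕ.* n ℕ.+ 10 ℕ.* k
        1≤n*n*k : 1 ℕ.≤ k ℕ.* (n ℕ.* n)
        1≤n*n*k = ℕ.>-nonZero⁻¹ _ {{ℕ.m*n≢0 k (n ℕ.* n)}}
          where
          instance
            n*n-nonZero : NonZero (n ℕ.* n)
            n*n-nonZero = ℕ.m*n≢0 n n
        instance
          B-nonZero : NonZero B
          B-nonZero = ℕ.>-nonZero (ℕ.≤-trans (ℕ.>-nonZero⁻¹ _ {{ℕ.m*n≢0 n n}}) (ℕ.m≤m+n (n ℕ.* n) _))
        A′≤A : A′ ℕ.≤ A
        A′≤A = ℕ.*-cancelˡ-≤ B (ℕ.≤-trans (ℕ.m≤n+m _ _) estimate)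
        G : ℕ
        G = A ℕ.∸ A′
        A≡ : A ≡ G ℕ.+ A′
        A≡ = ≡.sym (ℕ.m∸n+n≡m A′≤A)
        estimate′ : k ℕ.* (n ℕ.* n) ℕ.* W ℕ.≤ B ℕ.* G
        estimate′ = ℕ.+-cancelʳ-≤ (B ℕ.* A′) _ _ (ℕ.≤-trans estimate
          (ℕ.≤-reflexive (≡.trans (≡.cong (B ℕ.*_) A≡) (ℕ.*-distribˡ-+ B G A′))))
        instance
          -- The estimate bounds B G below by k n² W, which is positive.
          G-nonZero : NonZero G
          G-nonZero = ℕ.m*n≢0⇒n≢0 B {{ℕ.>-nonZero (ℕ.≤-trans (ℕ.*-mono-≤ 1≤n*n*k W-positive) estimate′)}}
        S : ℕ
        S = B ℕ.* G ℕ.∸ k ℕ.* (n ℕ.* n) ℕ.* W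
        Y≈ : Y ≈ ↑ (n ℕ.* W) + ↑ G * d
        Y≈ = +-cancelʳ (↑ A′ * F + ↑ A) _ _ (begin
          Y + (↑ A′ * F + ↑ A)  ≈⟨ +-assoc Y _ _ ⟨
          Y + ↑ A′ * F + ↑ A  ≈⟨ balance ⟩
          ↑ (n ℕ.* W) + ↑ A′ + ↑ A * F  ≈⟨ +-congˡ (*-cong A≈ F≈) ⟩
          ↑ (n ℕ.* W) + ↑ A′ + (↑ G + ↑ A′) * (d + 1#)  ≈⟨ solve 5 (λ ω a′ g d o → ω :+ a′ :+ (g :+ a′) :* (d :+ o)
                                                               := ω :+ g :* d :+ (a′ :* (d :+ o) :+ (g :* o :+ a′)))
                                                                   refl (↑ (n ℕ.* W)) (↑ A′) (↑ G) d 1# ⟩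
          ↑ (n ℕ.* W) + ↑ G * d + (↑ A′ * (d + 1#) + (↑ G * 1# + ↑ A′))
                                                          ≈⟨ +-congˡ (+-cong (*-congˡ F≈) (trans A≈ (+-congʳ (sym (*-identityʳ (↑ G)))))) ⟨
          ↑ (n ℕ.* W) + ↑ G * d + (↑ A′ * F + ↑ A)  ∎)
          where
          A≈ : ↑ A ≈ ↑ G + ↑ A′
          A≈ = trans (reflexive (≡.cong ↑_ A≡)) (↑-+ G A′)
        BG≈ : ↑ B * ↑ G ≈ ↑ (k ℕ.* n) * ↑ (n ℕ.* W) + ↑ S
        BG≈ = begin
          ↑ B * ↑ G  ≈⟨ ↑-* B G ⟨
          ↑ (B ℕ.* G)  ≈⟨ reflexive (≡.cong ↑_ (ℕ.m+[n∸m]≡n estimate′)) ⟨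
          ↑ (k ℕ.* (n ℕ.* n) ℕ.* W ℕ.+ S)  ≈⟨ ↑-+ (k ℕ.* (n ℕ.* n) ℕ.* W) S ⟩
          ↑ (k ℕ.* (n ℕ.* n) ℕ.* W) + ↑ S
            ≈⟨ +-congʳ (reflexive (≡.cong ↑_ (≡.trans (≡.cong (ℕ._* W) (≡.sym (ℕ.*-assoc k n n))) (ℕ.*-assoc (k ℕ.* n) n W)))) ⟩
          ↑ (k ℕ.* n ℕ.* (n ℕ.* W)) + ↑ S  ≈⟨ +-congʳ (↑-* (k ℕ.* n) (n ℕ.* W)) ⟩
          ↑ (k ℕ.* n) * ↑ (n ℕ.* W) + ↑ S  ∎
        G-multiple : ↑ G * (↑ (k ℕ.* n) * d + ↑ B) ≈ ↑ (k ℕ.* n) * Y + ↑ S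
        G-multiple = begin
          ↑ G * (↑ (k ℕ.* n) * d + ↑ B)
            ≈⟨ solve 4 (λ g κ d B → g :* (κ :* d :+ B) := κ :* (g :* d) :+ B :* g) refl (↑ G) (↑ (k ℕ.* n)) d (↑ B) ⟩
          ↑ (k ℕ.* n) * (↑ G * d) + ↑ B * ↑ G  ≈⟨ +-congˡ BG≈ ⟩
          ↑ (k ℕ.* n) * (↑ G * d) + (↑ (k ℕ.* n) * ↑ (n ℕ.* W) + ↑ S)
                                                    ≈⟨ solve 4 (λ κ gd ω s → κ :* gd :+ (κ :* ω :+ s)
                                                         := κ :* (ω :+ gd) :+ s)
                                                             refl (↑ (k ℕ.* n)) (↑ G * d) (↑ (n ℕ.* W)) (↑ S) ⟩
          ↑ (k ℕ.* n) * (↑ (n ℕ.* W) + ↑ G * d) + ↑ S  ≈⟨ +-congʳ (*-congˡ Y≈) ⟨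
          ↑ (k ℕ.* n) * Y + ↑ S  ∎

  -- The second inclusion over an ordered ring.

  chosen : ∀ {A : Set} {m} (s : Subset m) → (Fin m → A) → Vec A (size s)
  chosen []          e = []
  chosen (true  ∷ s) e = e zero ∷ chosen s (λ i → e (suc i))
  chosen (false ∷ s) e = chosen s (λ i → e (suc i))

  module Inclusion (R : DivisibleOrderedRing) where
    open DivisibleOrderedRing R hiding (zero)
    open LowerBound R
    open SemiringSum semiring using () renaming (sum to ∑; sum-cong-≋ to ∑-cong; ∑-distrib-+ to ∑-+; ∑-comm to ∑-swap;
      *-distribˡ-sum to ∑-*ˡ; *-distribʳ-sum to ∑-*ʳ)
    open NaturalCoefficients commutativeSemiring using (solve; _:+_; _:*_; _:=_)
    open import Relation.Binary.Reasoning.Setoid setoid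

    monomial : ∀ {E k} → (Fin E → Carrier) → Vec≤ (Fin E) k → Carrier
    monomial v m = List.foldr (λ i p → v i * p) 1# (Vec≤.toList m)

    monomial-chosen : ∀ {E m} (v : Fin E → Carrier) (s : Subset m) (e : Fin m → Fin E) (b : Fin m → ℕ) →
      (∀ i → v (e i) ≈ ↑ b i) → monomial v (Vec≤.fromVec (chosen s e)) ≈ ↑ prod s b
    monomial-chosen v []          e b h = sym ↑-1
    monomial-chosen v (true  ∷ s) e b h = trans
      (*-cong (h zero) (monomial-chosen v s (λ i → e (suc i)) (λ i → b (suc i)) (λ i → h (suc i))))
      (sym (↑-* (b zero) _))
    monomial-chosen v (false ∷ s) e b h = monomial-chosen v s (λ i → e (suc i)) (λ i → b (suc i)) (λ i → h (suc i))

    ∑-const : ∀ m x → ∑ {m} (λ _ → x) ≈ ↑ m * x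
    ∑-const zero    x = sym (zeroˡ x)
    ∑-const (suc m) x = trans (+-cong (sym (*-identityˡ x)) (∑-const m x)) (sym (distribʳ x 1# (↑ m)))

    nonneg-∑ : ∀ {m} {f : Fin m → Carrier} → (∀ i → Nonneg (f i)) → Nonneg (∑ f)
    nonneg-∑ {zero}  h = nonneg-0
    nonneg-∑ {suc m} h = nonneg-+ (h zero) (nonneg-∑ (λ i → h (suc i)))

    undo-1/ : ∀ M .{{_ : NonZero M}} x → ↑ M * (1/ M * x) ≈ x
    undo-1/ M x = trans (sym (*-assoc (↑ M) (1/ M) x)) (trans (*-congʳ (1/-inverse M)) (*-identityˡ x))

    module Shrink {n : ℕ} (cs : CycleSystem n) (k : ℕ) .{{_ : NonZero n}} .{{_ : NonZero k}}
      .{{X≢0 : NonZero (CycleSystem.M cs)}} (cert : ∀ x₀ → Certificate cs k x₀)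
      {E : ℕ} (src tgt : Fin E → Fin n) (src≢tgt : ∀ e → src e ≢ tgt e) (pt : Fin (CycleSystem.M cs) → Fin E → Carrier)
      (pt-value : ∀ x e → pt x e ≈ ↑ CycleSystem.b cs x (src e) (tgt e))
      (index : ∀ {u v} → u ≢ v → ∃ λ e → ∀ x → pt x e ≈ ↑ CycleSystem.b cs x u v)
      (one : ∃ λ (d : Fin E → Carrier) → ∀ x → 1# ≈ ∑ (λ e → d e * pt x e))
      (c : Fin E → Carrier) (f : Fin (CycleSystem.M cs) → Carrier) (f-linear : ∀ x → f x ≈ ∑ (λ e → c e * pt x e))
      (f-average : 1/ (CycleSystem.M cs) * ∑ f ≈ 1#)
      (h : Vec≤ (Fin E) k → Fin (CycleSystem.M cs) → Carrier) (h-monomial : ∀ m x → h m x ≈ monomial (pt x) m)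
      (f-squares : ∀ m → Nonneg (1/ (CycleSystem.M cs) * ∑ (λ x → f x * (h m x * h m x)))) where
      open CycleSystem cs

      f-total : ∑ f ≈ ↑ M
      f-total = begin
        ∑ f  ≈⟨ undo-1/ M (∑ f) ⟨
        ↑ M * (1/ M * ∑ f)  ≈⟨ *-congˡ f-average ⟩
        ↑ M * 1#  ≈⟨ *-identityʳ (↑ M) ⟩
        ↑ M  ∎

      -- The test function is the monomial of the chosen pairs moved by `σ`. Its values are 0 or 1,
      -- so squaring leaves it unchanged.
      f-products : ∀ (σ : Permutation′ n) (s : Subset ⌊ n /2⌋) → size s ≡ k →
        Nonneg (∑ λ x → ↑ prod s (λ i → b x (σ ⟨$⟩ʳ left i) (σ ⟨$⟩ʳ right i)) * f x)
      f-products σ s ≡.refl = nonneg-resp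
        (trans (undo-1/ M _) (∑-cong λ x → square x (prod-boolean s (λ i → b-bool x _ _))))
        (nonneg-↑* M (f-squares (Vec≤.fromVec (chosen s e))))
        where
        σ-≢ : ∀ i → σ ⟨$⟩ʳ left i ≢ σ ⟨$⟩ʳ right i
        σ-≢ i eq = left≢right i (≡.trans (≡.sym (Perm.inverseˡ σ)) (≡.trans (≡.cong (σ ⟨$⟩ˡ_) eq) (Perm.inverseˡ σ)))
        e : Fin ⌊ n /2⌋ → Fin E
        e i = proj₁ (index (σ-≢ i))
        p : Fin M → ℕ
        p x = prod s (λ i → b x (σ ⟨$⟩ʳ left i) (σ ⟨$⟩ʳ right i))
        hₛ : Fin M → Carrier
        hₛ = h (Vec≤.fromVec (chosen s e))
        h-value : ∀ x → hₛ x ≈ ↑ p x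
        h-value x = trans (h-monomial _ x) (monomial-chosen (pt x) s e _ (λ i → proj₂ (index (σ-≢ i)) x))
        idempotent : ∀ {a} → Boolean a → a ℕ.* a ≡ a
        idempotent (inj₁ ≡.refl) = ≡.refl
        idempotent (inj₂ ≡.refl) = ≡.refl
        square : ∀ x → Boolean (p x) → f x * (hₛ x * hₛ x) ≈ ↑ p x * f x
        square x px = begin
          f x * (hₛ x * hₛ x)  ≈⟨ *-congˡ (*-cong (h-value x) (h-value x)) ⟩
          f x * (↑ p x * ↑ p x)  ≈⟨ *-congˡ (trans (sym (↑-* (p x) (p x))) (reflexive (≡.cong ↑_ (idempotent px)))) ⟩
          f x * ↑ p x  ≈⟨ *-comm (f x) (↑ p x) ⟩
          ↑ p x * f x  ∎

      -- The solver works over commutative semirings, so -1 is an atom that is added instead of a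
      -- subtraction of 1.
      ν : Carrier
      ν = - 1#

      B : ℕ
      B = n ℕ.* n ℕ.+ 10 ℕ.* k

      instance
        B-nonZero : NonZero B
        B-nonZero = ℕ.>-nonZero (ℕ.≤-trans (ℕ.>-nonZero⁻¹ _ {{ℕ.m*n≢0 n n}}) (ℕ.m≤m+n (n ℕ.* n) _))

      f-bound : ∀ x₀ → Nonneg (↑ (k ℕ.* n) * (f x₀ + ν) + ↑ B)
      f-bound x₀ = lower-bound cs k x₀ (cert x₀) src tgt src≢tgt c f
        (λ x → trans (f-linear x) (∑-cong λ e → *-congˡ (pt-value x e))) f-total f-products (f x₀ + ν)
        (sym (trans (+-assoc _ _ _) (trans (+-congˡ (-‿inverseˡ 1#)) (+-identityʳ _))))

      -- This is 1/a. Hence f - 1 = a (f′ - 1) for the function `f′` below, and f ≥ 1 - a becomes f′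
      -- ≥ 0.
      ρ : Carrier
      ρ = ↑ (k ℕ.* n) * 1/ B

      f′ : Fin M → Carrier
      f′ x = 1# + ρ * (f x + ν)

      f′-linear : ∃ λ c′ → ∀ x → f′ x ≈ ∑ (λ e → c′ e * pt x e)
      f′-linear = (λ e → ρ * c e + (1# + ρ * ν) * d e) , λ x → begin
        1# + ρ * (f x + ν)
          ≈⟨ trans (+-congˡ (distribˡ ρ (f x) ν)) (trans (sym (+-assoc 1# _ _))
               (trans (+-congʳ (+-comm 1# (ρ * f x))) (+-assoc _ 1# _))) ⟩
        ρ * f x + (1# + ρ * ν)
          ≈⟨ +-cong (*-congˡ (f-linear x)) (trans (sym (*-identityʳ _)) (*-congˡ (d-one x))) ⟩
        ρ * ∑ (λ e → c e * pt x e) + (1# + ρ * ν) * ∑ (λ e → d e * pt x e)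
          ≈⟨ +-cong (∑-*ˡ ρ (λ e → c e * pt x e)) (∑-*ˡ (1# + ρ * ν) (λ e → d e * pt x e)) ⟩
        ∑ (λ e → ρ * (c e * pt x e)) + ∑ (λ e → (1# + ρ * ν) * (d e * pt x e))
          ≈⟨ ∑-+ (λ e → ρ * (c e * pt x e)) (λ e → (1# + ρ * ν) * (d e * pt x e)) ⟨
        ∑ (λ e → ρ * (c e * pt x e) + (1# + ρ * ν) * (d e * pt x e))
          ≈⟨ ∑-cong (λ e → solve 5 (λ r c s d p → r :* (c :* p) :+ s :* (d :* p) := (r :* c :+ s :* d) :* p)
               refl ρ (c e) (1# + ρ * ν) (d e) (pt x e)) ⟩
        ∑ (λ e → (ρ * c e + (1# + ρ * ν) * d e) * pt x e) ∎
        where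
        d : Fin E → Carrier
        d = proj₁ one
        d-one : ∀ x → 1# ≈ ∑ (λ e → d e * pt x e)
        d-one = proj₂ one

      f′-nonneg : ∀ x → Nonneg (f′ x)
      f′-nonneg x = nonneg-resp (begin
        (↑ (k ℕ.* n) * (f x + ν) + ↑ B) * 1/ B
          ≈⟨ solve 4 (λ κ d B r → (κ :* d :+ B) :* r
               := B :* r :+ (κ :* r) :* d) refl (↑ (k ℕ.* n)) (f x + ν) (↑ B) (1/ B) ⟩
        ↑ B * 1/ B + ρ * (f x + ν)
          ≈⟨ +-congʳ (1/-inverse B) ⟩
        f′ x ∎) (nonneg-1/ B (f-bound x))

      f′-average : 1/ M * ∑ f′ ≈ 1#
      f′-average = begin
        1/ M * ∑ f′  ≈⟨ *-congˡ total ⟩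
        1/ M * ↑ M  ≈⟨ trans (*-comm _ _) (1/-inverse M) ⟩
        1#  ∎
        where
        total : ∑ f′ ≈ ↑ M
        total = begin
          ∑ (λ x → 1# + ρ * (f x + ν))  ≈⟨ ∑-+ (λ _ → 1#) (λ x → ρ * (f x + ν)) ⟩
          ∑ {M} (λ _ → 1#) + ∑ (λ x → ρ * (f x + ν))
            ≈⟨ +-cong (trans (∑-const M 1#) (*-identityʳ _)) (sym (∑-*ˡ ρ (λ x → f x + ν))) ⟩
          ↑ M + ρ * ∑ (λ x → f x + ν)  ≈⟨ +-congˡ (*-congˡ (trans (∑-+ f (λ _ → ν)) (+-cong f-total (∑-const M ν)))) ⟩
          ↑ M + ρ * (↑ M + ↑ M * ν)
            ≈⟨ +-congˡ (*-congˡ (trans (+-congʳ (sym (*-identityʳ (↑ M)))) (sym (distribˡ (↑ M) 1# ν)))) ⟩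
          ↑ M + ρ * (↑ M * (1# + ν))
            ≈⟨ +-congˡ (trans (*-congˡ (trans (*-congˡ (-‿inverseʳ 1#)) (zeroʳ _))) (zeroʳ ρ)) ⟩
          ↑ M + 0#  ≈⟨ +-identityʳ _ ⟩
          ↑ M  ∎

      f′-scaled : ∀ a → ↑ (k ℕ.* n) * a ≈ ↑ B → ∀ x → f x + ν ≈ a * (f′ x + ν)
      f′-scaled a a-value x = sym (begin
        a * (1# + ρ * (f x + ν) + ν)
          ≈⟨ *-congˡ (trans (+-congʳ (+-comm 1# _)) (trans (+-assoc _ 1# ν) (trans (+-congˡ (-‿inverseʳ 1#)) (+-identityʳ _)))) ⟩
        a * (↑ (k ℕ.* n) * 1/ B * (f x + ν))
          ≈⟨ solve 4 (λ a κ r d → a :* (κ :* r :* d) := (κ :* a) :* r :* d) refl a (↑ (k ℕ.* n)) (1/ B) (f x + ν) ⟩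
        ↑ (k ℕ.* n) * a * 1/ B * (f x + ν)
          ≈⟨ *-congʳ (trans (*-congʳ a-value) (1/-inverse B)) ⟩
        1# * (f x + ν)
          ≈⟨ *-identityˡ _ ⟩
        f x + ν ∎)

      shrink : ∀ a → ↑ (k ℕ.* n) * a ≈ ↑ B → ∃ λ f′ →
        (∃ λ (c′ : Fin E → Carrier) → ∀ x → f′ x ≈ ∑ (λ e → c′ e * pt x e)) ∧ (∀ x → Nonneg (f′ x)) ∧
        1/ M * ∑ f′ ≈ 1# ∧ (∀ x → f x + - 1# ≈ a * (f′ x + - 1#))
      shrink a a-value = f′ , f′-linear , f′-nonneg , f′-average , f′-scaled a a-value

    module _ {n M E : ℕ} (inc : Fin n → Fin E → ℕ)
      (pt : Fin M → Fin E → Carrier) (bit : Fin M → Fin E → ℕ) (pt-value : ∀ x e → pt x e ≈ ↑ bit x e)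
      (v : Fin n) (degree : ∀ x → sum (λ e → inc v e ℕ.* bit x e) ≡ 2) where

      -- The constant 1 is half the degree at v.
      one-linear : ∃ λ (d : Fin E → Carrier) → ∀ x → 1# ≈ ∑ (λ e → d e * pt x e)
      one-linear = (λ e → 1/ 2 * ↑ inc v e) , λ x → sym (begin
        ∑ (λ e → 1/ 2 * ↑ inc v e * pt x e)
          ≈⟨ ∑-cong (λ e → trans (*-assoc _ _ _) (*-congˡ (trans (*-congˡ (pt-value x e)) (sym (↑-* (inc v e) (bit x e)))))) ⟩
        ∑ (λ e → 1/ 2 * ↑ (inc v e ℕ.* bit x e))
          ≈⟨ ∑-*ˡ (1/ 2) (λ e → ↑ (inc v e ℕ.* bit x e)) ⟨
        1/ 2 * ∑ (λ e → ↑ (inc v e ℕ.* bit x e))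
          ≈⟨ *-congˡ (trans (sym (↑-sum (λ e → inc v e ℕ.* bit x e))) (reflexive (≡.cong ↑_ (degree x)))) ⟩
        1/ 2 * ↑ 2
          ≈⟨ trans (*-comm _ _) (1/-inverse 2) ⟩
        1# ∎)

open import Defs
open import Data.Integer.Base using (+_)
open import Data.Nat.Base using (ℕ; NonZero; ⌊_/2⌋) renaming (_≤_ to _≤ᴺ_)
open import Data.Product.Base using (∃-syntax; _×_)
open import Data.Rational.Base using (_/_)
open import Relation.Unary using (_⊆_)

open import Algebra.Bundles using (CommutativeRing)
import Algebra.Definitions.RawMonoid as Sums
import Algebra.Properties.Semiring.Mult as SemiringMult
import Algebra.Properties.Semiring.Sum as SemiringSum
open import Algebra.Structures using (IsCommutativeRing)
open import Data.Bool.Base using (Bool; true; false; if_then_else_)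
open import Data.Fin.Base as Fin using (Fin)
import Data.Integer.Base as ℤ
import Data.Integer.Properties as ℤ
import Data.List.Base as List
open import Data.Nat.Base as ℕ using (zero; suc)
import Data.Nat.Properties as ℕ
open import Data.Product.Base using (∃; _,_; proj₁; proj₂)
open import Data.Rational.Base as ℚ using (ℚ; 0ℚ; 1ℚ; ½; Positive; positive; 1/_)
import Data.Rational.Properties as ℚ
open import Data.Rational.Solver using (module +-*-Solver)
import Data.Rational.Unnormalised.Base as ℚᵘ
import Data.Rational.Unnormalised.Properties as ℚᵘ
open import Data.Sum.Base using (_⊎_; inj₁; inj₂)
import Data.Vec.Base as Vec
open import Data.Vec.Bounded.Base using (Vec≤)
open import Level using (0ℓ)
open import Relation.Binary.PropositionalEquality
  using (_≡_; _≢_; refl; sym; trans; cong; cong₂; subst; subst₂)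
open import Relation.Unary using (_∈_)
open Combinatorics using (⟦_⟧; δ; sum; module CycleSystem; Certificate; certificate; next-facts; module Tours; incident-sum)
open OrderedRings using (DivisibleOrderedRing; module DivisibleOrderedRing; module LowerBound; module Inclusion)

-- The real numbers as an ordered ring.

0<½ : ∀ {ε} → 0ℚ ℚ.< ε → 0ℚ ℚ.< ½ ℚ.* ε
0<½ {ε} 0<ε = ℚ.positive⁻¹ _ {{ℚ.pos*pos⇒pos ½ ε {{positive 0<ε}}}}

½ε+½ε : ∀ ε → ½ ℚ.* ε ℚ.+ ½ ℚ.* ε ≡ ε
½ε+½ε ε = trans (sym (ℚ.*-distribʳ-+ ε ½ ½)) (ℚ.*-identityˡ ε)

∣∣-triangle : ∀ a b c → ℚ.∣ a ℚ.- c ∣ ℚ.≤ ℚ.∣ a ℚ.- b ∣ ℚ.+ ℚ.∣ b ℚ.- c ∣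
∣∣-triangle a b c = subst (λ z → ℚ.∣ z ∣ ℚ.≤ ℚ.∣ a ℚ.- b ∣ ℚ.+ ℚ.∣ b ℚ.- c ∣)
  (solve 3 (λ a b c → (a :- b) :+ (b :- c) := a :- c) refl a b c)
  (ℚ.∣p+q∣≤∣p∣+∣q∣ (a ℚ.- b) (b ℚ.- c))
  where open +-*-Solver

∣∣-sym : ∀ a b → ℚ.∣ a ℚ.- b ∣ ≡ ℚ.∣ b ℚ.- a ∣
∣∣-sym a b = trans (sym (ℚ.∣-p∣≡∣p∣ (a ℚ.- b)))
  (cong ℚ.∣_∣ (solve 2 (λ a b → :- (a :- b) := b :- a) refl a b))
  where open +-*-Solver

p≤∣p∣ : ∀ p → p ℚ.≤ ℚ.∣ p ∣
p≤∣p∣ p with ℚ.≤-total 0ℚ p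
... | inj₁ 0≤p = ℚ.≤-reflexive (sym (ℚ.0≤p⇒∣p∣≡p 0≤p))
... | inj₂ p≤0 = ℚ.≤-trans p≤0 (ℚ.0≤∣p∣ p)

both : ∀ {A B : ℕ → Set} → Eventually A → Eventually B → Eventually (λ m → A m × B m)
both (N , f) (M , g) = N ℕ.⊔ M , λ m ≤m →
  f m (ℕ.m⊔n≤o⇒m≤o N M ≤m) , g m (ℕ.m⊔n≤o⇒n≤o N M ≤m)

always : ∀ {A : ℕ → Set} → (∀ m → A m) → Eventually A
always f = 0 , λ m _ → f m

eventually-map : ∀ {A B : ℕ → Set} → (∀ m → A m → B m) → Eventually A → Eventually B
eventually-map f (N , g) = N , λ m ≤m → f m (g m ≤m)

pointwise : ∀ x y → (∀ m → seq x m ≡ seq y m) → x ≈ y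
pointwise x y e ε 0<ε = always λ m →
  subst (λ z → ℚ.∣ seq x m ℚ.- z ∣ ℚ.< ε) (e m)
    (subst (ℚ._< ε) (cong ℚ.∣_∣ (sym (ℚ.+-inverseʳ (seq x m)))) 0<ε)

≈-refl : ∀ {x} → x ≈ x
≈-refl {x} = pointwise x x λ _ → refl

≈-sym : ∀ {x y} → x ≈ y → y ≈ x
≈-sym {x} {y} e ε 0<ε =
  eventually-map (λ m → subst (ℚ._< ε) (∣∣-sym (seq x m) (seq y m))) (e ε 0<ε)

≈-trans : ∀ {x y z} → x ≈ y → y ≈ z → x ≈ z
≈-trans {x} {y} {z} e e′ ε 0<ε = eventually-map
  (λ m (p , q) → ℚ.<-respʳ-≡ (½ε+½ε ε)
    (ℚ.≤-<-trans (∣∣-triangle (seq x m) (seq y m) (seq z m)) (ℚ.+-mono-< p q)))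
  (both (e _ (0<½ 0<ε)) (e′ _ (0<½ 0<ε)))

+-cong : ∀ {x y u v} → x ≈ y → u ≈ v → x + u ≈ y + v
+-cong {x} {y} {u} {v} e e′ ε 0<ε = eventually-map
  (λ m (p , q) → ℚ.<-respʳ-≡ (½ε+½ε ε)
    (ℚ.≤-<-trans (close (seq x m) (seq y m) (seq u m) (seq v m)) (ℚ.+-mono-< p q)))
  (both (e _ (0<½ 0<ε)) (e′ _ (0<½ 0<ε)))
  where
  open +-*-Solver
  close : ∀ a b c d →
    ℚ.∣ (a ℚ.+ c) ℚ.- (b ℚ.+ d) ∣ ℚ.≤ ℚ.∣ a ℚ.- b ∣ ℚ.+ ℚ.∣ c ℚ.- d ∣
  close a b c d = subst (λ z → ℚ.∣ z ∣ ℚ.≤ ℚ.∣ a ℚ.- b ∣ ℚ.+ ℚ.∣ c ℚ.- d ∣)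
    (solve 4 (λ a b c d → (a :- b) :+ (c :- d) := (a :+ c) :- (b :+ d)) refl a b c d)
    (ℚ.∣p+q∣≤∣p∣+∣q∣ (a ℚ.- b) (c ℚ.- d))

-‿cong : ∀ {x y} → x ≈ y → - x ≈ - y
-‿cong {x} {y} e ε 0<ε = eventually-map
  (λ m → subst (ℚ._< ε) (eq (seq x m) (seq y m))) (e ε 0<ε)
  where
  open +-*-Solver
  eq : ∀ a b → ℚ.∣ a ℚ.- b ∣ ≡ ℚ.∣ ℚ.- a ℚ.- ℚ.- b ∣
  eq a b = trans (∣∣-sym a b)
    (cong ℚ.∣_∣ (solve 2 (λ a b → b :- a := :- a :- :- b) refl a b))

bounded : ∀ x → ∃ λ B → Positive B × Eventually λ m → ℚ.∣ seq x m ∣ ℚ.≤ B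
bounded (mkℝ x cx) = bound (cx 1ℚ (ℚ.positive⁻¹ 1ℚ))
  where
  open +-*-Solver
  split : ∀ a b → ℚ.∣ a ∣ ℚ.≤ ℚ.∣ a ℚ.- b ∣ ℚ.+ ℚ.∣ b ∣
  split a b = subst (λ z → ℚ.∣ z ∣ ℚ.≤ ℚ.∣ a ℚ.- b ∣ ℚ.+ ℚ.∣ b ∣)
    (solve 2 (λ a b → (a :- b) :+ b := a) refl a b) (ℚ.∣p+q∣≤∣p∣+∣q∣ (a ℚ.- b) b)
  bound : (∃ λ N → ∀ m n → N ℕ.≤ m → N ℕ.≤ n → ℚ.∣ x m ℚ.- x n ∣ ℚ.< 1ℚ) →
    ∃ λ B → Positive B × Eventually λ m → ℚ.∣ x m ∣ ℚ.≤ B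
  bound (N , h) = 1ℚ ℚ.+ ℚ.∣ x N ∣
    , positive (ℚ.+-mono-<-≤ (ℚ.positive⁻¹ 1ℚ) (ℚ.0≤∣p∣ (x N)))
    , N , λ m N≤m → ℚ.≤-trans (split (x m) (x N))
        (ℚ.+-monoˡ-≤ ℚ.∣ x N ∣ (ℚ.<⇒≤ (h m N N≤m ℕ.≤-refl)))

rescale : ∀ B ε → Positive B → 0ℚ ℚ.< ε → ∃ λ δ → 0ℚ ℚ.< δ × B ℚ.* δ ≡ ε
rescale B ε B>0 0<ε =
  1/B ℚ.* ε
  , ℚ.positive⁻¹ _ {{ℚ.pos*pos⇒pos 1/B {{ℚ.1/pos⇒pos B {{B>0}}}} ε {{positive 0<ε}}}}
  , trans (sym (ℚ.*-assoc B 1/B ε))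
      (trans (cong (ℚ._* ε) (ℚ.*-inverseʳ B {{ℚ.pos⇒nonZero B {{B>0}}}})) (ℚ.*-identityˡ ε))
  where
  1/B : ℚ
  1/B = (1/ B) {{ℚ.pos⇒nonZero B {{B>0}}}}

-- The sequence of `x` is eventually bounded by some B, so `y` and `z` have to be compared with
-- accuracy ε/B.
*-congˡ : ∀ {x y z} → y ≈ z → x * y ≈ x * z
*-congˡ {x} {y} {z} e ε 0<ε = from (bounded x)
  where
  open +-*-Solver
  Goal : Set
  Goal = Eventually λ m → ℚ.∣ seq x m ℚ.* seq y m ℚ.- seq x m ℚ.* seq z m ∣ ℚ.< ε
  factor : ∀ a b c → ℚ.∣ a ∣ ℚ.* ℚ.∣ b ℚ.- c ∣ ≡ ℚ.∣ a ℚ.* b ℚ.- a ℚ.* c ∣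
  factor a b c = trans (sym (ℚ.∣p*q∣≡∣p∣*∣q∣ a (b ℚ.- c)))
    (cong ℚ.∣_∣ (solve 3 (λ a b c → a :* (b :- c) := a :* b :- a :* c) refl a b c))
  choose : ∀ {B} → Positive B → Eventually (λ m → ℚ.∣ seq x m ∣ ℚ.≤ B) →
    (∃ λ δ → 0ℚ ℚ.< δ × B ℚ.* δ ≡ ε) → Goal
  choose {B} B>0 x≤B (δ , 0<δ , Bδ) = eventually-map
    (λ m (p , q) → subst₂ ℚ._<_ (factor (seq x m) (seq y m) (seq z m)) Bδ
      (ℚ.≤-<-trans
        (ℚ.*-monoʳ-≤-nonNeg _ {{ℚ.nonNegative (ℚ.0≤∣p∣ (seq y m ℚ.- seq z m))}} p)
        (ℚ.*-monoʳ-<-pos B {{B>0}} q)))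
    (both x≤B (e δ 0<δ))
  from : (∃ λ B → Positive B × Eventually λ m → ℚ.∣ seq x m ∣ ℚ.≤ B) → Goal
  from (B , B>0 , x≤B) = choose B>0 x≤B (rescale B ε B>0 0<ε)

*-comm : ∀ x y → x * y ≈ y * x
*-comm x y = pointwise (x * y) (y * x) λ m → ℚ.*-comm (seq x m) (seq y m)

*-cong : ∀ {x y u v} → x ≈ y → u ≈ v → x * u ≈ y * v
*-cong {x} {y} {u} {v} e e′ = ≈-trans {x * u} {x * v} {y * v} (*-congˡ {x} {u} {v} e′)
  (≈-trans {x * v} {v * x} {y * v} (*-comm x v)
    (≈-trans {v * x} {v * y} {y * v} (*-congˡ {v} {x} {y} e) (*-comm v y)))

+-*-isCommutativeRing : IsCommutativeRing _≈_ _+_ _*_ -_ 0ℝ 1ℝ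
+-*-isCommutativeRing = record
  { isRing = record
    { +-isAbelianGroup = record
      { isGroup = record
        { isMonoid = record
          { isSemigroup = record
            { isMagma = record
              { isEquivalence = record
                  { refl = λ {x} → ≈-refl {x} ; sym = λ {x} {y} → ≈-sym {x} {y}
                  ; trans = λ {x} {y} {z} → ≈-trans {x} {y} {z} }
              ; ∙-cong = λ {x} {y} {u} {v} → +-cong {x} {y} {u} {v} }
            ; assoc = λ x y z → pointwise ((x + y) + z) (x + (y + z)) λ m →
                ℚ.+-assoc (seq x m) (seq y m) (seq z m) }
          ; identity = (λ x → pointwise (0ℝ + x) x λ m → ℚ.+-identityˡ (seq x m))
                     , (λ x → pointwise (x + 0ℝ) x λ m → ℚ.+-identityʳ (seq x m)) }
        ; inverse = (λ x → pointwise (- x + x) 0ℝ λ m → ℚ.+-inverseˡ (seq x m))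
                  , (λ x → pointwise (x + - x) 0ℝ λ m → ℚ.+-inverseʳ (seq x m))
        ; ⁻¹-cong = λ {x} {y} → -‿cong {x} {y} }
      ; comm = λ x y → pointwise (x + y) (y + x) λ m → ℚ.+-comm (seq x m) (seq y m) }
    ; *-cong = λ {x} {y} {u} {v} → *-cong {x} {y} {u} {v}
    ; *-assoc = λ x y z → pointwise ((x * y) * z) (x * (y * z)) λ m →
        ℚ.*-assoc (seq x m) (seq y m) (seq z m)
    ; *-identity = (λ x → pointwise (1ℝ * x) x λ m → ℚ.*-identityˡ (seq x m))
                 , (λ x → pointwise (x * 1ℝ) x λ m → ℚ.*-identityʳ (seq x m))
    ; distrib = (λ x y z → pointwise (x * (y + z)) (x * y + x * z) λ m →
                  ℚ.*-distribˡ-+ (seq x m) (seq y m) (seq z m))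
              , (λ x y z → pointwise ((y + z) * x) (y * x + z * x) λ m →
                  ℚ.*-distribʳ-+ (seq x m) (seq y m) (seq z m)) }
  ; *-comm = *-comm }

≤-resp-≈ : ∀ {x y} → x ≈ y → 0ℝ ≤ x → 0ℝ ≤ y
≤-resp-≈ {x} {y} e 0≤x ε 0<ε = eventually-map
  (λ m (p , q) → shift (seq x m) (seq y m) p q)
  (both (0≤x _ (0<½ 0<ε)) (e _ (0<½ 0<ε)))
  where
  open +-*-Solver
  shift : ∀ a b → 0ℚ ℚ.< a ℚ.+ ½ ℚ.* ε → ℚ.∣ a ℚ.- b ∣ ℚ.< ½ ℚ.* ε → 0ℚ ℚ.< b ℚ.+ ε
  shift a b p q = ℚ.<-≤-trans p (ℚ.≤-trans
    (ℚ.+-monoˡ-≤ (½ ℚ.* ε) a≤b+½ε)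
    (ℚ.≤-reflexive (trans (ℚ.+-assoc b _ _) (cong (b ℚ.+_) (½ε+½ε ε)))))
    where
    a≤b+½ε : a ℚ.≤ b ℚ.+ ½ ℚ.* ε
    a≤b+½ε = subst (ℚ._≤ b ℚ.+ ½ ℚ.* ε)
      (solve 2 (λ a b → b :+ (a :- b) := a) refl a b)
      (ℚ.+-monoʳ-≤ b (ℚ.≤-trans (p≤∣p∣ (a ℚ.- b)) (ℚ.<⇒≤ q)))

0≤-pointwise : ∀ {x} → (∀ m → 0ℚ ℚ.≤ seq x m) → 0ℝ ≤ x
0≤-pointwise h ε 0<ε = always λ m → ℚ.+-mono-≤-< (h m) 0<ε

0≤-+ : ∀ {x y} → 0ℝ ≤ x → 0ℝ ≤ y → 0ℝ ≤ x + y
0≤-+ {x} {y} 0≤x 0≤y ε 0<ε = eventually-map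
  (λ m (p , q) → ℚ.<-respʳ-≡ (regroup (seq x m) (seq y m)) (ℚ.+-mono-< p q))
  (both (0≤x _ (0<½ 0<ε)) (0≤y _ (0<½ 0<ε)))
  where
  open +-*-Solver
  regroup : ∀ a b → (a ℚ.+ ½ ℚ.* ε) ℚ.+ (b ℚ.+ ½ ℚ.* ε) ≡ (a ℚ.+ b) ℚ.+ ε
  regroup a b = trans
    (solve 3 (λ a b c → (a :+ c) :+ (b :+ c) := (a :+ b) :+ (c :+ c)) refl a b (½ ℚ.* ε))
    (cong ((a ℚ.+ b) ℚ.+_) (½ε+½ε ε))

-- The second factor is nonnegative termwise; this covers squares and rational constants.
0≤-* : ∀ {x y} → 0ℝ ≤ x → (∀ m → 0ℚ ℚ.≤ seq y m) → 0ℝ ≤ x * y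
0≤-* {x} {y} 0≤x 0≤y ε 0<ε = from (bounded y)
  where
  open +-*-Solver
  Goal : Set
  Goal = Eventually λ m → 0ℚ ℚ.< seq x m ℚ.* seq y m ℚ.+ ε
  below : ∀ {B δ} a b → 0ℚ ℚ.≤ b → b ℚ.≤ B → 0ℚ ℚ.< δ → 0ℚ ℚ.< a ℚ.+ δ →
    B ℚ.* δ ≡ ½ ℚ.* ε → 0ℚ ℚ.< a ℚ.* b ℚ.+ ε
  below {B} {δ} a b 0≤b b≤B 0<δ 0<a+δ Bδ = ℚ.≤-<-trans
    (subst₂ ℚ._≤_ (ℚ.*-zeroˡ b)
      (solve 3 (λ a b d → (a :+ d) :* b := a :* b :+ b :* d) refl a b δ)
      (ℚ.*-monoʳ-≤-nonNeg b {{ℚ.nonNegative 0≤b}} (ℚ.<⇒≤ 0<a+δ)))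
    (ℚ.+-monoʳ-< (a ℚ.* b) (ℚ.≤-<-trans
      (ℚ.≤-trans (ℚ.*-monoʳ-≤-nonNeg δ {{ℚ.nonNegative (ℚ.<⇒≤ 0<δ)}} b≤B) (ℚ.≤-reflexive Bδ))
      (subst₂ ℚ._<_ (ℚ.+-identityʳ _) (½ε+½ε ε) (ℚ.+-monoʳ-< (½ ℚ.* ε) (0<½ 0<ε)))))
  choose : ∀ {B} → Eventually (λ m → ℚ.∣ seq y m ∣ ℚ.≤ B) →
    (∃ λ δ → 0ℚ ℚ.< δ × B ℚ.* δ ≡ ½ ℚ.* ε) → Goal
  choose y≤B (δ , 0<δ , Bδ) = eventually-map
    (λ m (p , q) → below (seq x m) (seq y m) (0≤y m)
      (ℚ.≤-trans (p≤∣p∣ (seq y m)) q) 0<δ p Bδ)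
    (both (0≤x δ 0<δ) y≤B)
  from : (∃ λ B → Positive B × Eventually λ m → ℚ.∣ seq y m ∣ ℚ.≤ B) → Goal
  from (B , B>0 , y≤B) = choose y≤B (rescale B (½ ℚ.* ε) B>0 (0<½ 0<ε))

0≤-square : ∀ p → 0ℚ ℚ.≤ p ℚ.* p
0≤-square p = subst (0ℚ ℚ.≤_) (∣p∣*∣p∣≡p*p (ℚ.∣p∣≡p∨∣p∣≡-p p))
  (ℚ.nonNegative⁻¹ _ {{ℚ.nonNeg*nonNeg⇒nonNeg ℚ.∣ p ∣ {{∣p∣≥0}} ℚ.∣ p ∣ {{∣p∣≥0}}}})
  where
  open +-*-Solver
  ∣p∣≥0 : ℚ.NonNegative ℚ.∣ p ∣
  ∣p∣≥0 = ℚ.nonNegative (ℚ.0≤∣p∣ p)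
  ∣p∣*∣p∣≡p*p : ℚ.∣ p ∣ ≡ p ⊎ ℚ.∣ p ∣ ≡ ℚ.- p → ℚ.∣ p ∣ ℚ.* ℚ.∣ p ∣ ≡ p ℚ.* p
  ∣p∣*∣p∣≡p*p (inj₁ e) = cong₂ ℚ._*_ e e
  ∣p∣*∣p∣≡p*p (inj₂ e) = trans (cong₂ ℚ._*_ e e)
    (solve 1 (λ p → (:- p) :* (:- p) := p :* p) refl p)

-- Follows the recursion of `a times 1ℝ`, so that `seq-times` is an immediate induction.
ι : ℕ → ℚ
ι zero    = 0ℚ
ι (suc a) = 1ℚ ℚ.+ ι a

ι-+ : ∀ a b → ι (a ℕ.+ b) ≡ ι a ℚ.+ ι b
ι-+ zero    b = sym (ℚ.+-identityˡ (ι b))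
ι-+ (suc a) b = trans (cong (1ℚ ℚ.+_) (ι-+ a b)) (sym (ℚ.+-assoc 1ℚ (ι a) (ι b)))

ι-* : ∀ a b → ι (a ℕ.* b) ≡ ι a ℚ.* ι b
ι-* zero    b = sym (ℚ.*-zeroˡ (ι b))
ι-* (suc a) b = trans (ι-+ b (a ℕ.* b)) (trans (cong (ι b ℚ.+_) (ι-* a b))
  (solve 2 (λ a b → b :+ a :* b := (con 1ℚ :+ a) :* b) refl (ι a) (ι b)))
  where open +-*-Solver

0≤ι : ∀ a → 0ℚ ℚ.≤ ι a
0≤ι zero    = ℚ.≤-refl
0≤ι (suc a) = ℚ.+-mono-≤ (ℚ.<⇒≤ (ℚ.positive⁻¹ 1ℚ)) (0≤ι a)

ι-mono : ∀ {a b} → a ≤ᴺ b → ι a ℚ.≤ ι b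
ι-mono {b = b} ℕ.z≤n = 0≤ι b
ι-mono (ℕ.s≤s a≤b) = ℚ.+-monoʳ-≤ 1ℚ (ι-mono a≤b)

ι≡/1 : ∀ a → ι a ≡ + a / 1
ι≡/1 zero = refl
ι≡/1 (suc a) = trans (cong (1ℚ ℚ.+_) (ι≡/1 a)) (ℚ.toℚᵘ-injective
  (ℚᵘ.≃-trans (ℚ.toℚᵘ-homo-+ 1ℚ (+ a / 1))
  (ℚᵘ.≃-trans (ℚᵘ.+-congʳ ℚᵘ.1ℚᵘ (ℚ.toℚᵘ-fromℚᵘ (ℚᵘ.mkℚᵘ (+ a) 0)))
  (ℚᵘ.≃-trans (ℚᵘ.*≡* eq) (ℚᵘ.≃-sym (ℚ.toℚᵘ-fromℚᵘ (ℚᵘ.mkℚᵘ (+ suc a) 0)))))))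
  where
  eq : (ℤ.1ℤ ℤ.* ℤ.1ℤ ℤ.+ + a ℤ.* ℤ.1ℤ) ℤ.* ℤ.1ℤ ≡ + suc a ℤ.* (ℤ.1ℤ ℤ.* ℤ.1ℤ)
  eq = cong (ℤ._* ℤ.1ℤ) (cong (λ z → ℤ.1ℤ ℤ.+ z) (ℤ.*-identityʳ (+ a)))

-- On ℚ the operation `_/_` reduces to lowest terms; among unnormalised fractions the claim is a
-- cross multiplication of integers.
ι-/ : ∀ a b .{{_ : NonZero b}} → ι b ℚ.* (+ a / b) ≡ ι a
ι-/ a b@(suc b-1) = trans (cong₂ ℚ._*_ (ι≡/1 b) refl) (trans (ℚ.toℚᵘ-injective
  (ℚᵘ.≃-trans (ℚ.toℚᵘ-homo-* (+ b / 1) (+ a / b))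
  (ℚᵘ.≃-trans (ℚᵘ.*-cong (ℚ.toℚᵘ-fromℚᵘ (ℚᵘ.mkℚᵘ (+ b) 0)) (ℚ.toℚᵘ-fromℚᵘ (ℚᵘ.mkℚᵘ (+ a) b-1)))
  (ℚᵘ.≃-trans (ℚᵘ.*≡* eq) (ℚᵘ.≃-sym (ℚ.toℚᵘ-fromℚᵘ (ℚᵘ.mkℚᵘ (+ a) 0)))))))
  (sym (ι≡/1 a)))
  where
  eq : (+ b ℤ.* + a) ℤ.* ℤ.1ℤ ≡ + a ℤ.* (ℤ.1ℤ ℤ.* + b)
  eq = trans (ℤ.*-identityʳ _) (trans (ℤ.*-comm (+ b) (+ a))
    (cong (λ z → + a ℤ.* z) (sym (ℤ.*-identityˡ (+ b)))))

-- Comparing sums and products of reals would unfold the proofs of the Cauchy property,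
-- hence these opaque copies of the operations.
opaque

  add mul : ℝ → ℝ → ℝ
  add = _+_
  mul = _*_

  neg : ℝ → ℝ
  neg = -_

  add≡ : _+_ ≡ add
  add≡ = refl

  mul≡ : _*_ ≡ mul
  mul≡ = refl

  neg≡ : -_ ≡ neg
  neg≡ = refl

-- Matching on `refl` carries the ring laws over to the opaque operations without comparing the two
-- versions by computation.
opaque-isCommutativeRing : ∀ {_⊹_ _·_ : ℝ → ℝ → ℝ} {⊝ : ℝ → ℝ} → _+_ ≡ _⊹_ → _*_ ≡ _·_ → -_ ≡ ⊝ →
  IsCommutativeRing _≈_ _⊹_ _·_ ⊝ 0ℝ 1ℝ
opaque-isCommutativeRing refl refl refl = +-*-isCommutativeRing

ℝ-ring : CommutativeRing 0ℓ 0ℓ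
ℝ-ring = record { isCommutativeRing = opaque-isCommutativeRing add≡ mul≡ neg≡ }

open SemiringMult (CommutativeRing.semiring ℝ-ring) using () renaming (_×_ to _times_)

opaque
  unfolding add

  seq-times : ∀ a m → seq (a times 1ℝ) m ≡ ι a
  seq-times ℕ.zero    m = refl
  seq-times (ℕ.suc a) m = cong (ℚ._+_ ℚ.1ℚ) (seq-times a m)

0≤1/ : ∀ a .{{_ : NonZero a}} → ℚ.0ℚ ℚ.≤ + 1 / a
0≤1/ a = ℚ.nonNegative⁻¹ (+ 1 / a) {{ℚ.normalize-nonNeg 1 a}}

opaque
  unfolding add

  reciprocal : ∀ a .{{_ : NonZero a}} → ℝ
  reciprocal a = fromℚ (+ 1 / a)

  reciprocal-inverse : ∀ a .{{_ : NonZero a}} → mul (a times 1ℝ) (reciprocal a) ≈ 1ℝ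
  reciprocal-inverse a = pointwise (mul (a times 1ℝ) (fromℚ (+ 1 / a))) 1ℝ λ m →
    trans (cong (ℚ._* (+ 1 / a)) (seq-times a m)) (ι-/ 1 a)

  0≤-*-reciprocal : ∀ a .{{_ : NonZero a}} {x} → 0ℝ ≤ x → 0ℝ ≤ mul x (reciprocal a)
  0≤-*-reciprocal a {x} h = 0≤-* {x} {fromℚ (+ 1 / a)} h λ _ → 0≤1/ a

  fromℚ-reciprocal : ∀ a .{{_ : NonZero a}} → fromℚ (+ 1 / a) ≡ reciprocal a
  fromℚ-reciprocal a = refl

  0≤-add : ∀ {x y} → 0ℝ ≤ x → 0ℝ ≤ y → 0ℝ ≤ add x y
  0≤-add {x} {y} = 0≤-+ {x} {y}

ℝ-ordered : DivisibleOrderedRing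
ℝ-ordered = record
  { commutativeRing = ℝ-ring
  ; Nonneg = λ x → 0ℝ ≤ x
  ; nonneg-resp = λ {x} {y} → ≤-resp-≈ {x} {y}
  ; nonneg-+ = λ {x} {y} → 0≤-add {x} {y}
  ; nonneg-0 = 0≤-pointwise {0ℝ} λ _ → ℚ.≤-refl
  ; nonneg-1 = 0≤-pointwise {1ℝ} λ _ → ℚ.nonNegative⁻¹ ℚ.1ℚ
  ; 1/ = reciprocal
  ; 1/-inverse = reciprocal-inverse
  ; nonneg-1/ = λ a {x} → 0≤-*-reciprocal a {x}
  }

-- The two inclusions over the real numbers.

module 𝓡 = DivisibleOrderedRing ℝ-ordered
open 𝓡 using (↑_)
open Inclusion ℝ-ordered

open SemiringSum 𝓡.semiring using () renaming (sum to ∑ᴿ)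

total≡ : ∀ {_⊹_ : ℝ → ℝ → ℝ} → _+_ ≡ _⊹_ →
  (λ m (f : Fin m → ℝ) → ∑ f) ≡ (λ m f → Sums.sum (record { Carrier = ℝ ; _≈_ = _≈_ ; _∙_ = _⊹_ ; ε = 0ℝ }) f)
total≡ refl = refl

sub≡ : ∀ {_⊹_ : ℝ → ℝ → ℝ} {⊝ : ℝ → ℝ} → _+_ ≡ _⊹_ → -_ ≡ ⊝ → _-_ ≡ (λ x y → x ⊹ ⊝ y)
sub≡ refl refl = refl

-- In the next lemmas the operations are variables, so that add≡ and mul≡ are used by matching on refl.
private
  variable
    _⊛_ _⊖_ : ℝ → ℝ → ℝ
    total : ∀ m → (Fin m → ℝ) → ℝ
    r : ℝ

linear-to : _*_ ≡ _⊛_ → (λ m (f : Fin m → ℝ) → ∑ f) ≡ total → ∀ n (f : FunX n) (c : Fin (N n) → ℝ) →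
  (∀ x → f x ≈ ∑ (λ e → c e * point n x e)) → ∀ x → f x ≈ total (N n) (λ e → c e ⊛ point n x e)
linear-to refl refl n f c h = h

linear-from : _*_ ≡ _⊛_ → (λ m (f : Fin m → ℝ) → ∑ f) ≡ total → ∀ n (f : FunX n) (c : Fin (N n) → ℝ) →
  (∀ x → f x ≈ total (N n) (λ e → c e ⊛ point n x e)) → ∀ x → f x ≈ ∑ (λ e → c e * point n x e)
linear-from refl refl n f c h = h

average-to : _*_ ≡ _⊛_ → (λ m (f : Fin m → ℝ) → ∑ f) ≡ total → ∀ n → fromℚ ((+ 1 / ∣X∣ n) {{∣X∣-nonZero n}}) ≡ r →
  ∀ (K : ℝ → Set) (f : FunX n) → K (average n f) → K (r ⊛ total (∣X∣ n) f)
average-to refl refl n refl K f h = h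

average-from : _*_ ≡ _⊛_ → (λ m (f : Fin m → ℝ) → ∑ f) ≡ total → ∀ n → fromℚ ((+ 1 / ∣X∣ n) {{∣X∣-nonZero n}}) ≡ r →
  ∀ (K : ℝ → Set) (f : FunX n) → K (r ⊛ total (∣X∣ n) f) → K (average n f)
average-from refl refl n refl K f h = h

squares-to : _*_ ≡ _⊛_ → (λ m (f : Fin m → ℝ) → ∑ f) ≡ total → ∀ n → fromℚ ((+ 1 / ∣X∣ n) {{∣X∣-nonZero n}}) ≡ r →
  ∀ (f g : FunX n) → 0ℝ ≤ average n (λ x → f x * (g x * g x)) → 0ℝ ≤ (r ⊛ total (∣X∣ n) (λ x → f x ⊛ (g x ⊛ g x)))
squares-to refl refl n refl f g h = h

scaled-from : _*_ ≡ _⊛_ → _-_ ≡ _⊖_ → ∀ n (a : ℝ) (f f′ : FunX n) →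
  (∀ x → (f x ⊖ 1ℝ) ≈ (a ⊛ (f′ x ⊖ 1ℝ))) → ∀ x → f x - 1ℝ ≈ a * (f′ x - 1ℝ)
scaled-from refl refl n a f f′ h = h

average-reciprocal : ∀ n → fromℚ ((+ 1 / ∣X∣ n) {{∣X∣-nonZero n}}) ≡ reciprocal (∣X∣ n) {{∣X∣-nonZero n}}
average-reciprocal n = fromℚ-reciprocal (∣X∣ n) {{∣X∣-nonZero n}}

nonneg-average : ∀ n {f : FunX n} → (∀ x → 0ℝ ≤ f x) → 0ℝ ≤ average n f
nonneg-average n {f} h = average-from mul≡ (total≡ add≡) n (average-reciprocal n) (0ℝ ≤_) f
  (≤-resp-≈ {mul (∑ᴿ f) c} {mul c (∑ᴿ f)} (𝓡.*-comm (∑ᴿ f) c)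
    (0≤-*-reciprocal (∣X∣ n) {{∣X∣-nonZero n}} {∑ᴿ f} (nonneg-∑ {f = f} h)))
  where
  c : ℝ
  c = reciprocal (∣X∣ n) {{∣X∣-nonZero n}}

Q⊆P : ∀ n k → (Q n -𝟙) ⊆ (P n k -𝟙)
Q⊆P n k (f , (linear , nonneg , avg) , g≈) =
  f , (linear , avg , λ h → nonneg-average n λ x →
    -- Each term of the sequence of the squared value is the square of a rational.
    0≤-* {f x} {eval h (point n x) * eval h (point n x)} (nonneg x) λ m → 0≤-square (seq (eval h (point n x)) m)) , g≈

if-value : ∀ c → (if c then 1ℝ else 0ℝ) ≈ ↑ ⟦ c ⟧
if-value true  = 𝓡.sym {↑ 1} {1ℝ} (LowerBound.↑-1 ℝ-ordered)
if-value false = ≈-refl {0ℝ}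

opaque
  unfolding add

  -- Characterises a = n/k + 10/n by k n a = n² + 10k, the form in which the second inclusion uses
  -- it.
  scale-value : ∀ n k .{{_ : NonZero n}} .{{_ : NonZero k}} {p α : ℝ} → fromℚ (+ n / k) ≡ p → fromℚ (+ 10 / n) ≡ α →
    mul (↑ (k ℕ.* n)) (p + α) ≈ ↑ (n ℕ.* n ℕ.+ 10 ℕ.* k)
  scale-value n k refl refl = pointwise (↑ (k ℕ.* n) * (fromℚ (+ n / k) + fromℚ (+ 10 / n))) (↑ (n ℕ.* n ℕ.+ 10 ℕ.* k)) λ m →
    trans (cong (ℚ._* (+ n / k ℚ.+ + 10 / n)) (trans (seq-times (k ℕ.* n) m) (ι-* k n)))
    (trans (solve 4 (λ k n p q → k :* n :* (p :+ q)
         := n :* (k :* p) :+ (n :* q) :* k) refl (ι k) (ι n) (+ n / k) (+ 10 / n))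
    (trans (cong₂ ℚ._+_ (trans (cong (ι n ℚ.*_) (ι-/ n k)) (sym (ι-* n n))) (trans (cong (ℚ._* ι k) (ι-/ 10 n)) (sym (ι-* 10 k))))
    (trans (sym (ι-+ (n ℕ.* n) (10 ℕ.* k))) (sym (seq-times (n ℕ.* n ℕ.+ 10 ℕ.* k) m)))))
    where open +-*-Solver

∣α∣-bound : ∀ n .{{_ : NonZero n}} {α : ℝ} → fromℚ (+ 10 / n) ≡ α → ∣ α ∣ ≤ α
∣α∣-bound n refl ε 0<ε = always λ _ → subst (ℚ._< + 10 / n ℚ.+ ε)
  (sym (ℚ.0≤p⇒∣p∣≡p (ℚ.nonNegative⁻¹ (+ 10 / n) {{ℚ.normalize-nonNeg 10 n}})))
  (subst (ℚ._< + 10 / n ℚ.+ ε) (ℚ.+-identityʳ _) (ℚ.+-monoʳ-< (+ 10 / n) 0<ε))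

module _ (n k : ℕ) .{{_ : NonZero n}} .{{_ : NonZero k}} (9≤n : 9 ≤ᴺ n) (k≤n/2 : k ≤ᴺ ⌊ n /2⌋) where

  private
    facts = next-facts n (ℕ.≤-trans (ℕ.s≤s (ℕ.s≤s (ℕ.s≤s (ℕ.s≤s ℕ.z≤n)))) 9≤n)
    module T = Tours n (proj₁ facts) (proj₁ (proj₂ facts)) (proj₁ (proj₂ (proj₂ facts))) (proj₂ (proj₂ (proj₂ facts)))

    src tgt : Fin (N n) → Fin n
    src e = proj₁ (edge n e)
    tgt e = proj₂ (edge n e)

    bit : Fin (∣X∣ n) → Fin (N n) → Bool
    bit x e = Vec.lookup (List.lookup (X n) x) e

    point-bit : ∀ x e → point n x e ≈ ↑ ⟦ bit x e ⟧
    point-bit x e = if-value (bit x e)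

    ↑-≡ : ∀ {y a b} → y ≈ ↑ a → a ≡ b → y ≈ ↑ b
    ↑-≡ h refl = h

    vertex : Fin n
    vertex = Fin.fromℕ< {0} (ℕ.>-nonZero⁻¹ n)

    degree : ∀ x → sum (λ e → (δ vertex (src e) ℕ.+ δ vertex (tgt e)) ℕ.* T.b x (src e) (tgt e)) ≡ 2
    degree x = trans (incident-sum n (T.b x) (CycleSystem.b-sym T.cycles x) (CycleSystem.b-irrefl T.cycles x) vertex)
      (CycleSystem.b-degree T.cycles x vertex)

    point-value : ∀ x e → point n x e ≈ ↑ T.b x (src e) (tgt e)
    point-value x e = ↑-≡ {point n x e} (point-bit x e) (T.b-edge x e)

    index : ∀ {u v} → u ≢ v → ∃ λ e → ∀ x → point n x e ≈ ↑ T.b x u v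
    index u≢v = proj₁ (T.edge-index u≢v) , λ x →
      ↑-≡ {point n x _} (point-bit x _) (T.b-joins x _ (proj₂ (T.edge-index u≢v)))

    certificates : ∀ x → Certificate T.cycles k x
    certificates x = certificate T.cycles (proj₁ facts) k x (T.π x) (T.b-tour x) 9≤n (ℕ.>-nonZero⁻¹ k) k≤n/2

    opaque
      unfolding add

      -- Positive semidefiniteness is tested only on polynomials with a single term of coefficient
      -- 1.
      square : Vec≤ (Fin (N n)) k → FunX n
      square m x = eval ((1ℝ , m) List.∷ List.[]) (point n x)

      square-monomial : ∀ m x → square m x ≈ monomial (point n x) m
      square-monomial m x = pointwise (1ℝ * p + 0ℝ) p λ i →
        trans (ℚ.+-identityʳ _) (ℚ.*-identityˡ (seq p i))
        where
        p : ℝ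
        p = monomial (point n x) m

      square-eval : ∀ m → (λ x → eval ((1ℝ , m) List.∷ List.[]) (point n x)) ≡ square m
      square-eval m = refl

    psd-square : ∀ {f} → (∀ (h : Poly (N n) k) → 0ℝ ≤ q n f h) →
      ∀ m → 0ℝ ≤ average n (λ x → f x * (square m x * square m x))
    psd-square {f} psd m = subst (λ h → 0ℝ ≤ average n (λ x → f x * (h x * h x))) (square-eval m)
      (psd ((1ℝ , m) List.∷ List.[]))

    shrunk : ∀ a f → mul (↑ (k ℕ.* n)) a ≈ ↑ (n ℕ.* n ℕ.+ 10 ℕ.* k) → f ∈ P n k →
      ∃ λ (f′ : FunX n) → IsLinear n f′ × (∀ x → 0ℝ ≤ f′ x) × average n f′ ≈ 1ℝ × (∀ x → f x - 1ℝ ≈ a * (f′ x - 1ℝ))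
    shrunk a f a-value ((c , linear) , avg , psd) = restate (Shrink.shrink T.cycles k {{X≢0 = ∣X∣-nonZero n}} certificates src tgt T.edge-≢
      (point n) point-value index
      (one-linear (λ v e → δ v (src e) ℕ.+ δ v (tgt e)) (point n)
        (λ x e → T.b x (src e) (tgt e)) point-value vertex degree)
      c f (linear-to mul≡ (total≡ add≡) n f c linear)
      (average-to mul≡ (total≡ add≡) n (average-reciprocal n) (_≈ 1ℝ) f avg) square square-monomial
      (λ m → squares-to mul≡ (total≡ add≡) n (average-reciprocal n) f (square m) (psd-square {f} psd m)) a a-value)
      where
      restate : (∃ λ (f′ : FunX n) → (∃ λ (c : Fin (N n) → ℝ) → ∀ x → f′ x ≈ ∑ᴿ (λ e → mul (c e) (point n x e))) × (∀ x → 0ℝ ≤ f′ x) ×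
          mul (reciprocal (∣X∣ n) {{∣X∣-nonZero n}}) (∑ᴿ f′) ≈ 1ℝ × (∀ x → add (f x) (neg 1ℝ) ≈ mul a (add (f′ x) (neg 1ℝ)))) →
        ∃ λ (f′ : FunX n) → IsLinear n f′ × (∀ x → 0ℝ ≤ f′ x) × average n f′ ≈ 1ℝ × (∀ x → f x - 1ℝ ≈ a * (f′ x - 1ℝ))
      restate (f′ , (c′ , linear) , nonneg , avg , scaled) =
        f′ , (c′ , linear-from mul≡ (total≡ add≡) n f′ c′ linear) ,
          nonneg , average-from mul≡ (total≡ add≡) n (average-reciprocal n) (_≈ 1ℝ) f′ avg
        , scaled-from mul≡ (sub≡ add≡ neg≡) n a f f′ scaled

  P⊆aQ : ∀ a → mul (↑ (k ℕ.* n)) a ≈ ↑ (n ℕ.* n ℕ.+ 10 ℕ.* k) → (P n k -𝟙) ⊆ a · (Q n -𝟙)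
  P⊆aQ a a-value {g} (f , f∈P , g≈) = from-shrunk (shrunk a f a-value f∈P)
    where
    from-shrunk : (∃ λ (f′ : FunX n) → IsLinear n f′ × (∀ x → 0ℝ ≤ f′ x) × average n f′ ≈ 1ℝ × (∀ x → f x - 1ℝ ≈ a * (f′ x - 1ℝ))) →
      g ∈ a · (Q n -𝟙)
    from-shrunk (f′ , linear , nonneg , avg , scaled) =
      (λ x → f′ x - 1ℝ) , (f′ , (linear , nonneg , avg) , λ x → ≈-refl {f′ x - 1ℝ})
      , λ x → ≈-trans {g x} {f x - 1ℝ} {a * (f′ x - 1ℝ)} (g≈ x) (scaled x)

-- The fractions n/k and 10/n are replaced by variables with equations; only the two lemmas about
-- their values unfold them.
sandwich : ∀ n k .{{_ : NonZero n}} .{{_ : NonZero k}} → 9 ≤ᴺ n → k ≤ᴺ ⌊ n /2⌋ → ∀ {p α : ℝ} →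
  fromℚ (+ n / k) ≡ p → fromℚ (+ 10 / n) ≡ α →
  ∃[ a ] ∃[ α′ ] (a ≈ p + α′ × ∣ α′ ∣ ≤ α × (Q n -𝟙) ⊆ (P n k -𝟙) × (P n k -𝟙) ⊆ a · (Q n -𝟙))
sandwich n k 9≤n k≤n/2 {p} {α} p≡ α≡ =
  p + α , α , ≈-refl {p + α} , ∣α∣-bound n α≡ , (λ {g} → Q⊆P n k {g})
  , (λ {g} → P⊆aQ n k 9≤n k≤n/2 (p + α) (scale-value n k p≡ α≡) {g})

theorem1 : ∀ (n k : ℕ) .{{_ : NonZero n}} .{{_ : NonZero k}} → 9 ≤ᴺ n → k ≤ᴺ ⌊ n /2⌋ →
    ∃[ a ] ∃[ α ] (a ≈ fromℚ (+ n / k) + α × ∣ α ∣ ≤ fromℚ (+ 10 / n)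
    × (Q n -𝟙) ⊆ (P n k -𝟙) × (P n k -𝟙) ⊆ a · (Q n -𝟙))
theorem1 n k 9≤n k≤n/2 = sandwich n k 9≤n k≤n/2 refl refl
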